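{- For every integer $k$ and nonnegative integer $n$, \[ \mathrm{sroots}_k^{B_n}=\sum_{C\in\mathrm{Conj}(B_n):\,C^k=\{w_0\}}\psi^C, \] where $w_0\in B_n$ is given by $w_0(i)=-i$, $C^k=\{x^k:x\in C\}$, and $\mathrm{sroots}_k^{B_n}(y)=\sum_{x\in B_n,\,x^k=y}\chi(x)$.
   Context: $B_n$ is the group of bijections $w$ of $\{\pm1,\dots,\pm n\}$ with $w(-i)=-w(i)$. $\chi$ is the linear character of $B_n$ with $\chi(w)=\prod_{i=1}^n\mathrm{sign}(w(i))$. Cycles: if $c=(a_1,\dots,a_\ell)$ is a cycle of $w$ on $\{\pm1,\dots,\pm n\}$ so is $\bar c$ (negated entries); if $c\ne\bar c$, $c\bar c$ is a cycle of length $\ell$ and $\mathbb Z_2$-class $+1$; if $c=\bar c$, a cycle of length $\ell/2$ and class $-1$. Higher Lie characters $\psi^C$: for $x\in C$ with $a_{i,\varepsilon}$ cycles of length $i$ and class $\varepsilon$, $Z_{B_n}(x)\cong\prod_{i,\varepsilon}G_{i,\varepsilon}\wr S_{a_{i,\varepsilon}}$, where $G_{i,+}\cong\mathbb Z_2\times\mathbb Z_i$ is the centralizer in $B_i$ of one cycle of length $i$ and class $+1$ ($\mathbb Z_2$ generated by $[-1,\dots,-i]$, $\mathbb Z_i$ by the cycle) and $G_{i,- }\cong\mathbb Z_{2i}$ is generated by one cycle of length $i$ and class $-1$. $\omega_{i,+}$ is the linear character of $G_{i,+}\wr S_a$ equal on the base group to the product over factors of (trivial on $\mathbb Z_2$)$\times$(faithful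 linear character of $\mathbb Z_i$) and trivial on the complement $S_a$; $\omega_{i,- }$ is the product over base factors of a faithful linear character of $\mathbb Z_{2i}$, trivial on $S_a$; $\omega^x=\bigotimes\omega_{i,\varepsilon}$ and $\psi^C=\mathrm{Ind}_{Z_{B_n}(x)}^{B_n}\omega^x$. -}

module Defs where

open import Level using (Level)
open import Data.Bool using (Bool; true; false; not; _∧_; _∨_; _xor_; if_then_else_)
open import Data.Nat using (ℕ; zero; suc; _+_; _*_; _≡ᵇ_; _<ᵇ_; _≤ᵇ_; _!)
open import Data.Nat.DivMod using (_/_)
open import Data.Integer using (ℤ; +_; -[1+_])
open import Data.Fin using (Fin; toℕ)
open import Data.Product using (_×_; _,_; proj₁; proj₂)
open import Data.Maybe using (Maybe; just; nothing)
open import Data.List using (List; []; _∷_; map; concatMap; filterᵇ; allFin; foldr; upTo; length)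
open import Data.Bool.ListAction using (all; any)
open import Data.Vec using (Vec; []; _∷_; lookup; tabulate)
open import Algebra.Bundles using (CommutativeRing)

-- The hyperoctahedral group B_n, concretely.
-- A signed point of {±1,…,±n} is (i , s) with i : Fin n and s = true
-- meaning the negative point -(i+1).  An element w of B_n is stored by its
-- values on the positive points: w (i , false) = lookup w i ; the value on
-- negative points is forced by w(-i) = -w(i).

SP : ℕ → Set
SP n = Fin n × Bool

negSP : ∀ {n} → SP n → SP n
negSP (i , s) = (i , not s)

W : ℕ → Set
W n = Vec (SP n) n

eqFin : ∀ {n} → Fin n → Fin n → Bool
eqFin i j = toℕ i ≡ᵇ toℕ j

eqBool : Bool → Bool → Bool
eqBool a b = not (a xor b)

eqSP : ∀ {n} → SP n → SP n → Bool
eqSP (i , s) (j , t) = eqFin i j ∧ eqBool s t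

eqW : ∀ {n} → W n → W n → Bool
eqW {n} v w = all (λ i → eqSP (lookup v i) (lookup w i)) (allFin n)

app : ∀ {n} → W n → SP n → SP n
app w (i , s) with lookup w i
... | (j , t) = (j , s xor t)

_·_ : ∀ {n} → W n → W n → W n
w · v = tabulate (λ i → app w (lookup v i))

infixl 7 _·_

idW : ∀ {n} → W n
idW = tabulate (λ i → (i , false))

w0 : ∀ {n} → W n
w0 = tabulate (λ i → (i , true))

isBn : ∀ {n} → W n → Bool
isBn {n} w = all (λ i → all (λ j → not (eqFin (proj₁ (lookup w i)) (proj₁ (lookup w j))) ∨ eqFin i j)
                            (allFin n)) (allFin n)

allVec : ∀ {A : Set} → List A → (m : ℕ) → List (Vec A m)
allVec as zero = [] ∷ []
allVec as (suc m) = concatMap (λ a → map (a ∷_) (allVec as m)) as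

allSP : (n : ℕ) → List (SP n)
allSP n = concatMap (λ i → (i , false) ∷ (i , true) ∷ []) (allFin n)

Bn : (n : ℕ) → List (W n)
Bn n = filterᵇ isBn (allVec (allSP n) n)

findFin : ∀ {n} → (Fin n → Bool) → List (Fin n) → Maybe (Fin n)
findFin p [] = nothing
findFin p (i ∷ is) = if p i then just i else findFin p is

inv : ∀ {n} → W n → W n
inv {n} w = tabulate λ j → h j (findFin (λ i → eqFin (proj₁ (lookup w i)) j) (allFin n))
  where
  h : Fin n → Maybe (Fin n) → SP n
  h j (just i) = (i , proj₂ (lookup w i))
  h j nothing = (j , false)

powℕ : ∀ {n} → W n → ℕ → W n
powℕ x zero = idW
powℕ x (suc m) = x · powℕ x m

powℤ : ∀ {n} → W n → ℤ → W n
powℤ x (+ m) = powℕ x m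
powℤ x -[1+ m ] = powℕ (inv x) (suc m)

-- the sign character χ(w) = ∏ sign(w(i)) : true iff χ(w) = -1
χneg : ∀ {n} → W n → Bool
χneg {n} w = foldr (λ i b → b xor proj₂ (lookup w i)) false (allFin n)

conjugate : ∀ {n} → W n → W n → Bool
conjugate {n} a b = any (λ g → eqW (g · a · inv g) b) (Bn n)

repsGo : ∀ {n} → List (W n) → List (W n) → List (W n)
repsGo acc [] = []
repsGo acc (x ∷ xs) =
  if any (λ r → conjugate r x) acc then repsGo acc xs else x ∷ repsGo (x ∷ acc) xs

ConjReps : (n : ℕ) → List (W n)
ConjReps n = repsGo [] (Bn n)

classPowIsW0 : ∀ {n} → ℤ → W n → Bool
classPowIsW0 {n} k x = all (λ g → eqW (powℤ (g · x · inv g) k) w0) (Bn n)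

inZ : ∀ {n} → W n → W n → Bool
inZ x z = eqW (x · z) (z · x)

transGo : ∀ {n} → W n → List (W n) → List (W n) → List (W n)
transGo x acc [] = []
transGo x acc (g ∷ gs) =
  if any (λ t → inZ x (inv t · g)) acc then transGo x acc gs else g ∷ transGo x (g ∷ acc) gs

transversal : ∀ {n} → W n → List (W n)
transversal {n} x = transGo x [] (Bn n)

-- The linear character ω^x of Z_{B_n}(x), as an exponent of a fixed
-- primitive N-th root of unity ζ, N = (2n)!.  Every cycle of x on
-- {±1,…,±n} has length ℓ ≤ 2n, so ℓ ∣ N and ζ^(N/ℓ) is a primitive ℓ-th
-- root of unity; the faithful character of Z_ℓ (resp. Z_{2i}) sends the
-- cycle to ζ^(N/ℓ).

Nord : ℕ → ℕ
Nord n = (2 * n) !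

iter : ∀ {n} → W n → ℕ → SP n → SP n
iter x zero p = p
iter x (suc m) p = app x (iter x m p)

findℕ : (ℕ → Bool) → List ℕ → Maybe ℕ
findℕ p [] = nothing
findℕ p (m ∷ ms) = if p m then just m else findℕ p ms

cycLenPred : ∀ {n} → W n → SP n → ℕ
cycLenPred {n} x p with findℕ (λ m → eqSP (iter x (suc m) p) p) (upTo (2 * n))
... | just m = m
... | nothing = 0

-- the positive point (i , false) is the base point of its cycle of x
-- (the cycle c ∪ c̄ contains no point of smaller absolute value)
isBase : ∀ {n} → W n → Fin n → Bool
isBase {n} x i = all (λ m → toℕ i ≤ᵇ toℕ (proj₁ (iter x m (i , false)))) (upTo (2 * n))

classMinus : ∀ {n} → W n → Fin n → Bool
classMinus {n} x i = any (λ m → eqSP (iter x m (i , false)) (i , true)) (upTo (2 * n))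

baseOf : ∀ {n} → W n → SP n → Fin n
baseOf {n} x q with findFin (λ j → any (λ m → eqFin (proj₁ (iter x m q)) j) (upTo (2 * n))) (allFin n)
... | just j = j
... | nothing = proj₁ q

-- wreath-product coordinate of z on the cycle with base point i:
-- z(i) = ε · x^r (i') with i' the base point of the image cycle; r taken mod ℓ
coordR : ∀ {n} → W n → W n → Fin n → ℕ
coordR {n} x z i with findℕ ok (upTo (suc (cycLenPred x (i , false))))
  where
  q : SP n
  q = app z (i , false)
  P' : SP n
  P' = (baseOf x q , false)
  ok : ℕ → Bool
  ok r = eqSP (iter x r P') q ∨ (not (classMinus x i) ∧ eqSP (iter x r P') (negSP q))
... | just r = r
... | nothing = 0

ωexp : ∀ {n} → W n → W n → ℕ
ωexp {n} x z = foldr (λ i acc → (if isBase x i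
                                   then coordR x z i * (Nord n / suc (cycLenPred x (i , false)))
                                   else 0) + acc) 0 (allFin n)

module _ {c ℓ : Level} (R : CommutativeRing c ℓ) where
  open CommutativeRing R using (Carrier; 1#; 0#) renaming (_+_ to _+R_; _*_ to _*R_; -_ to -R_)

  powR : Carrier → ℕ → Carrier
  powR a zero = 1#
  powR a (suc m) = a *R powR a m

  sumR : List Carrier → Carrier
  sumR = foldr _+R_ 0#

  sroots : ℤ → (n : ℕ) → W n → Carrier
  sroots k n y = sumR (map (λ x → if χneg x then -R 1# else 1#)
                           (filterᵇ (λ x → eqW (powℤ x k) y) (Bn n)))

  -- ψ^C(y) = Ind_{Z(x)}^{B_n} ω^x (y) = Σ_{t ∈ T} ω^x°(t⁻¹ y t), x the representative of C
  ψ : Carrier → (n : ℕ) → W n → W n → Carrier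
  ψ ζ n x y = sumR (map (λ t → if inZ x (inv t · y · t) then powR ζ (ωexp x (inv t · y · t)) else 0#)
                        (transversal x))

  sumψ : Carrier → ℤ → (n : ℕ) → W n → Carrier
  sumψ ζ k n y = sumR (map (λ x → ψ ζ n x y) (filterᵇ (classPowIsW0 k) (ConjReps n)))

  natR : ℕ → Carrier
  natR zero = 0#
  natR (suc m) = 1# +R natR m

-- Unfolding the induced characters turns the right-hand side into a sum of ω^x(y)
-- over the x with x^K = w₀ commuting with y; the left-hand side is a sum of χ(x)
-- over the x with x^K = y, which also commute with y. Both summands are products
-- over the orbits of ⟨x, y⟩, so one may trade the first weight for the second one
-- orbit at a time, averaging over the multiplications of x by ± powers of y on a
-- single y-cycle of the orbit. If this cycle has period D and x returns to it after
-- t steps as −y^s, with K = t k, then for k odd the weight ω is, up to a common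
-- sign, ζ_D^{s*} where s ↦ s* is an involution of {s mod D : k s = 0}, and the
-- identity to prove is #{s : k s = 1} = Σ_{k s = 0} ζ_D^s, which is Fourier
-- inversion on Z/D. For k even the two signs of the return cancel in both sums.

module Submission where

open import Defs
open import Level using (Level; _⊔_)
open import Data.Bool using (Bool; T; true; false; not; _∧_; _∨_; _xor_; if_then_else_)
open import Data.Bool.ListAction using (all; any)
import Data.Bool.Properties as Boolₚ
open import Data.Nat using (ℕ; zero; suc; _+_; _*_; _∸_; _≤_; _<_; z≤n; s≤s; NonZero; _!; _≡ᵇ_; _<ᵇ_; _≤ᵇ_; >-nonZero)
open import Data.Nat.DivMod using (_/_; _%_)
import Data.Nat.DivMod as DivMod
import Data.Nat.Properties as ℕₚ
open import Data.Nat.Divisibility using (_∣_; divides; _∣?_)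
import Data.Nat.Divisibility as Div
open import Data.Fin using (Fin; toℕ; fromℕ<)
open import Data.Product using (∃; _×_; _,_; proj₁; proj₂)
open import Data.Sum using (_⊎_; inj₁; inj₂)
open import Data.Maybe using (Maybe; just; nothing; fromMaybe)
open import Data.List using (List; []; _∷_; map; concatMap; filterᵇ; foldr; upTo; applyUpTo; allFin; _++_)
import Data.List.Properties as Listₚ
import Data.List as List
open import Data.List.Membership.Propositional using (_∈_)
import Data.List.Membership.Propositional as Mem
import Data.List.Membership.Propositional.Properties as Memₚ
open import Data.List.Relation.Unary.Any using (here; there)
open import Data.List.Relation.Unary.All using (All; []; _∷_)
import Data.List.Relation.Unary.All as All
open import Data.List.Relation.Unary.AllPairs using ([]; _∷_)
open import Data.List.Relation.Unary.Unique.Propositional using (Unique)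
import Data.List.Relation.Unary.Unique.Propositional.Properties as Uniqueₚ
open import Data.List.Membership.Propositional.Properties.WithK using (unique∧set⇒bag)
open import Data.List.Relation.Binary.BagAndSetEquality using (∼bag⇒↭)
open import Data.List.Relation.Binary.Permutation.Propositional using (_↭_)
import Data.List.Relation.Binary.Permutation.Propositional as Perm
open import Data.Empty using (⊥; ⊥-elim)
open import Function using (_∘_; id; _∋_)
open import Function.Bundles using (mk⇔)
open import Relation.Nullary using (¬_; Dec; yes; no)
open import Relation.Binary.PropositionalEquality using (_≡_; _≢_; refl; sym; trans; cong; cong₂; subst; subst₂)
open import Algebra.Bundles using (CommutativeRing; CommutativeMonoid)
open import Data.Vec using (Vec; lookup; tabulate)
import Data.Vec.Base as Vec
import Data.Vec.Properties as Vecₚ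
import Data.Fin as Fin
import Data.Fin.Properties as Finₚ
import Data.Bool as Bool
open import Data.Unit using (tt)
open import Data.Integer using (ℤ)
import Data.Integer as ℤ
import Data.Product.Properties as Productₚ
import Algebra.Solver.CommutativeMonoid as CMSolver
open import Data.Nat.Tactic.RingSolver using (solve-∀)
open import Data.Nat.GCD using (gcd; gcd-GCD; GCD; module GCD; module Bézout)

-- No bijection underlies the equality: for a single x the two weights are unrelated, and only
-- averages agree. Right multiplication of x by (-1)^b y^a on one y-cycle permutes the centralizer
-- of y, fixes the orbits of ⟨x, y⟩, the action outside the chosen orbit and the return time t, and
-- moves the return data (s, sign) to (s + a, sign + b). All return data thus occur equally often.
-- Undoing the average means cancelling 2D, hence a domain of characteristic zero. The involution
-- arises because the x-cycle of the chosen point has length 2bt, b being the order of s in Z/D;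
-- finding the least power of y on that cycle as a power of x inverts 2s/gcd(s, D) modulo b, or
-- 4s/gcd(s, D) if the y-cycle has class -1. This is possible since b divides the odd number k. A
-- second obstacle is that ω^x is defined through base points, which conjugation does not respect;
-- ratios of roots of unity that are constant along cycles remove the dependence. The number N =
-- (2n)! is a multiple of all cycle lengths, so x^N = 1, and x^(N-1) replaces the inverse of x: one
-- natural exponent K does the work of the integer exponent.

private variable
  α β : Level
  𝒜 : Set α
  ℬ : Set β
  n : ℕ

-- Booleans, lists and periods

true≢false : ∀ {x} → x ≡ true → x ≡ false → ⊥
true≢false refl ()

≢true⇒false : ∀ {x} → ¬ x ≡ true → x ≡ false
≢true⇒false {true} h = ⊥-elim (h refl)
≢true⇒false {false} h = refl

not-true : ∀ {x} → not x ≡ true → x ≡ false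
not-true {false} _ = refl

⇔⇒≡ᵇ : ∀ {x y} → (x ≡ true → y ≡ true) → (y ≡ true → x ≡ true) → x ≡ y
⇔⇒≡ᵇ {true} f g = sym (f refl)
⇔⇒≡ᵇ {false} {false} f g = refl
⇔⇒≡ᵇ {false} {true} f g = g refl

∧-true : ∀ {x y} → x ∧ y ≡ true → x ≡ true × y ≡ true
∧-true {true} h = refl , h

any-true : ∀ (p : 𝒜 → Bool) xs → any p xs ≡ true → ∃ λ x → x ∈ xs × p x ≡ true
any-true p (x ∷ xs) h with p x in eq
... | true = x , here refl , eq
... | false with any-true p xs h
...   | y , y∈ , py = y , there y∈ , py

true-any : ∀ (p : 𝒜 → Bool) {x} xs → x ∈ xs → p x ≡ true → any p xs ≡ true
true-any p (x ∷ xs) (here refl) px rewrite px = refl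
true-any p (x ∷ xs) (there m) px rewrite true-any p xs m px = Boolₚ.∨-zeroʳ (p x)

all-true : ∀ (p : 𝒜 → Bool) xs → all p xs ≡ true → ∀ {x} → x ∈ xs → p x ≡ true
all-true p (x ∷ xs) h (here refl) = proj₁ (∧-true h)
all-true p (x ∷ xs) h (there m) = all-true p xs (proj₂ (∧-true {p x} h)) m

true-all : ∀ (p : 𝒜 → Bool) xs → (∀ {x} → x ∈ xs → p x ≡ true) → all p xs ≡ true
true-all p [] h = refl
true-all p (x ∷ xs) h rewrite h (here refl) = true-all p xs (h ∘ there)

any-cong : ∀ {p q : 𝒜 → Bool} → (∀ x → p x ≡ q x) → ∀ xs → any p xs ≡ any q xs
any-cong e [] = refl
any-cong e (x ∷ xs) = cong₂ _∨_ (e x) (any-cong e xs)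

all-cong : ∀ {p q : 𝒜 → Bool} → (∀ x → p x ≡ q x) → ∀ xs → all p xs ≡ all q xs
all-cong e [] = refl
all-cong e (x ∷ xs) = cong₂ _∧_ (e x) (all-cong e xs)

∈-filterᵇ⁻ : ∀ (p : 𝒜 → Bool) xs {x} → x ∈ filterᵇ p xs → x ∈ xs × p x ≡ true
∈-filterᵇ⁻ p (y ∷ xs) m with p y in eq
∈-filterᵇ⁻ p (y ∷ xs) (here refl) | true = here refl , eq
∈-filterᵇ⁻ p (y ∷ xs) (there m) | true with ∈-filterᵇ⁻ p xs m
... | m′ , px = there m′ , px
∈-filterᵇ⁻ p (y ∷ xs) m | false with ∈-filterᵇ⁻ p xs m
... | m′ , px = there m′ , px

∈-filterᵇ⁺ : ∀ (p : 𝒜 → Bool) xs {x} → x ∈ xs → p x ≡ true → x ∈ filterᵇ p xs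
∈-filterᵇ⁺ p (y ∷ xs) (here refl) px rewrite px = here refl
∈-filterᵇ⁺ p (y ∷ xs) (there m) px with p y
... | true = there (∈-filterᵇ⁺ p xs m px)
... | false = ∈-filterᵇ⁺ p xs m px

filterᵇ-unique : ∀ (p : 𝒜 → Bool) {xs} → Unique xs → Unique (filterᵇ p xs)
filterᵇ-unique p {[]} u = []
filterᵇ-unique p {x ∷ xs} (h ∷ u) with p x
... | false = filterᵇ-unique p u
... | true = All.tabulate (λ m → All.lookup h (proj₁ (∈-filterᵇ⁻ p xs m))) ∷ filterᵇ-unique p u

map-unique : ∀ (f : 𝒜 → ℬ) {xs} → Unique xs → (∀ {x y} → x ∈ xs → y ∈ xs → f x ≡ f y → x ≡ y) → Unique (map f xs)
map-unique f {[]} u inj = []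
map-unique f {x ∷ xs} (h ∷ u) inj = All.tabulate fresh ∷ map-unique f u (λ p q → inj (there p) (there q))
  where
  fresh : ∀ {y} → y ∈ map f xs → f x ≢ y
  fresh m e with Memₚ.∈-map⁻ f m
  ... | z , z∈ , refl = All.lookup h z∈ (inj (here refl) (there z∈) e)

concatMap-unique : ∀ (f : 𝒜 → List ℬ) {xs} → Unique xs → (∀ {x} → x ∈ xs → Unique (f x)) →
  (∀ {x y z} → x ∈ xs → y ∈ xs → z ∈ f x → z ∈ f y → x ≡ y) → Unique (concatMap f xs)
concatMap-unique f {[]} u uf dis = []
concatMap-unique f {x ∷ xs} (h ∷ u) uf dis =
  Uniqueₚ.++⁺ (uf (here refl)) (concatMap-unique f u (uf ∘ there) (λ p q → dis (there p) (there q))) disj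
  where
  disj : ∀ {v} → v ∈ f x × v ∈ concatMap f xs → ⊥
  disj (m , m′) with Mem.find (Memₚ.∈-concatMap⁻ f {xs = xs} m′)
  ... | y , y∈ , v∈ = All.lookup h y∈ (dis (here refl) (there y∈) m v∈)

∈-concatMap : ∀ (f : 𝒜 → List ℬ) xs {x z} → x ∈ xs → z ∈ f x → z ∈ concatMap f xs
∈-concatMap f xs m m′ = Memₚ.∈-concatMap⁺ f (Mem.lose m m′)

∈-concatMap⁻ : ∀ (f : 𝒜 → List ℬ) xs {z} → z ∈ concatMap f xs → ∃ λ x → x ∈ xs × z ∈ f x
∈-concatMap⁻ f xs m = Mem.find (Memₚ.∈-concatMap⁻ f {xs = xs} m)

sameSet⇒↭ : ∀ {xs ys : List 𝒜} → Unique xs → Unique ys →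
  (∀ {x} → x ∈ xs → x ∈ ys) → (∀ {x} → x ∈ ys → x ∈ xs) → xs ↭ ys
sameSet⇒↭ u v f g = ∼bag⇒↭ (unique∧set⇒bag u v (mk⇔ f g))

findFin-just : ∀ {n} (p : Fin n → Bool) xs {i} → findFin p xs ≡ just i → p i ≡ true
findFin-just p (x ∷ xs) e with p x in eq
findFin-just p (x ∷ xs) refl | true = eq
... | false = findFin-just p xs e

findFin-nothing : ∀ {n} (p : Fin n → Bool) xs → findFin p xs ≡ nothing → ∀ {i} → i ∈ xs → p i ≡ false
findFin-nothing p (x ∷ xs) e m with p x in eq
findFin-nothing p (x ∷ xs) () m | true
findFin-nothing p (x ∷ xs) e (here refl) | false = eq
findFin-nothing p (x ∷ xs) e (there m) | false = findFin-nothing p xs e m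

findFin-cong : ∀ {n} {p q : Fin n → Bool} → (∀ x → p x ≡ q x) → ∀ xs → findFin p xs ≡ findFin q xs
findFin-cong e [] = refl
findFin-cong {q = q} e (x ∷ xs) rewrite e x with q x
... | true = refl
... | false = findFin-cong e xs

findℕ-cong : ∀ {p q : ℕ → Bool} → (∀ x → p x ≡ q x) → ∀ xs → findℕ p xs ≡ findℕ q xs
findℕ-cong e [] = refl
findℕ-cong {q = q} e (x ∷ xs) rewrite e x with q x
... | true = refl
... | false = findℕ-cong e xs

findℕ-applyUpTo-just : ∀ (p : ℕ → Bool) (f : ℕ → ℕ) m {r} → findℕ p (applyUpTo f m) ≡ just r →
  ∃ λ i → i < m × f i ≡ r × p r ≡ true × (∀ j → j < i → p (f j) ≡ false)
findℕ-applyUpTo-just p f (suc m) e with p (f 0) in eq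
findℕ-applyUpTo-just p f (suc m) refl | true = 0 , s≤s z≤n , refl , eq , λ j ()
findℕ-applyUpTo-just p f (suc m) e | false with findℕ-applyUpTo-just p (f ∘ suc) m e
... | i , i<m , fi , pr , before = suc i , s≤s i<m , fi , pr , λ { zero _ → eq ; (suc j) (s≤s l) → before j l }

findℕ-upTo-just : ∀ (p : ℕ → Bool) m {r} → findℕ p (upTo m) ≡ just r →
  r < m × p r ≡ true × (∀ j → j < r → p j ≡ false)
findℕ-upTo-just p m e with findℕ-applyUpTo-just p id m e
... | i , i<m , refl , pr , before = i<m , pr , before

findℕ-nothing : ∀ (p : ℕ → Bool) xs → findℕ p xs ≡ nothing → ∀ {i} → i ∈ xs → p i ≡ false
findℕ-nothing p (x ∷ xs) e m with p x in eq
findℕ-nothing p (x ∷ xs) () m | true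
findℕ-nothing p (x ∷ xs) e (here refl) | false = eq
findℕ-nothing p (x ∷ xs) e (there m) | false = findℕ-nothing p xs e m

∈-upTo : ∀ {i m} → i < m → i ∈ upTo m
∈-upTo = Memₚ.∈-upTo⁺

∈-upTo⁻ : ∀ {i m} → i ∈ upTo m → i < m
∈-upTo⁻ = Memₚ.∈-upTo⁻

upTo-∷ʳ : ∀ m → upTo (suc m) ≡ upTo m ++ (m ∷ [])
upTo-∷ʳ m = sym (Listₚ.applyUpTo-∷ʳ id m)

upTo-∷ : ∀ m → upTo (suc m) ≡ 0 ∷ map suc (upTo m)
upTo-∷ m = cong (0 ∷_) (sym (Listₚ.map-applyUpTo id suc m))

least : ∀ {p} {P : ℕ → Set p} → (∀ c → Dec (P c)) → ∀ N → 0 < N → P N →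
  ∃ λ m → 0 < m × P m × (∀ c → 0 < c → c < m → ¬ P c)
least {P = P} P? N 0<N PN = go N 1 (s≤s z≤n) (ℕₚ.m≤m+n N 1) λ { zero () _ ; (suc c) _ (s≤s ()) }
  where
  go : ∀ fuel s → 0 < s → N ≤ fuel + s → (∀ c → 0 < c → c < s → ¬ P c) →
    ∃ λ m → 0 < m × P m × (∀ c → 0 < c → c < m → ¬ P c)
  go fuel s 0<s N≤ below with P? s
  ... | yes Ps = s , 0<s , Ps , below
  go zero s 0<s N≤s below | no ¬Ps with ℕₚ.m≤n⇒m<n∨m≡n N≤s
  ...   | inj₁ N<s = ⊥-elim (below N 0<N N<s PN)
  ...   | inj₂ refl = ⊥-elim (¬Ps PN)
  go (suc fuel) s 0<s N≤ below | no ¬Ps =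
    go fuel (suc s) (s≤s z≤n) (subst (N ≤_) (sym (ℕₚ.+-suc fuel s)) N≤) below′
    where
    below′ : ∀ c → 0 < c → c < suc s → ¬ P c
    below′ c 0<c (s≤s c≤s) with ℕₚ.m≤n⇒m<n∨m≡n c≤s
    ... | inj₁ c<s = below c 0<c c<s
    ... | inj₂ refl = ¬Ps

-- A set of naturals closed under sums and cancellation behaves like the trace of a subgroup of ℤ:
-- the remainder of `c` modulo `m` would again lie in it, and being below `m` it must vanish.
least-divides : ∀ {p} {P : ℕ → Set p} m → 0 < m → P m → (∀ c → 0 < c → c < m → ¬ P c) →
  (∀ {c e} → P c → P e → P (c + e)) → (∀ {c e} → P c → P (c + e) → P e) → ∀ c → P c → m ∣ c
least-divides {P = P} m@(suc _) 0<m Pm below add sub c Pc with c % m in eq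
... | zero = Div.m%n≡0⇒n∣m c m eq
... | suc r = ⊥-elim (below (suc r) (s≤s z≤n) r<m Pr)
  where
  r<m : suc r < m
  r<m = subst (_< m) eq (DivMod.m%n<n c m)
  mult : ∀ q → P (suc q * m)
  mult zero = subst P (sym (ℕₚ.*-identityˡ m)) Pm
  mult (suc q) = add Pm (mult q)
  dec : c ≡ (c / m) * m + suc r
  dec = trans (DivMod.m≡m%n+[m/n]*n c m) (trans (ℕₚ.+-comm (c % m) _) (cong ((c / m) * m +_) eq))
  rem : ∀ q → c ≡ q * m + suc r → P (suc r)
  rem zero e = subst P e Pc
  rem (suc q) e = sub (mult q) (subst P e Pc)
  Pr : P (suc r)
  Pr = rem (c / m) dec

minimalPeriod : ∀ {p} {P : ℕ → Set p} → (∀ c → Dec (P c)) → ∀ N → 0 < N → P N →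
  (∀ {c e} → P c → P e → P (c + e)) → (∀ {c e} → P c → P (c + e) → P e) →
  ∃ λ m → 0 < m × P m × (∀ c → P c → m ∣ c)
minimalPeriod P? N 0<N PN add sub with least P? N 0<N PN
... | m , 0<m , Pm , below = m , 0<m , Pm , least-divides m 0<m Pm below add sub

euclid : ∀ m → 0 < m → ∀ a → ∃ λ q → ∃ λ r → r < m × a ≡ r + q * m
euclid m@(suc _) _ a = a / m , a % m , DivMod.m%n<n a m , DivMod.m≡m%n+[m/n]*n a m

-- Finite sums and products

module BigOp {c ℓ : Level} (M : CommutativeMonoid c ℓ) where
  open CommutativeMonoid M renaming (refl to ≈-refl; sym to ≈-sym; trans to ≈-trans)

  bigop : List 𝒜 → (𝒜 → Carrier) → Carrier
  bigop [] f = ε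
  bigop (x ∷ xs) f = f x ∙ bigop xs f

  interchange : ∀ w x y z → (w ∙ x) ∙ (y ∙ z) ≈ (w ∙ y) ∙ (x ∙ z)
  interchange w x y z = ≈-trans (assoc w x (y ∙ z)) (≈-trans (∙-congˡ (≈-trans (≈-sym (assoc x y z))
    (≈-trans (∙-congʳ (comm x y)) (assoc y x z)))) (≈-sym (assoc w y (x ∙ z))))

  bigop-cong : ∀ (xs : List 𝒜) {f g : 𝒜 → Carrier} → (∀ {x} → x ∈ xs → f x ≈ g x) → bigop xs f ≈ bigop xs g
  bigop-cong [] e = ≈-refl
  bigop-cong (x ∷ xs) e = ∙-cong (e (here refl)) (bigop-cong xs (e ∘ there))

  bigop-ε : ∀ (xs : List 𝒜) {f : 𝒜 → Carrier} → (∀ {x} → x ∈ xs → f x ≈ ε) → bigop xs f ≈ ε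
  bigop-ε [] e = ≈-refl
  bigop-ε (x ∷ xs) e = ≈-trans (∙-cong (e (here refl)) (bigop-ε xs (e ∘ there))) (identityˡ ε)

  bigop-∙ : ∀ (xs : List 𝒜) (f g : 𝒜 → Carrier) → bigop xs (λ x → f x ∙ g x) ≈ bigop xs f ∙ bigop xs g
  bigop-∙ [] f g = ≈-sym (identityˡ ε)
  bigop-∙ (x ∷ xs) f g = ≈-trans (∙-congˡ (bigop-∙ xs f g)) (interchange _ _ _ _)

  bigop-++ : ∀ (xs ys : List 𝒜) (f : 𝒜 → Carrier) → bigop (xs ++ ys) f ≈ bigop xs f ∙ bigop ys f
  bigop-++ [] ys f = ≈-sym (identityˡ _)
  bigop-++ (x ∷ xs) ys f = ≈-trans (∙-congˡ (bigop-++ xs ys f)) (≈-sym (assoc _ _ _))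

  bigop-↭ : ∀ {xs ys : List 𝒜} (f : 𝒜 → Carrier) → xs ↭ ys → bigop xs f ≈ bigop ys f
  bigop-↭ f Perm.refl = ≈-refl
  bigop-↭ f (Perm.prep x p) = ∙-congˡ (bigop-↭ f p)
  bigop-↭ f (Perm.swap x y p) = ≈-trans (≈-sym (assoc _ _ _)) (≈-trans (∙-cong (comm _ _) (bigop-↭ f p)) (assoc _ _ _))
  bigop-↭ f (Perm.trans p q) = ≈-trans (bigop-↭ f p) (bigop-↭ f q)

  bigop-map : ∀ (h : 𝒜 → ℬ) xs (f : ℬ → Carrier) → bigop (map h xs) f ≡ bigop xs (f ∘ h)
  bigop-map h [] f = refl
  bigop-map h (x ∷ xs) f = cong (f (h x) ∙_) (bigop-map h xs f)

  bigop-concatMap : ∀ (g : 𝒜 → List ℬ) xs (f : ℬ → Carrier) →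
    bigop (concatMap g xs) f ≈ bigop xs (λ x → bigop (g x) f)
  bigop-concatMap g [] f = ≈-refl
  bigop-concatMap g (x ∷ xs) f = ≈-trans (bigop-++ (g x) (concatMap g xs) f) (∙-congˡ (bigop-concatMap g xs f))

  bigop-swap : ∀ (xs : List 𝒜) (ys : List ℬ) (f : 𝒜 → ℬ → Carrier) →
    bigop xs (λ x → bigop ys (f x)) ≈ bigop ys (λ y → bigop xs (λ x → f x y))
  bigop-swap [] ys f = ≈-sym (bigop-ε ys (λ _ → ≈-refl))
  bigop-swap (x ∷ xs) ys f = ≈-trans (∙-congˡ (bigop-swap xs ys f)) (≈-sym (bigop-∙ ys (f x) _))

  bigop-filterᵇ : ∀ (p : 𝒜 → Bool) xs (f : 𝒜 → Carrier) →
    bigop (filterᵇ p xs) f ≈ bigop xs (λ x → if p x then f x else ε)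
  bigop-filterᵇ p [] f = ≈-refl
  bigop-filterᵇ p (x ∷ xs) f with p x
  ... | true = ∙-congˡ (bigop-filterᵇ p xs f)
  ... | false = ≈-trans (bigop-filterᵇ p xs f) (≈-sym (identityˡ _))

  bigop-split : ∀ (p : 𝒜 → Bool) xs (f : 𝒜 → Carrier) →
    bigop xs f ≈ bigop (filterᵇ p xs) f ∙ bigop (filterᵇ (not ∘ p) xs) f
  bigop-split p [] f = ≈-sym (identityˡ ε)
  bigop-split p (x ∷ xs) f with p x
  ... | true = ≈-trans (∙-congˡ (bigop-split p xs f)) (≈-sym (assoc _ _ _))
  ... | false = ≈-trans (∙-congˡ (≈-trans (bigop-split p xs f) (comm _ _))) (≈-trans (≈-sym (assoc _ _ _)) (comm _ _))

  bigop-reindex : ∀ {xs : List 𝒜} {ys : List ℬ} (h : 𝒜 → ℬ) (f : ℬ → Carrier) → Unique xs → Unique ys →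
    (∀ {x} → x ∈ xs → h x ∈ ys) → (∀ {x y} → x ∈ xs → y ∈ xs → h x ≡ h y → x ≡ y) →
    (∀ {y} → y ∈ ys → ∃ λ x → x ∈ xs × h x ≡ y) →
    bigop xs (f ∘ h) ≈ bigop ys f
  bigop-reindex {xs = xs} {ys} h f u v into inj onto =
    ≈-trans (reflexive (sym (bigop-map h xs f))) (bigop-↭ f (sameSet⇒↭ (map-unique h u inj) v to from))
    where
    to : ∀ {z} → z ∈ map h xs → z ∈ ys
    to m with Memₚ.∈-map⁻ h m
    ... | x , x∈ , refl = into x∈
    from : ∀ {z} → z ∈ ys → z ∈ map h xs
    from m with onto m
    ... | x , x∈ , refl = Memₚ.∈-map⁺ h x∈

  bigop-upTo-suc : ∀ m (f : ℕ → Carrier) → bigop (upTo (suc m)) f ≈ bigop (upTo m) f ∙ f m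
  bigop-upTo-suc m f = ≈-trans (reflexive (cong (λ l → bigop l f) (upTo-∷ʳ m)))
    (≈-trans (bigop-++ (upTo m) (m ∷ []) f) (∙-congˡ (identityʳ (f m))))

  bigop-upTo-head : ∀ m (f : ℕ → Carrier) → bigop (upTo (suc m)) f ≈ f 0 ∙ bigop (upTo m) (f ∘ suc)
  bigop-upTo-head m f = reflexive (trans (cong (λ l → bigop l f) (upTo-∷ m)) (cong (f 0 ∙_) (bigop-map suc (upTo m) f)))

  -- A shift by one trades the first value for the value one period later; `rotate` does this once
  -- and the induction repeats it.
  bigop-upTo-shift : ∀ m (f : ℕ → Carrier) → (∀ i → f (i + m) ≈ f i) → ∀ s →
    bigop (upTo m) (λ i → f (i + s)) ≈ bigop (upTo m) f
  bigop-upTo-shift m f per zero = bigop-cong (upTo m) (λ {i} _ → reflexive (cong f (ℕₚ.+-identityʳ i)))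
  bigop-upTo-shift m f per (suc s) = ≈-trans (bigop-cong (upTo m) (λ {i} _ → reflexive (cong f (ℕₚ.+-suc i s))))
    (≈-trans (rotate (λ i → f (i + s)) per′) (bigop-upTo-shift m f per s))
    where
    per′ : f (m + s) ≈ f (0 + s)
    per′ = ≈-trans (reflexive (cong f (ℕₚ.+-comm m s))) (per s)
    rotate : ∀ g → g m ≈ g 0 → bigop (upTo m) (g ∘ suc) ≈ bigop (upTo m) g
    rotate g e = aux m g e
      where
      aux : ∀ k g → g k ≈ g 0 → bigop (upTo k) (g ∘ suc) ≈ bigop (upTo k) g
      aux zero g e = ≈-refl
      aux (suc k) g e = ≈-trans (bigop-upTo-suc k (g ∘ suc)) (≈-trans (∙-congˡ e)
        (≈-trans (comm _ _) (≈-sym (bigop-upTo-head k g))))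

-- Sums and powers in a domain of characteristic zero

module _ {c ℓ : Level} (R : CommutativeRing c ℓ) where
  open CommutativeRing R using (Carrier; _≈_; 0#; 1#) renaming (_*_ to _⊛_)

  IsDomain : Set (c ⊔ ℓ)
  IsDomain = ∀ a b → a ⊛ b ≈ 0# → a ≈ 0# ⊎ b ≈ 0#

  CharZero : Set ℓ
  CharZero = ∀ m → ¬ natR R (suc m) ≈ 0#

  IsRoot IsPrimitive : ℕ → Carrier → Set ℓ
  IsRoot n ζ = powR R ζ (Nord n) ≈ 1#
  IsPrimitive n ζ = ∀ j → 0 < j → j < Nord n → ¬ powR R ζ j ≈ 1#

module RingSums {c ℓ : Level} (R : CommutativeRing c ℓ) where
  open CommutativeRing R renaming (_+_ to _⊕_; _*_ to _⊛_; refl to ≈-refl; sym to ≈-sym; trans to ≈-trans)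
  module Sum = BigOp +-commutativeMonoid
  module Prod = BigOp *-commutativeMonoid
  open import Algebra.Properties.Ring ring using (-‿distribʳ-*; -‿involutive; -1*x≈-x)

  ∑ : List 𝒜 → (𝒜 → Carrier) → Carrier
  ∑ = Sum.bigop

  ∏ : List 𝒜 → (𝒜 → Carrier) → Carrier
  ∏ = Prod.bigop

  sumR-map : ∀ (f : 𝒜 → Carrier) xs → sumR R (map f xs) ≡ ∑ xs f
  sumR-map f [] = refl
  sumR-map f (x ∷ xs) = cong (f x ⊕_) (sumR-map f xs)

  ∑-*ˡ : ∀ (xs : List 𝒜) r f → r ⊛ ∑ xs f ≈ ∑ xs (λ x → r ⊛ f x)
  ∑-*ˡ [] r f = zeroʳ r
  ∑-*ˡ (x ∷ xs) r f = ≈-trans (distribˡ r _ _) (+-congˡ (∑-*ˡ xs r f))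

  ∏-zero : ∀ (xs : List 𝒜) (f : 𝒜 → Carrier) {x} → x ∈ xs → f x ≈ 0# → ∏ xs f ≈ 0#
  ∏-zero (x ∷ xs) f (here refl) e = ≈-trans (*-congʳ e) (zeroˡ _)
  ∏-zero (x ∷ xs) f (there m) e = ≈-trans (*-congˡ (∏-zero xs f m e)) (zeroʳ _)

  ∑-const : ∀ m r → ∑ (upTo m) (λ _ → r) ≈ natR R m ⊛ r
  ∑-const zero r = ≈-sym (zeroˡ r)
  ∑-const (suc m) r = ≈-trans (Sum.bigop-upTo-head m (λ _ → r))
    (≈-trans (+-cong (≈-sym (*-identityˡ r)) (∑-const m r)) (≈-sym (distribʳ r 1# (natR R m))))

  pow : Carrier → ℕ → Carrier
  pow = powR R

  pow-+ : ∀ z m k → pow z (m + k) ≈ pow z m ⊛ pow z k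
  pow-+ z zero k = ≈-sym (*-identityˡ _)
  pow-+ z (suc m) k = ≈-trans (*-congˡ (pow-+ z m k)) (≈-sym (*-assoc _ _ _))

  pow-one : ∀ {z} m → z ≈ 1# → pow z m ≈ 1#
  pow-one zero e = ≈-refl
  pow-one (suc m) e = ≈-trans (*-cong e (pow-one m e)) (*-identityˡ 1#)

  pow-* : ∀ z m k → pow z (m * k) ≈ pow (pow z k) m
  pow-* z zero k = ≈-refl
  pow-* z (suc m) k = ≈-trans (pow-+ z k (m * k)) (*-congˡ (pow-* z m k))

  pow-cong : ∀ {y z} m → y ≈ z → pow y m ≈ pow z m
  pow-cong zero e = ≈-refl
  pow-cong (suc m) e = *-cong e (pow-cong m e)

  sg : Bool → Carrier
  sg b = if b then - 1# else 1#

  -1*-1 : (- 1#) ⊛ (- 1#) ≈ 1#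
  -1*-1 = ≈-trans (-1*x≈-x (- 1#)) (-‿involutive 1#)

  sg-xor : ∀ b b′ → sg (b xor b′) ≈ sg b ⊛ sg b′
  sg-xor false b′ = ≈-sym (*-identityˡ _)
  sg-xor true false = ≈-sym (*-identityʳ _)
  sg-xor true true = ≈-sym -1*-1

  sg² : ∀ b → sg b ⊛ sg b ≈ 1#
  sg² false = *-identityˡ 1#
  sg² true = -1*-1

  module Domain
    (domain : IsDomain R) (char0 : CharZero R) where

    x-y≈0 : ∀ {x y} → x ⊕ - y ≈ 0# → x ≈ y
    x-y≈0 {x} {y} e = ≈-trans (≈-sym (+-identityʳ x)) (≈-trans (+-congˡ (≈-sym (-‿inverseˡ y)))
      (≈-trans (≈-sym (+-assoc x (- y) y)) (≈-trans (+-congʳ e) (+-identityˡ y))))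

    *-cancelˡ : ∀ a {x y} → ¬ a ≈ 0# → a ⊛ x ≈ a ⊛ y → x ≈ y
    *-cancelˡ a {x} {y} a≉0 e with domain a (x ⊕ - y) (≈-trans (distribˡ a x (- y))
      (≈-trans (+-cong e (≈-sym (-‿distribʳ-* a y))) (-‿inverseʳ (a ⊛ y))))
    ... | inj₁ a≈0 = ⊥-elim (a≉0 a≈0)
    ... | inj₂ d = x-y≈0 d

    natR-cancel : ∀ m {x y} → 0 < m → natR R m ⊛ x ≈ natR R m ⊛ y → x ≈ y
    natR-cancel (suc m) _ = *-cancelˡ (natR R (suc m)) (char0 m)

    square-one : ∀ z → z ⊛ z ≈ 1# → ¬ z ≈ 1# → z ≈ - 1#
    square-one z sq z≉1 with domain (z ⊕ - 1#) (z ⊕ 1#) eq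
      where
      eq : (z ⊕ - 1#) ⊛ (z ⊕ 1#) ≈ 0#
      eq = ≈-trans (distribʳ _ z (- 1#)) (≈-trans (+-cong (≈-trans (distribˡ z z 1#) (+-cong sq (*-identityʳ z)))
             (-1*x≈-x (z ⊕ 1#))) (≈-trans (+-congʳ (+-comm 1# z)) (-‿inverseʳ (z ⊕ 1#))))
    ... | inj₁ e = ⊥-elim (z≉1 (x-y≈0 e))
    ... | inj₂ e = x-y≈0 (≈-trans (+-congˡ (-‿involutive 1#)) e)

    -- Multiplication by `z` permutes the summands cyclically, so z - 1 annihilates the sum.
    geometric : ∀ m z → pow z m ≈ 1# → ¬ z ≈ 1# → ∑ (upTo m) (pow z) ≈ 0#
    geometric m z zm z≉1 with domain (z ⊕ - 1#) (∑ (upTo m) (pow z)) eq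
      where
      s = ∑ (upTo m) (pow z)
      shift : z ⊛ s ≈ s
      shift = ≈-trans (∑-*ˡ (upTo m) z (pow z)) (≈-trans (Sum.bigop-cong (upTo m) (λ {i} _ →
                CommutativeRing.reflexive R (cong (pow z) (sym (ℕₚ.+-comm i 1)))))
              (Sum.bigop-upTo-shift m (pow z) (λ i → ≈-trans (pow-+ z i m) (≈-trans (*-congˡ zm) (*-identityʳ _))) 1))
      eq : (z ⊕ - 1#) ⊛ s ≈ 0#
      eq = ≈-trans (distribʳ s z (- 1#)) (≈-trans (+-cong shift (-1*x≈-x s)) (-‿inverseʳ s))
    ... | inj₁ e = ⊥-elim (z≉1 (x-y≈0 e))
    ... | inj₂ e = e

-- The hyperoctahedral group

≡ᵇ-true : ∀ {m k} → (m ≡ᵇ k) ≡ true → m ≡ k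
≡ᵇ-true {m} {k} h = ℕₚ.≡ᵇ⇒≡ m k (subst T (sym h) tt)

T⇒true : ∀ {b} → T b → b ≡ true
T⇒true {true} _ = refl

eqFin-true : ∀ {i j : Fin n} → eqFin i j ≡ true → i ≡ j
eqFin-true h = Finₚ.toℕ-injective (≡ᵇ-true h)

eqFin-refl : ∀ (i : Fin n) → eqFin i i ≡ true
eqFin-refl i = T⇒true (ℕₚ.≡⇒≡ᵇ (toℕ i) (toℕ i) refl)

true-eqFin : ∀ {i j : Fin n} → i ≡ j → eqFin i j ≡ true
true-eqFin {i = i} refl = eqFin-refl i

eqBool-true : ∀ {a b} → eqBool a b ≡ true → a ≡ b
eqBool-true {true} {true} h = refl
eqBool-true {false} {false} h = refl

eqBool-refl : ∀ a → eqBool a a ≡ true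
eqBool-refl true = refl
eqBool-refl false = refl

eqSP-true : ∀ {p q : SP n} → eqSP p q ≡ true → p ≡ q
eqSP-true {p = i , s} {j , t} h with ∧-true {eqFin i j} h
... | e , f with eqFin-true {i = i} {j} e | eqBool-true {s} {t} f
... | refl | refl = refl

true-eqSP : ∀ {p q : SP n} → p ≡ q → eqSP p q ≡ true
true-eqSP {p = i , s} refl rewrite eqFin-refl i = eqBool-refl s

_≟SP_ : (p q : SP n) → Dec (p ≡ q)
_≟SP_ = Productₚ.≡-dec Finₚ._≟_ Bool._≟_

pt : Fin n → SP n
pt i = i , false

∣_∣ₚ : SP n → Fin n
∣_∣ₚ = proj₁

negᵇ : Bool → SP n → SP n
negᵇ b (i , s) = i , s xor b

-- Opaque, because app and hence iter unfold to pairs from which unification cannot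
-- recover their arguments.
opaque
  act : W n → SP n → SP n
  act = app

  act≡app : ∀ (w : W n) p → act w p ≡ app w p
  act≡app w p = refl

  act-def : ∀ (w : W n) i s → act w (i , s) ≡ (proj₁ (lookup w i) , s xor proj₂ (lookup w i))
  act-def w i s with lookup w i
  ... | j , t = refl

iter′ : W n → ℕ → SP n → SP n
iter′ x zero p = p
iter′ x (suc m) p = act x (iter′ x m p)

iter′≡iter : ∀ (x : W n) m p → iter′ x m p ≡ iter x m p
iter′≡iter x zero p = refl
iter′≡iter x (suc m) p = trans (act≡app x _) (cong (app x) (iter′≡iter x m p))

W-ext : ∀ {v w : W n} → (∀ p → act v p ≡ act w p) → v ≡ w
W-ext {n} {v} {w} e = trans (sym (Vecₚ.tabulate∘lookup v)) (trans (Vecₚ.tabulate-cong at) (Vecₚ.tabulate∘lookup w))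
  where
  val : ∀ (u : W n) i → act u (pt i) ≡ lookup u i
  val u i = act-def u i false
  at : ∀ i → lookup v i ≡ lookup w i
  at i = trans (sym (val v i)) (trans (e (pt i)) (val w i))

eqW-true : ∀ {v w : W n} → eqW v w ≡ true → v ≡ w
eqW-true {n} {v} {w} h = W-ext λ { (i , s) → trans (act-def v i s) (trans
  (cong (λ q → proj₁ q , s xor proj₂ q) (eqSP-true (all-true (λ i → eqSP (lookup v i) (lookup w i)) (allFin n) h (Memₚ.∈-allFin i))))
  (sym (act-def w i s))) }

true-eqW : ∀ {v w : W n} → v ≡ w → eqW v w ≡ true
true-eqW {n} {v} refl = true-all (λ i → eqSP (lookup v i) (lookup v i)) (allFin n) (λ _ → true-eqSP {p = lookup v _} refl)

act-neg : ∀ (w : W n) p → act w (negSP p) ≡ negSP (act w p)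
act-neg w (i , s) = trans (act-def w i (not s)) (trans (cong (_ ,_) (lem s _)) (cong negSP (sym (act-def w i s))))
  where
  lem : ∀ s t → not s xor t ≡ not (s xor t)
  lem true true = refl
  lem true false = refl
  lem false true = refl
  lem false false = refl

act-· : ∀ (w v : W n) p → act (w · v) p ≡ act w (act v p)
act-· w v (i , s) = trans (act-def (w · v) i s) (trans (cong (λ q → proj₁ q , s xor proj₂ q)
    (trans (Vecₚ.lookup∘tabulate _ i) (trans (sym (act≡app w (lookup v i))) (act-def w (proj₁ (lookup v i)) (proj₂ (lookup v i))))))
  (trans (cong (_ ,_) (sym (Boolₚ.xor-assoc s _ _))) (sym (trans (cong (act w) (act-def v i s)) (act-def w _ _)))))

act-id : ∀ (p : SP n) → act idW p ≡ p
act-id (i , s) = trans (act-def idW i s) (trans (cong (λ q → proj₁ q , s xor proj₂ q) (Vecₚ.lookup∘tabulate _ i))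
  (cong (i ,_) (Boolₚ.xor-identityʳ s)))

act-w0 : ∀ (p : SP n) → act w0 p ≡ negSP p
act-w0 (i , s) = trans (act-def w0 i s) (trans (cong (λ q → proj₁ q , s xor proj₂ q) (Vecₚ.lookup∘tabulate _ i))
  (cong (i ,_) (lem s)))
  where
  lem : ∀ s → s xor true ≡ not s
  lem true = refl
  lem false = refl

neg-neg : ∀ (p : SP n) → negSP (negSP p) ≡ p
neg-neg (i , s) = cong (i ,_) (Boolₚ.not-involutive s)

neg≢ : ∀ {p : SP n} → negSP p ≢ p
neg≢ {p = i , true} ()
neg≢ {p = i , false} ()

abs-act : ∀ (w : W n) i s → ∣ act w (i , s) ∣ₚ ≡ proj₁ (lookup w i)
abs-act w i s = cong proj₁ (act-def w i s)

abs-cong : ∀ (w : W n) {p q} → ∣ p ∣ₚ ≡ ∣ q ∣ₚ → ∣ act w p ∣ₚ ≡ ∣ act w q ∣ₚ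
abs-cong w {i , s} {j , t} refl = trans (abs-act w i s) (sym (abs-act w i t))

abs-eq : ∀ {p q : SP n} → ∣ p ∣ₚ ≡ ∣ q ∣ₚ → p ≡ q ⊎ p ≡ negSP q
abs-eq {p = i , true} {.i , true} refl = inj₁ refl
abs-eq {p = i , true} {.i , false} refl = inj₂ refl
abs-eq {p = i , false} {.i , true} refl = inj₂ refl
abs-eq {p = i , false} {.i , false} refl = inj₁ refl

record IsB (w : W n) : Set where
  constructor mkB
  field injB : ∀ i j → proj₁ (lookup w i) ≡ proj₁ (lookup w j) → i ≡ j
open IsB

abs-inj : ∀ {w : W n} → IsB w → ∀ {p q} → ∣ act w p ∣ₚ ≡ ∣ act w q ∣ₚ → ∣ p ∣ₚ ≡ ∣ q ∣ₚ
abs-inj {w = w} B {i , s} {j , t} e = injB B i j (trans (sym (abs-act w i s)) (trans e (abs-act w j t)))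

absInj⇒IsB : ∀ {w : W n} → (∀ {p q} → ∣ act w p ∣ₚ ≡ ∣ act w q ∣ₚ → ∣ p ∣ₚ ≡ ∣ q ∣ₚ) → IsB w
absInj⇒IsB {w = w} h = mkB λ i j e → h {pt i} {pt j} (trans (abs-act w i false) (trans e (sym (abs-act w j false))))

act-inj : ∀ {w : W n} → IsB w → ∀ {p q} → act w p ≡ act w q → p ≡ q
act-inj {w = w} B {p} {q} e with abs-eq (abs-inj {w = w} B {p} {q} (cong proj₁ e))
... | inj₁ h = h
... | inj₂ refl = ⊥-elim (neg≢ (trans (sym (act-neg w q)) e))

isBn-true : ∀ {w : W n} → isBn w ≡ true → IsB w
isBn-true {n} {w} h = mkB λ i j e → eqFin-true (lem i j e (all-true _ (allFin n) (all-true _ (allFin n) h (Memₚ.∈-allFin i)) (Memₚ.∈-allFin j)))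
  where
  lem : ∀ i j → proj₁ (lookup w i) ≡ proj₁ (lookup w j) →
    not (eqFin (proj₁ (lookup w i)) (proj₁ (lookup w j))) ∨ eqFin i j ≡ true → eqFin i j ≡ true
  lem i j e h rewrite true-eqFin e = h

true-isBn : ∀ {w : W n} → IsB w → isBn w ≡ true
true-isBn {n} {w} B = true-all _ (allFin n) (λ {i} _ → true-all _ (allFin n) (λ {j} _ → lem i j))
  where
  lem : ∀ i j → not (eqFin (proj₁ (lookup w i)) (proj₁ (lookup w j))) ∨ eqFin i j ≡ true
  lem i j with eqFin (proj₁ (lookup w i)) (proj₁ (lookup w j)) in eq
  ... | false = refl
  ... | true = true-eqFin (injB B i j (eqFin-true eq))

IsB-· : ∀ {w v : W n} → IsB w → IsB v → IsB (w · v)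
IsB-· {w = w} {v} Bw Bv = absInj⇒IsB λ {p} {q} e → abs-inj {w = v} Bv {p} {q} (abs-inj {w = w} Bw
  (trans (cong proj₁ (sym (act-· w v p))) (trans e (cong proj₁ (act-· w v q)))))

IsB-id : IsB (idW {n})
IsB-id = absInj⇒IsB λ {p} {q} e → trans (sym (cong proj₁ (act-id p))) (trans e (cong proj₁ (act-id q)))

iter-+ : ∀ (x : W n) a b p → iter′ x (a + b) p ≡ iter′ x a (iter′ x b p)
iter-+ x zero b p = refl
iter-+ x (suc a) b p = cong (act x) (iter-+ x a b p)

iter-comm : ∀ (x : W n) a b p → iter′ x a (iter′ x b p) ≡ iter′ x b (iter′ x a p)
iter-comm x a b p = trans (sym (iter-+ x a b p)) (trans (cong (λ c → iter′ x c p) (ℕₚ.+-comm a b)) (iter-+ x b a p))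

iter-act : ∀ (x : W n) a p → iter′ x a (act x p) ≡ act x (iter′ x a p)
iter-act x a p = iter-comm x a 1 p

iter-neg : ∀ (x : W n) a p → iter′ x a (negSP p) ≡ negSP (iter′ x a p)
iter-neg x zero p = refl
iter-neg x (suc a) p = trans (cong (act x) (iter-neg x a p)) (act-neg x _)

iter-abs-cong : ∀ (x : W n) a {p q} → ∣ p ∣ₚ ≡ ∣ q ∣ₚ → ∣ iter′ x a p ∣ₚ ≡ ∣ iter′ x a q ∣ₚ
iter-abs-cong x zero e = e
iter-abs-cong x (suc a) e = abs-cong x (iter-abs-cong x a e)

iter-inj : ∀ {x : W n} → IsB x → ∀ a {p q} → iter′ x a p ≡ iter′ x a q → p ≡ q
iter-inj B zero e = e
iter-inj B (suc a) e = iter-inj B a (act-inj B e)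

iter-abs-inj : ∀ {x : W n} → IsB x → ∀ a {p q} → ∣ iter′ x a p ∣ₚ ≡ ∣ iter′ x a q ∣ₚ → ∣ p ∣ₚ ≡ ∣ q ∣ₚ
iter-abs-inj B zero e = e
iter-abs-inj B (suc a) {p} {q} e = iter-abs-inj B a {p} {q} (abs-inj B e)

iter-fix : ∀ (x : W n) l {p} → iter′ x l p ≡ p → ∀ m → iter′ x (m * l) p ≡ p
iter-fix x l e zero = refl
iter-fix x l e (suc m) = trans (iter-+ x l (m * l) _) (trans (cong (iter′ x l) (iter-fix x l e m)) e)

powℕ-act : ∀ (x : W n) m p → act (powℕ x m) p ≡ iter′ x m p
powℕ-act x zero p = act-id p
powℕ-act x (suc m) p = trans (act-· x (powℕ x m) p) (cong (act x) (powℕ-act x m p))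

-- An exponent of the group

∣! : ∀ l m → 0 < l → l ≤ m → l ∣ m !
∣! (suc l) m _ l≤m = Div.∣-trans (Div.m∣m*n (l !)) (Div.m≤n⇒m!∣n! l≤m)

Nord>0 : ∀ n → 0 < Nord n
Nord>0 n = ℕₚ.1≤n! (2 * n)

code : SP n → Fin (2 * n)
code (i , false) = Fin.combine {2} Fin.zero i
code (i , true) = Fin.combine {2} (Fin.suc Fin.zero) i

code-inj : ∀ (p q : SP n) → code p ≡ code q → p ≡ q
code-inj (i , false) (j , false) e with Finₚ.combine-injective {2} Fin.zero i Fin.zero j e
... | _ , refl = refl
code-inj (i , false) (j , true) e with Finₚ.combine-injective {2} Fin.zero i (Fin.suc Fin.zero) j e
... | () , _
code-inj (i , true) (j , false) e with Finₚ.combine-injective {2} (Fin.suc Fin.zero) i Fin.zero j e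
... | () , _
code-inj (i , true) (j , true) e with Finₚ.combine-injective {2} (Fin.suc Fin.zero) i (Fin.suc Fin.zero) j e
... | _ , refl = refl

-- Among 2n + 1 iterates two coincide; injectivity of `x` cancels the steps they share.
cycle-bound : ∀ {x : W n} → IsB x → ∀ p → ∃ λ l → 0 < l × l ≤ 2 * n × iter′ x l p ≡ p
cycle-bound {n} {x} B p with Finₚ.pigeonhole (ℕₚ.n<1+n (2 * n)) (λ i → code (iter′ x (toℕ i) p))
... | i , j , i<j , e = toℕ j ∸ toℕ i , ℕₚ.m<n⇒0<n∸m i<j , ℕₚ.≤-trans (ℕₚ.m∸n≤m (toℕ j) (toℕ i)) (ℕₚ.≤-pred (Finₚ.toℕ<n j)) ,
  iter-inj B (toℕ i) (trans (sym (iter-+ x (toℕ i) _ p)) (trans (cong (λ c → iter′ x c p) (ℕₚ.m+[n∸m]≡n (ℕₚ.<⇒≤ i<j)))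
    (sym (code-inj _ _ e))))

-- All cycle lengths are at most 2n and hence divide (2n)!, the same number that is prescribed as
-- the order of ζ.
iter-Nord : ∀ {x : W n} → IsB x → ∀ p → iter′ x (Nord n) p ≡ p
iter-Nord {n} {x} B p with cycle-bound B p
... | l , 0<l , l≤ , e with ∣! l (2 * n) 0<l l≤
... | divides q eq = trans (cong (λ c → iter′ x c p) eq) (iter-fix x l e q)

iter-Nord* : ∀ {x : W n} → IsB x → ∀ m p → iter′ x (m * Nord n) p ≡ p
iter-Nord* {n} {x} B m p = iter-fix x (Nord n) (iter-Nord B p) m

-- x^(N-1) is the inverse of x
N-1 : ℕ → ℕ
N-1 n = Nord n ∸ 1

suc-N-1 : ∀ n → suc (N-1 n) ≡ Nord n
suc-N-1 n = ℕₚ.m+[n∸m]≡n (Nord>0 n)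

act-iter-N-1 : ∀ {x : W n} → IsB x → ∀ p → act x (iter′ x (N-1 n) p) ≡ p
act-iter-N-1 {n} {x} B p = trans (cong (λ c → iter′ x c p) (suc-N-1 n)) (iter-Nord B p)

lookup-inv : ∀ {w : W n} → IsB w → ∀ i → lookup (inv w) (proj₁ (lookup w i)) ≡ (i , proj₂ (lookup w i))
lookup-inv {n} {w} B i
  rewrite ((lookup (inv w) (proj₁ (lookup w i)) ≡ _) ∋ Vecₚ.lookup∘tabulate _ (proj₁ (lookup w i)))
  with findFin (λ k → eqFin (proj₁ (lookup w k)) (proj₁ (lookup w i))) (allFin n) in eq
... | just k with injB B k i (eqFin-true (findFin-just _ (allFin n) eq))
...   | refl = refl
lookup-inv {n} {w} B i | nothing = ⊥-elim (true≢false (eqFin-refl (proj₁ (lookup w i))) (findFin-nothing _ (allFin n) eq (Memₚ.∈-allFin i)))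

inv-act : ∀ {w : W n} → IsB w → ∀ p → act (inv w) (act w p) ≡ p
inv-act {n} {w} B (i , s) = trans (cong (act (inv w)) (act-def w i s))
  (trans (act-def (inv w) _ _) (trans (cong (λ q → proj₁ q , (s xor t) xor proj₂ q) (lookup-inv B i)) (cong (i ,_)
    (trans (Boolₚ.xor-assoc s t t) (trans (cong (s xor_) (Boolₚ.xor-same t)) (Boolₚ.xor-identityʳ s))))))
  where t = proj₂ (lookup w i)

-- `IsB` records injectivity only, which makes `inv w` a left inverse. For the other side, p is
-- rewritten as w applied to w^(N-1) p.
act-inv : ∀ {w : W n} → IsB w → ∀ p → act w (act (inv w) p) ≡ p
act-inv {n} {w} B p = trans (cong (λ q → act w (act (inv w) q)) (sym (act-iter-N-1 B p)))
  (trans (cong (act w) (inv-act B _)) (act-iter-N-1 B p))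

inv-iter : ∀ {w : W n} → IsB w → ∀ p → act (inv w) p ≡ iter′ w (N-1 n) p
inv-iter {n} {w} B p = act-inj B (trans (act-inv B p) (sym (act-iter-N-1 B p)))

IsB-inv : ∀ {w : W n} → IsB w → IsB (inv w)
IsB-inv {n} {w} B = absInj⇒IsB λ {p} {q} e → trans (cong proj₁ (sym (act-inv B p)))
   (trans (abs-cong w e) (cong proj₁ (act-inv B q)))

iter-iter : ∀ (x : W n) (u : W n) l → (∀ p → act u p ≡ iter′ x l p) → ∀ m p → iter′ u m p ≡ iter′ x (m * l) p
iter-iter x u l e zero p = refl
iter-iter x u l e (suc m) p = trans (e _) (trans (cong (iter′ x l) (iter-iter x u l e m p)) (sym (iter-+ x l (m * l) p)))

-- The inverse of x is x^(N-1), so an integer power is a natural power whose exponent serves all x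
-- at once.
powℤ-nat : ∀ n k → ∃ λ K → ∀ (x : W n) → IsB x → ∀ p → act (powℤ x k) p ≡ iter′ x K p
powℤ-nat n (ℤ.+ m) = m , λ x B p → powℕ-act x m p
powℤ-nat n ℤ.-[1+ m ] = suc m * N-1 n , λ x B p →
  trans (powℕ-act (inv x) (suc m) p) (iter-iter x (inv x) (N-1 n) (inv-iter B) (suc m) p)

-- Enumeration of the group and centralizers

allSP-complete : ∀ (p : SP n) → p ∈ allSP n
allSP-complete {n} (i , false) = ∈-concatMap _ (allFin n) (Memₚ.∈-allFin i) (here refl)
allSP-complete {n} (i , true) = ∈-concatMap _ (allFin n) (Memₚ.∈-allFin i) (there (here refl))

allSP-unique : ∀ n → Unique (allSP n)
allSP-unique n = concatMap-unique _ (Uniqueₚ.allFin⁺ n) (λ _ → ((λ ()) ∷ []) ∷ [] ∷ [])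
  λ { _ _ (here refl) (here refl) → refl ; _ _ (there (here refl)) (there (here refl)) → refl
    ; _ _ (here refl) (there (here ())) ; _ _ (there (here refl)) (here ()) }

allVec-complete : ∀ {A : Set} (as : List A) → (∀ a → a ∈ as) → ∀ m (v : Vec A m) → v ∈ allVec as m
allVec-complete as h zero Vec.[] = here refl
allVec-complete as h (suc m) (a Vec.∷ v) = ∈-concatMap _ as (h a) (Memₚ.∈-map⁺ (a Vec.∷_) (allVec-complete as h m v))

allVec-unique : ∀ {A : Set} {as : List A} → Unique as → ∀ m → Unique (allVec as m)
allVec-unique u zero = [] ∷ []
allVec-unique {as = as} u (suc m) = concatMap-unique _ u (λ {a} _ → map-unique (a Vec.∷_) (allVec-unique u m) (λ { _ _ refl → refl }))
  λ {a} {b} _ _ p q → dis p q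
  where
  dis : ∀ {a b z} → z ∈ map (a Vec.∷_) (allVec as m) → z ∈ map (b Vec.∷_) (allVec as m) → a ≡ b
  dis p q with Memₚ.∈-map⁻ _ p | Memₚ.∈-map⁻ _ q
  ... | _ , _ , refl | _ , _ , refl = refl

Bn-unique : ∀ n → Unique (Bn n)
Bn-unique n = filterᵇ-unique isBn (allVec-unique (allSP-unique n) n)

∈-Bn : ∀ {w : W n} → IsB w → w ∈ Bn n
∈-Bn {n} {w} B = ∈-filterᵇ⁺ isBn (allVec (allSP n) n) (allVec-complete (allSP n) allSP-complete n w) (true-isBn B)

∈-Bn⁻ : ∀ {w : W n} → w ∈ Bn n → IsB w
∈-Bn⁻ {n} m = isBn-true (proj₂ (∈-filterᵇ⁻ isBn (allVec (allSP n) n) m))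

record Commute (x z : W n) : Set where
  constructor mkC
  field commutes : ∀ p → act x (act z p) ≡ act z (act x p)
open Commute

inZ-true : ∀ {x z : W n} → inZ x z ≡ true → Commute x z
inZ-true {x = x} {z} h = mkC λ p → trans (sym (act-· x z p)) (trans (cong (λ w → act w p) (eqW-true h)) (act-· z x p))

true-inZ : ∀ {x z : W n} → Commute x z → inZ x z ≡ true
true-inZ {x = x} {z} h = true-eqW (W-ext λ p → trans (act-· x z p) (trans (commutes h p) (sym (act-· z x p))))

iter-commute : ∀ {x z : W n} → Commute x z → ∀ a b p → iter′ x a (iter′ z b p) ≡ iter′ z b (iter′ x a p)
iter-commute {x = x} {z} c zero b p = refl
iter-commute {x = x} {z} c (suc a) b p = trans (cong (act x) (iter-commute c a b p)) (one b (iter′ x a p))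
  where
  one : ∀ b p → act x (iter′ z b p) ≡ iter′ z b (act x p)
  one zero p = refl
  one (suc b) p = trans (commutes c (iter′ z b p)) (cong (act z) (one b p))

-- Cycles

cycLen : W n → SP n → ℕ
cycLen x p = suc (cycLenPred x p)

cycLen-spec : ∀ {x : W n} → IsB x → ∀ p → iter′ x (cycLen x p) p ≡ p × cycLen x p ≤ 2 * n ×
  (∀ c → 0 < c → c < cycLen x p → ¬ iter′ x c p ≡ p)
cycLen-spec {n} {x} B p with findℕ (λ m → eqSP (iter x (suc m) p) p) (upTo (2 * n)) in eq
... | just m with findℕ-upTo-just _ (2 * n) eq
...   | m< , pm , before = trans (iter′≡iter x (suc m) p) (eqSP-true pm) , m< ,
        λ { zero () _ ; (suc c) _ (s≤s c<) e → true≢false (true-eqSP (trans (sym (iter′≡iter x (suc c) p)) e)) (before c c<) }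
cycLen-spec {n} {x} B p | nothing with cycle-bound B p
... | suc l , _ , l≤ , e = ⊥-elim (true≢false (true-eqSP (trans (sym (iter′≡iter x (suc l) p)) e)) (findℕ-nothing _ _ eq (∈-upTo l≤)))

iter-cycLen : ∀ {x : W n} → IsB x → ∀ p → iter′ x (cycLen x p) p ≡ p
iter-cycLen B p = proj₁ (cycLen-spec B p)

fix-add : ∀ {x : W n} {p} {c e} → iter′ x c p ≡ p → iter′ x e p ≡ p → iter′ x (c + e) p ≡ p
fix-add {x = x} {p} {c} {e} h k = trans (iter-+ x c e p) (trans (cong (iter′ x c) k) h)

fix-sub : ∀ {x : W n} {p} {c e} → iter′ x c p ≡ p → iter′ x (c + e) p ≡ p → iter′ x e p ≡ p
fix-sub {x = x} {p} {c} {e} h k = trans (cong (iter′ x e) (sym h)) (trans (sym (iter-+ x e c p)) (trans (cong (λ m → iter′ x m p) (ℕₚ.+-comm e c)) k))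

cycLen-divides : ∀ {x : W n} → IsB x → ∀ p c → iter′ x c p ≡ p → cycLen x p ∣ c
cycLen-divides {x = x} B p = least-divides (cycLen x p) (s≤s z≤n) (iter-cycLen B p) (proj₂ (proj₂ (cycLen-spec B p)))
  (λ {c} {e} → fix-add {x = x} {p} {c} {e}) (λ {c} {e} → fix-sub {x = x} {p} {c} {e})

iter-% : ∀ {x : W n} → IsB x → ∀ p m → iter′ x m p ≡ iter′ x (m % cycLen x p) p
iter-% {x = x} B p m = trans (cong (λ c → iter′ x c p) (DivMod.m≡m%n+[m/n]*n m (cycLen x p)))
  (trans (iter-+ x (m % cycLen x p) _ p) (cong (iter′ x (m % cycLen x p)) (iter-fix x (cycLen x p) (iter-cycLen B p) (m / cycLen x p))))

-- The searches in the definitions run over exponents below 2n; reduction modulo the cycle length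
-- brings any exponent into that range.
%-bound : ∀ {x : W n} → IsB x → ∀ p m → m % cycLen x p < 2 * n
%-bound {x = x} B p m = ℕₚ.<-≤-trans (DivMod.m%n<n m (cycLen x p)) (proj₁ (proj₂ (cycLen-spec B p)))

angle : W n → SP n → ℕ
angle {n} x p = Nord n / cycLen x p

angle-* : ∀ {x : W n} → IsB x → ∀ p → angle x p * cycLen x p ≡ Nord n
angle-* {n} {x} B p = DivMod.m/n*n≡m (∣! (cycLen x p) (2 * n) (s≤s z≤n) (proj₁ (proj₂ (cycLen-spec B p))))

cycLenPred-cong : ∀ (x x′ : W n) p p′ → (∀ m → eqSP (iter x (suc m) p) p ≡ eqSP (iter x′ (suc m) p′) p′) →
  cycLenPred x p ≡ cycLenPred x′ p′
cycLenPred-cong {n} x x′ p p′ h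
  with findℕ (λ m → eqSP (iter x (suc m) p) p) (upTo (2 * n))
     | findℕ (λ m → eqSP (iter x′ (suc m) p′) p′) (upTo (2 * n))
     | findℕ-cong {p = λ m → eqSP (iter x (suc m) p) p} {λ m → eqSP (iter x′ (suc m) p′) p′} h (upTo (2 * n))
... | just m | .(just m) | refl = refl
... | nothing | .nothing | refl = refl

eqSP-cong : ∀ {p q : SP n} {p′ q′ : SP n} → (p ≡ q → p′ ≡ q′) → (p′ ≡ q′ → p ≡ q) → eqSP p q ≡ eqSP p′ q′
eqSP-cong f g = ⇔⇒≡ᵇ (λ h → true-eqSP (f (eqSP-true h))) (λ h → true-eqSP (g (eqSP-true h)))

-- The search for the length sees only which exponents fix the point, so it may be compared across
-- different elements and points.
cycLenPred-⇔ : ∀ (x x′ : W n) p p′ → (∀ m → iter′ x m p ≡ p → iter′ x′ m p′ ≡ p′) →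
  (∀ m → iter′ x′ m p′ ≡ p′ → iter′ x m p ≡ p) → cycLenPred x p ≡ cycLenPred x′ p′
cycLenPred-⇔ x x′ p p′ f g = cycLenPred-cong x x′ p p′ λ m → eqSP-cong
  (λ e → trans (sym (iter′≡iter x′ (suc m) p′)) (f (suc m) (trans (iter′≡iter x (suc m) p) e)))
  (λ e → trans (sym (iter′≡iter x (suc m) p)) (g (suc m) (trans (iter′≡iter x′ (suc m) p′) e)))

iter-act-comm : ∀ {x z : W n} → Commute x z → ∀ a p → iter′ x a (act z p) ≡ act z (iter′ x a p)
iter-act-comm c a p = iter-commute c a 1 p

cycLenPred-commute : ∀ {x z : W n} → IsB z → Commute x z → ∀ p → cycLenPred x (act z p) ≡ cycLenPred x p
cycLenPred-commute {x = x} {z} Bz c p = cycLenPred-⇔ x x (act z p) p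
  (λ m e → act-inj Bz (trans (sym (iter-act-comm c m p)) e))
  (λ m e → trans (iter-act-comm c m p) (cong (act z) e))

cycLenPred-iter : ∀ {x : W n} → IsB x → ∀ a p → cycLenPred x (iter′ x a p) ≡ cycLenPred x p
cycLenPred-iter {x = x} B a p = cycLenPred-⇔ x x (iter′ x a p) p
  (λ m e → iter-inj B a (trans (iter-comm x a m p) e))
  (λ m e → trans (iter-comm x m a p) (cong (iter′ x a) e))

findFin-tabulate-min : ∀ {m n} (p : Fin n → Bool) (f : Fin m → Fin n) {r} → findFin p (List.tabulate f) ≡ just r →
  ∃ λ k → f k ≡ r × (∀ i → p (f i) ≡ true → toℕ k ≤ toℕ i)
findFin-tabulate-min {suc m} p f e with p (f Fin.zero) in eq
findFin-tabulate-min {suc m} p f refl | true = Fin.zero , refl , λ _ _ → z≤n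
findFin-tabulate-min {suc m} p f e | false with findFin-tabulate-min p (f ∘ Fin.suc) e
... | k , fk , low = Fin.suc k , fk , λ { Fin.zero h → ⊥-elim (true≢false h eq) ; (Fin.suc i) h → s≤s (low i h) }

findFin-min : ∀ (p : Fin n → Bool) {r} → findFin p (allFin n) ≡ just r → ∀ i → p i ≡ true → toℕ r ≤ toℕ i
findFin-min p e with findFin-tabulate-min p id e
... | k , refl , low = low

inCycle : W n → SP n → Fin n → Bool
inCycle {n} x q j = any (λ m → eqFin (proj₁ (iter x m q)) j) (upTo (2 * n))

inCycle-true : ∀ (x : W n) q j → inCycle x q j ≡ true → ∃ λ m → ∣ iter′ x m q ∣ₚ ≡ j
inCycle-true {n} x q j h with any-true _ (upTo (2 * n)) h
... | m , _ , e = m , trans (cong proj₁ (iter′≡iter x m q)) (eqFin-true e)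

true-inCycle : ∀ {x : W n} → IsB x → ∀ q j m → ∣ iter′ x m q ∣ₚ ≡ j → inCycle x q j ≡ true
true-inCycle {n} {x} B q j m e = true-any _ (upTo (2 * n)) (∈-upTo (%-bound B q m))
  (true-eqFin (trans (cong proj₁ (trans (sym (iter′≡iter x (m % cycLen x q) q)) (sym (iter-% B q m)))) e))

baseOf-spec : ∀ {x : W n} → IsB x → ∀ q → (∃ λ m → ∣ iter′ x m q ∣ₚ ≡ baseOf x q) × (∀ m → toℕ (baseOf x q) ≤ toℕ ∣ iter′ x m q ∣ₚ)
baseOf-spec {n} {x} B q with findFin (inCycle x q) (allFin n) in eq
... | just j = inCycle-true x q j (findFin-just _ (allFin n) eq) ,
        λ m → findFin-min (inCycle x q) eq _ (true-inCycle B q _ m refl)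
... | nothing = ⊥-elim (true≢false (true-inCycle B q ∣ q ∣ₚ 0 refl) (findFin-nothing _ (allFin n) eq (Memₚ.∈-allFin ∣ q ∣ₚ)))

baseOf-unique : ∀ {x : W n} → IsB x → ∀ q i m → ∣ iter′ x m q ∣ₚ ≡ i → (∀ m → toℕ i ≤ toℕ ∣ iter′ x m q ∣ₚ) → i ≡ baseOf x q
baseOf-unique B q i m refl low with baseOf-spec B q
... | (m′ , e) , low′ = Finₚ.toℕ-injective (ℕₚ.≤-antisym (subst (λ k → _ ≤ toℕ k) e (low m′)) (low′ m))

iter-return : ∀ {x : W n} → IsB x → ∀ a p → ∃ λ b → iter′ x b (iter′ x a p) ≡ p
-- Together with the first a steps this makes aN steps, and x^N = 1.
iter-return {n} {x} B a p = a * N-1 n , trans (sym (iter-+ x (a * N-1 n) a p)) (trans (cong (λ c → iter′ x c p)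
  (trans (cong (λ k → a * N-1 n + k) (sym (ℕₚ.*-identityʳ a))) (trans (sym (ℕₚ.*-distribˡ-+ a (N-1 n) 1)) (cong (a *_) (trans (ℕₚ.+-comm (N-1 n) 1) (suc-N-1 n))))))
  (iter-Nord* B a p))

-- Agreement up to sign is enough: the base point is a minimal absolute value, hence common to a
-- cycle and its negative.
baseOf-cycle : ∀ {x : W n} → IsB x → ∀ q q′ a → ∣ iter′ x a q ∣ₚ ≡ ∣ q′ ∣ₚ → baseOf x q′ ≡ baseOf x q
baseOf-cycle {n} {x} B q q′ a e with baseOf-spec B q′ | iter-return B a q
... | (m , f) , low | b , r = baseOf-unique B q (baseOf x q′) (m + a)
  (trans (cong ∣_∣ₚ (iter-+ x m a q)) (trans (iter-abs-cong x m e) f))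
  (λ m → subst (λ k → _ ≤ toℕ k) (trans (cong ∣_∣ₚ (iter-+ x m b q′)) (iter-abs-cong x m (trans (iter-abs-cong x b (sym e)) (cong ∣_∣ₚ r)))) (low (m + b)))

isBase-true : ∀ {x : W n} → IsB x → ∀ i → isBase x i ≡ true → baseOf x (pt i) ≡ i
isBase-true {n} {x} B i h = sym (baseOf-unique B (pt i) i 0 refl λ m →
  subst (λ p → toℕ i ≤ toℕ ∣ p ∣ₚ) (trans (sym (iter′≡iter x (m % cycLen x (pt i)) (pt i))) (sym (iter-% B (pt i) m)))
  (ℕₚ.≤ᵇ⇒≤ _ _ (subst T (sym (all-true (λ m → toℕ i ≤ᵇ toℕ (proj₁ (iter x m (i , false)))) (upTo (2 * n)) h (∈-upTo (%-bound B (pt i) m)))) tt)))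

true-isBase : ∀ {x : W n} → IsB x → ∀ i → baseOf x (pt i) ≡ i → isBase x i ≡ true
true-isBase {n} {x} B i h = true-all _ (upTo (2 * n)) λ {m} _ → T⇒true (ℕₚ.≤⇒≤ᵇ
  (subst (λ p → toℕ i ≤ toℕ ∣ p ∣ₚ) (iter′≡iter x m (pt i)) (subst (λ k → toℕ k ≤ toℕ ∣ iter′ x m (pt i) ∣ₚ) h (proj₂ (baseOf-spec B (pt i)) m))))

baseOf-isBase : ∀ {x : W n} → IsB x → ∀ q → isBase x (baseOf x q) ≡ true
baseOf-isBase {n} {x} B q with baseOf-spec B q
... | (m , e) , _ = true-isBase B (baseOf x q) (baseOf-cycle B q (pt (baseOf x q)) m e)

classMinus-true : ∀ {x : W n} → IsB x → ∀ K i → iter′ x K (pt i) ≡ negSP (pt i) → classMinus x i ≡ true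
classMinus-true {n} {x} B K i e = true-any _ (upTo (2 * n)) (∈-upTo (%-bound B (pt i) K))
  (true-eqSP (trans (sym (iter′≡iter x (K % cycLen x (pt i)) (pt i))) (trans (sym (iter-% B (pt i) K)) e)))

-- The hypothesis Min says that −q lies on the cycle of q: the class of the cycle is −1.
module Minus {x : W n} (B : IsB x) (K : ℕ) where

  Min : SP n → Set
  Min q = iter′ x K q ≡ negSP q

  Min-iter : ∀ {q} a → Min q → Min (iter′ x a q)
  Min-iter {q} a h = trans (iter-comm x K a q) (trans (cong (iter′ x a) h) (iter-neg x a q))

  Min-neg : ∀ {q} → Min q → Min (negSP q)
  Min-neg {q} h = trans (iter-neg x K q) (cong negSP h)

  Min-abs : ∀ {q q′} → ∣ q ∣ₚ ≡ ∣ q′ ∣ₚ → Min q → Min q′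
  Min-abs {q} {q′} e h with abs-eq {p = q′} {q} (sym e)
  ... | inj₁ refl = h
  ... | inj₂ refl = Min-neg h

  -- A hit up to sign becomes an exact one after `K` further steps, because x^K negates q.
  abs⇒cycle : ∀ {q q′} a → Min q → ∣ iter′ x a q ∣ₚ ≡ ∣ q′ ∣ₚ → ∃ λ b → iter′ x b q ≡ q′
  abs⇒cycle {q} {q′} a h e with abs-eq e
  ... | inj₁ f = a , f
  ... | inj₂ f = a + K , trans (iter-+ x a K q) (trans (cong (iter′ x a) h) (trans (iter-neg x a q) (trans (cong negSP f) (neg-neg q′))))

  toBase : ∀ {q} → Min q → ∃ λ b → iter′ x b q ≡ pt (baseOf x q)
  toBase {q} h with baseOf-spec B q
  ... | (m , e) , _ = abs⇒cycle m h e

  fromBase : ∀ {q} → Min q → ∃ λ b → iter′ x b (pt (baseOf x q)) ≡ q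
  fromBase {q} h with toBase h
  ... | b , e with iter-return B b q
  ... | b′ , r = b′ , trans (cong (iter′ x b′) (sym e)) r

  sameBase⇒cycle : ∀ {q q′} → Min q → Min q′ → baseOf x q ≡ baseOf x q′ → ∃ λ b → iter′ x b q ≡ q′
  sameBase⇒cycle {q} {q′} h h′ e with toBase h | fromBase h′
  ... | a , f | b , g = b + a , trans (iter-+ x b a q) (trans (cong (iter′ x b) (trans f (cong pt e))) g)

-- The exponent r with q = x^r · base; 0 if there is none.
dlog : W n → SP n → ℕ
dlog {n} x q = fromMaybe 0 (findℕ (λ r → eqSP (iter x r (pt (baseOf x q))) q) (upTo (2 * n)))

dlog-spec : ∀ {x : W n} → IsB x → ∀ q b → iter′ x b (pt (baseOf x q)) ≡ q → iter′ x (dlog x q) (pt (baseOf x q)) ≡ q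
dlog-spec {n} {x} B q b e with findℕ (λ r → eqSP (iter x r (pt (baseOf x q))) q) (upTo (2 * n)) in eq
... | just r = trans (iter′≡iter x r _) (eqSP-true (proj₁ (proj₂ (findℕ-upTo-just _ (2 * n) eq))))
... | nothing = ⊥-elim (true≢false (true-eqSP (trans (sym (iter′≡iter x (b % cycLen x (pt (baseOf x q))) (pt (baseOf x q)))) (trans (sym (iter-% B (pt (baseOf x q)) b)) e)))
       (findℕ-nothing _ (upTo (2 * n)) eq (∈-upTo (%-bound B (pt (baseOf x q)) b))))

baseOf-cong : ∀ (x x′ : W n) q → (∀ m → iter x m q ≡ iter x′ m q) → baseOf x q ≡ baseOf x′ q
baseOf-cong {n} x x′ q h
  with findFin (inCycle x q) (allFin n) | findFin (inCycle x′ q) (allFin n)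
     | findFin-cong {p = inCycle x q} {inCycle x′ q} (λ j → any-cong (λ m → cong (λ p → eqFin (proj₁ p) j) (h m)) (upTo (2 * n))) (allFin n)
... | just j | .(just j) | refl = refl
... | nothing | .nothing | refl = refl

isBase-cong : ∀ (x x′ : W n) i → (∀ m → iter x m (pt i) ≡ iter x′ m (pt i)) → isBase x i ≡ isBase x′ i
isBase-cong {n} x x′ i h = all-cong (λ m → cong (λ p → toℕ i ≤ᵇ toℕ (proj₁ p)) (h m)) (upTo (2 * n))

dlog-cong : ∀ (x x′ : W n) q → (∀ m → iter x m q ≡ iter x′ m q) →
  (∀ m → iter x m (pt (baseOf x q)) ≡ iter x′ m (pt (baseOf x q))) → dlog x q ≡ dlog x′ q
dlog-cong {n} x x′ q h h′ = cong (fromMaybe 0) (findℕ-cong (λ r → cong (λ p → eqSP p q)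
  (trans (h′ r) (cong (λ b → iter x′ r (pt b)) (baseOf-cong x x′ q h)))) (upTo (2 * n)))

-- The test `ok` local to `coordR`, restated so that it can be reasoned about. Its second
-- alternative concerns cycles of class +1 and disappears when `classMinus` holds.
coordOK : W n → W n → Fin n → ℕ → Bool
coordOK x z i r = eqSP (iter x r (pt (baseOf x (app z (pt i))))) (app z (pt i))
  ∨ (not (classMinus x i) ∧ eqSP (iter x r (pt (baseOf x (app z (pt i))))) (negSP (app z (pt i))))

coordOK-minus : ∀ (x z : W n) i r → classMinus x i ≡ true →
  coordOK x z i r ≡ eqSP (iter x r (pt (baseOf x (app z (pt i))))) (app z (pt i))
coordOK-minus x z i r cm rewrite cm = Boolₚ.∨-identityʳ _

-- The search in `coordR` is bounded by the length of the cycle of i, whereas the exponent lives on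
-- the cycle of z(i). The bound suffices because z commutes with x and so preserves cycle lengths.
coordR-spec : ∀ {x z : W n} → IsB x → IsB z → Commute x z → ∀ i → classMinus x i ≡ true →
  (∃ λ b → iter′ x b (pt (baseOf x (app z (pt i)))) ≡ app z (pt i)) →
  iter′ x (coordR x z i) (pt (baseOf x (app z (pt i)))) ≡ app z (pt i)
coordR-spec {n} {x} {z} B Bz c i cm (b , e)
  with findℕ (coordOK x z i) (upTo (suc (cycLenPred x (i , false)))) in eq
... | just r = trans (iter′≡iter x r _) (eqSP-true (trans (sym (coordOK-minus x z i r cm))
    (proj₁ (proj₂ (findℕ-upTo-just (coordOK x z i) (suc (cycLenPred x (i , false))) eq)))))
... | nothing = ⊥-elim (true≢false (trans (coordOK-minus x z i r cm) hit)
    (findℕ-nothing (coordOK x z i) (upTo (suc (cycLenPred x (i , false)))) eq (∈-upTo bound)))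
  where
  P = pt (baseOf x (app z (pt i)))
  r = b % cycLen x P
  len : cycLenPred x P ≡ cycLenPred x (pt i)
  len = trans (sym (trans (cong (cycLenPred x) (sym e)) (cycLenPred-iter B b P)))
    (trans (cong (cycLenPred x) (sym (act≡app z (pt i)))) (cycLenPred-commute Bz c (pt i)))
  bound : r < suc (cycLenPred x (pt i))
  bound = subst (λ m → r < suc m) len (DivMod.m%n<n b (cycLen x P))
  hit : eqSP (iter x r P) (app z (pt i)) ≡ true
  hit = true-eqSP (trans (sym (iter′≡iter x r P)) (trans (sym (iter-% B P b)) e))

-- Angles and higher Lie characters

module Angles {c ℓ : Level} (R : CommutativeRing c ℓ) (n : ℕ) (ζ : CommutativeRing.Carrier R)
  (ζᴺ : IsRoot R n ζ) where

  open CommutativeRing R renaming (_+_ to _⊕_; _*_ to _⊛_; refl to ≈-refl; sym to ≈-sym; trans to ≈-trans)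
  open RingSums R
  module CM = CMSolver *-commutativeMonoid
  open CM using (_⊜_) renaming (_⊕_ to _:*_; solve to solve*)

  inverse-unique : ∀ {a b b′} → a ⊛ b ≈ 1# → a ⊛ b′ ≈ 1# → b ≈ b′
  inverse-unique {a} {b} {b′} e e′ = ≈-trans (≈-sym (*-identityʳ b)) (≈-trans (*-congˡ (≈-sym e′))
    (≈-trans (solve* 3 (λ a b c → b :* (a :* c) ⊜ (a :* b) :* c) ≈-refl a b b′) (≈-trans (*-congʳ e) (*-identityˡ b′))))

  ζ-period : ∀ m → pow ζ (m * Nord n) ≈ 1#
  ζ-period m = ≈-trans (pow-* ζ m (Nord n)) (pow-one m ζᴺ)

  -- Exponents reaching the same point differ by a multiple of the cycle length ℓ, and ℓ times the
  -- angle N/ℓ is N.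
  pow-cycle-≤ : ∀ {x : W n} → IsB x → ∀ p a b → a ≤ b → iter′ x a p ≡ iter′ x b p →
    pow ζ (a * angle x p) ≈ pow ζ (b * angle x p)
  pow-cycle-≤ {x} B p a b a≤b e with ℕₚ.m≤n⇒∃[o]m+o≡n a≤b
  ... | d , refl with cycLen-divides B p d (sym (iter-inj B a (trans e (iter-+ x a d p))))
  ... | divides q refl = ≈-sym (≈-trans (reflexive (cong (pow ζ) (trans (ℕₚ.*-distribʳ-+ (angle x p) a (q * cycLen x p))
            (cong (a * angle x p +_) (trans (ℕₚ.*-assoc q (cycLen x p) (angle x p)) (cong (q *_) (trans (ℕₚ.*-comm (cycLen x p) (angle x p)) (angle-* B p))))))))
          (≈-trans (pow-+ ζ (a * angle x p) (q * Nord n)) (≈-trans (*-congˡ (ζ-period q)) (*-identityʳ _))))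

  pow-cycle : ∀ {x : W n} → IsB x → ∀ p a b → iter′ x a p ≡ iter′ x b p →
    pow ζ (a * angle x p) ≈ pow ζ (b * angle x p)
  pow-cycle B p a b e with ℕₚ.≤-total a b
  ... | inj₁ a≤b = pow-cycle-≤ B p a b a≤b e
  ... | inj₂ b≤a = ≈-sym (pow-cycle-≤ B p b a b≤a (sym e))

  -- `θ x q` is the faithful character of the cycle of q at the power of the cycle that carries the
  -- base point to q. `θ⁻` is its inverse, -1 being represented by N - 1 in the exponent.
  θ θ⁻ : W n → SP n → Carrier
  θ x q = pow ζ (dlog x q * angle x q)
  θ⁻ x q = pow ζ (N-1 n * (dlog x q * angle x q))

  θ*θ⁻ : ∀ x q → θ x q ⊛ θ⁻ x q ≈ 1#
  θ*θ⁻ x q = ≈-trans (≈-sym (pow-+ ζ e (N-1 n * e))) (≈-trans (reflexive (cong (pow ζ)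
    (trans (cong (_* e) (suc-N-1 n)) (ℕₚ.*-comm (Nord n) e)))) (ζ-period e))
    where e = dlog x q * angle x q

  angle-len : ∀ (x x′ : W n) p p′ → cycLenPred x p ≡ cycLenPred x′ p′ → angle x p ≡ angle x′ p′
  angle-len x x′ p p′ e = cong (λ l → Nord n / suc l) e

  θ-val : ∀ {x} → IsB x → ∀ q r → iter′ x r (pt (baseOf x q)) ≡ q → θ x q ≈ pow ζ (r * angle x q)
  θ-val {x} B q r e = ≈-trans (reflexive (cong (λ u → pow ζ (dlog x q * u)) len))
    (≈-trans (pow-cycle B P (dlog x q) r (trans (dlog-spec B q r e) (sym e))) (reflexive (cong (λ u → pow ζ (r * u)) (sym len))))
    where
    P = pt (baseOf x q)
    len : angle x q ≡ angle x P
    len = angle-len x x q P (trans (cong (cycLenPred x) (sym e)) (cycLenPred-iter B r P))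

  θ-base : ∀ {x} → IsB x → ∀ i → isBase x i ≡ true → θ x (pt i) ≈ 1#
  θ-base {x} B i b = θ-val B (pt i) 0 (cong pt (isBase-true B i b))

  θ⁻-base : ∀ {x} → IsB x → ∀ i → isBase x i ≡ true → θ⁻ x (pt i) ≈ 1#
  θ⁻-base {x} B i b = inverse-unique (θ*θ⁻ x (pt i)) (≈-trans (*-congʳ (θ-base B i b)) (*-identityˡ 1#))

  θ-iter : ∀ {x} (B : IsB x) K q r → Minus.Min B K q → θ x (iter′ x r q) ≈ pow ζ (r * angle x q) ⊛ θ x q
  θ-iter {x} B K q r h with Minus.fromBase B K h
  ... | b , e = ≈-trans (θ-val B (iter′ x r q) (r + b) (trans (cong (λ i → iter′ x (r + b) (pt i)) (baseOf-cycle B q (iter′ x r q) r refl))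
            (trans (iter-+ x r b _) (cong (iter′ x r) e))))
          (≈-trans (reflexive (cong (λ u → pow ζ ((r + b) * u)) (angle-len x x (iter′ x r q) q (cycLenPred-iter B r q))))
          (≈-trans (reflexive (cong (pow ζ) (ℕₚ.*-distribʳ-+ (angle x q) r b))) (≈-trans (pow-+ ζ (r * angle x q) (b * angle x q))
          (*-congˡ (≈-sym (θ-val B q b e))))))

  θ⁻-iter : ∀ {x} (B : IsB x) K q r → Minus.Min B K q → pow ζ (r * angle x q) ⊛ θ⁻ x (iter′ x r q) ≈ θ⁻ x q
  θ⁻-iter {x} B K q r h = ≈-sym (inverse-unique (θ*θ⁻ x q) (≈-trans (solve* 3 (λ a b c → a :* (b :* c) ⊜ (b :* a) :* c) ≈-refl _ _ _)
      (≈-trans (*-congʳ (≈-sym (θ-iter B K q r h))) (θ*θ⁻ x (iter′ x r q)))))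

  -- Along a cycle θ is multiplied by a root of unity depending only on the cycle
  -- length, so ratios of angles are constant on cycles.
  ratio-iter : ∀ {x x′ : W n} (B : IsB x) (B′ : IsB x′) K q q′ r → Minus.Min B K q → Minus.Min B′ K q′ →
    cycLenPred x q ≡ cycLenPred x′ q′ →
    θ x (iter′ x r q) ⊛ θ⁻ x′ (iter′ x′ r q′) ≈ θ x q ⊛ θ⁻ x′ q′
  ratio-iter {x} {x′} B B′ K q q′ r h h′ len = ≈-trans (*-congʳ (≈-trans (θ-iter B K q r h)
      (*-congʳ (reflexive (cong (λ u → pow ζ (r * u)) (angle-len x x′ q q′ len))))))
    (≈-trans (solve* 3 (λ a b c → (a :* b) :* c ⊜ b :* (a :* c)) ≈-refl _ _ _) (*-congˡ (θ⁻-iter B′ K q′ r h′)))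

  bases : W n → List (Fin n)
  bases x = filterᵇ (isBase x) (allFin n)

  bases-unique : ∀ x → Unique (bases x)
  bases-unique x = filterᵇ-unique (isBase x) (Uniqueₚ.allFin⁺ n)

  ∈-bases : ∀ {x i} → isBase x i ≡ true → i ∈ bases x
  ∈-bases {x} {i} h = ∈-filterᵇ⁺ (isBase x) (allFin n) (Memₚ.∈-allFin i) h

  ∈-bases⁻ : ∀ {x i} → i ∈ bases x → isBase x i ≡ true
  ∈-bases⁻ {x} m = proj₂ (∈-filterᵇ⁻ (isBase x) (allFin n) m)

  intertwine-iter : ∀ {z x x′ : W n} → (∀ p → act z (act x p) ≡ act x′ (act z p)) → ∀ r p → act z (iter′ x r p) ≡ iter′ x′ r (act z p)
  intertwine-iter {z} {x} {x′} t zero p = refl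
  intertwine-iter {z} {x} {x′} t (suc r) p = trans (t (iter′ x r p)) (cong (act x′) (intertwine-iter {z} {x} {x′} t r p))

  -- `z` carries the cycles of x to those of x′, but not base points to base points. Since `F` is
  -- constant along the cycles of x′, moving each image to its base point changes no factor.
  ∏-bases : ∀ {x x′ z : W n} (B : IsB x) (B′ : IsB x′) → IsB z → ∀ K → (∀ p → Minus.Min B′ K p) →
    (∀ p → act z (act x p) ≡ act x′ (act z p)) → (F : SP n → Carrier) → (∀ r p → F (iter′ x′ r p) ≈ F p) →
    ∏ (bases x) (λ i → F (act z (pt i))) ≈ ∏ (bases x′) (λ i → F (pt i))
  ∏-bases {x} {x′} {z} B B′ Bz K min t F inv-F =
    ≈-trans (Prod.bigop-cong (bases x) same)
      (Prod.bigop-reindex h (λ i → F (pt i)) (bases-unique x) (bases-unique x′) (λ _ → ∈-bases (baseOf-isBase B′ _)) inj onto)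
    where
    h : Fin n → Fin n
    h i = baseOf x′ (act z (pt i))
    ti = intertwine-iter {z} {x} {x′} t
    minx : ∀ p → Minus.Min B K p
    minx p = act-inj Bz (trans (ti K p) (trans (min (act z p)) (sym (act-neg z p))))
    same : ∀ {i} → i ∈ bases x → F (act z (pt i)) ≈ F (pt (h i))
    same {i} _ with Minus.toBase B′ K (min (act z (pt i)))
    ... | b , e = ≈-trans (≈-sym (inv-F b (act z (pt i)))) (reflexive (cong F e))
    inj : ∀ {i j} → i ∈ bases x → j ∈ bases x → h i ≡ h j → i ≡ j
    inj {i} {j} i∈ j∈ e with Minus.sameBase⇒cycle B′ K (min (act z (pt i))) (min (act z (pt j))) e
    ... | b , f = trans (sym (isBase-true B i (∈-bases⁻ i∈))) (trans (sym (baseOf-cycle B (pt i) (pt j) b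
          (cong ∣_∣ₚ (act-inj Bz (trans (ti b (pt i)) f))))) (isBase-true B j (∈-bases⁻ j∈)))
    onto : ∀ {j} → j ∈ bases x′ → ∃ λ i → i ∈ bases x × h i ≡ j
    onto {j} j∈ with Minus.toBase B K (minx (act (inv z) (pt j)))
    ... | b , e = baseOf x (act (inv z) (pt j)) , ∈-bases (baseOf-isBase B _) ,
          trans (baseOf-cycle B′ (pt j) _ b (cong ∣_∣ₚ (trans (cong (iter′ x′ b) (sym (act-inv Bz (pt j))))
            (trans (sym (ti b _)) (cong (act z) e))))) (isBase-true B′ j (∈-bases⁻ j∈))

  -- The value ω^x(z) when all cycles of x have class -1: one root of unity for each cycle, while
  -- the permutation of the cycles contributes nothing.
  Ω : W n → W n → Carrier
  Ω x z = ∏ (bases x) (λ i → θ x (act z (pt i)))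

  -- θ⁻ is 1 at base points. For z commuting with x the ratio does not depend on the point chosen on
  -- the cycle, which `Ω` in its original form conceals.
  Ω-ratio : ∀ {x} → IsB x → ∀ z → Ω x z ≈ ∏ (bases x) (λ i → θ x (act z (pt i)) ⊛ θ⁻ x (pt i))
  Ω-ratio {x} B z = Prod.bigop-cong (bases x) (λ {i} i∈ → ≈-sym (≈-trans (*-congˡ (θ⁻-base B i (∈-bases⁻ i∈))) (*-identityʳ _)))

  ωexp-Ω : ∀ {x z} (B : IsB x) → IsB z → Commute x z → ∀ K → (∀ p → Minus.Min B K p) → pow ζ (ωexp x z) ≈ Ω x z
  ωexp-Ω {x} {z} B Bz c K min = go (allFin n)
    where
    term : Fin n → ℕ
    term i = coordR x z i * (Nord n / suc (cycLenPred x (i , false)))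
    coord : ∀ i → pow ζ (term i) ≈ θ x (act z (pt i))
    coord i with Minus.fromBase B K (min (act z (pt i)))
    ... | b , e with act z (pt i) | act≡app z (pt i) | cycLenPred-commute {x = x} {z} Bz c (pt i)
    ... | .(app z (pt i)) | refl | len = ≈-sym (≈-trans (θ-val B (app z (pt i)) (coordR x z i)
            (coordR-spec B Bz c i (classMinus-true B K i (min (pt i))) (b , e)))
            (reflexive (cong (λ u → pow ζ (coordR x z i * u)) (angle-len x x _ (pt i) len))))
    go : ∀ is → pow ζ (foldr (λ i acc → (if isBase x i then coordR x z i * (Nord n / suc (cycLenPred x (i , false))) else 0) + acc) 0 is)
      ≈ ∏ (filterᵇ (isBase x) is) (λ i → θ x (act z (pt i)))
    go [] = ≈-refl
    go (i ∷ is) with isBase x i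
    ... | true = ≈-trans (pow-+ ζ (term i) _) (*-cong (coord i) (go is))
    ... | false = go is

  -- Conjugation by t moves base points, so pulling θ back along t introduces a correction `C`. It
  -- is constant along the cycles of x′ and y permutes these cycles, so the corrections at y p and
  -- at p cancel in the product.
  Ω-conj : ∀ {x x′ y z t : W n} (B : IsB x) (B′ : IsB x′) → IsB y → IsB t → ∀ K → (∀ p → Minus.Min B′ K p) →
    (∀ p → act t (act x p) ≡ act x′ (act t p)) → (∀ p → act t (act z p) ≡ act y (act t p)) → Commute x′ y →
    Ω x z ≈ Ω x′ y
  Ω-conj {x} {x′} {y} {z} {t} B B′ By Bt K min tx tz c =
    ≈-trans (Ω-ratio B z) (≈-trans (Prod.bigop-cong (bases x) (λ {i} _ → reflexive (G′-t i)))
    (≈-trans (∏-bases B B′ Bt K min tx G′ G′-inv) (≈-trans (Prod.bigop-cong (bases x′) (λ {i} _ → split (pt i)))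
    (≈-trans (Prod.bigop-∙ (bases x′) _ _) (≈-trans (*-cong (≈-sym (Ω-ratio B′ y)) cancel) (*-identityʳ _))))))
    where
    t⁻ : SP n → SP n
    t⁻ = act (inv t)
    minx : ∀ p → Minus.Min B K p
    minx p = act-inj Bt (trans (intertwine-iter {t} {x} {x′} tx K p) (trans (min (act t p)) (sym (act-neg t p))))
    t⁻-iter : ∀ r p → t⁻ (iter′ x′ r p) ≡ iter′ x r (t⁻ p)
    t⁻-iter r p = act-inj Bt (trans (act-inv Bt _) (sym (trans (intertwine-iter {t} {x} {x′} tx r (t⁻ p)) (cong (iter′ x′ r) (act-inv Bt p)))))
    G′ G : SP n → Carrier
    G′ p = θ x (t⁻ (act y p)) ⊛ θ⁻ x (t⁻ p)
    G p = θ x′ (act y p) ⊛ θ⁻ x′ p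
    C C⁻ : SP n → Carrier
    C p = θ x (t⁻ p) ⊛ θ⁻ x′ p
    C⁻ p = θ x′ p ⊛ θ⁻ x (t⁻ p)
    G′-t : ∀ i → θ x (act z (pt i)) ⊛ θ⁻ x (pt i) ≡ G′ (act t (pt i))
    G′-t i = cong₂ (λ p q → θ x p ⊛ θ⁻ x q) (trans (sym (inv-act Bt _)) (cong t⁻ (tz (pt i)))) (sym (inv-act Bt (pt i)))
    len-t : ∀ p → cycLenPred x (t⁻ p) ≡ cycLenPred x′ p
    len-t p = cycLenPred-⇔ x x′ (t⁻ p) p
      (λ m e → trans (sym (act-inv Bt _)) (trans (cong (act t) (trans (t⁻-iter m p) e)) (act-inv Bt p)))
      (λ m e → trans (sym (t⁻-iter m p)) (cong t⁻ e))
    G′-inv : ∀ r p → G′ (iter′ x′ r p) ≈ G′ p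
    G′-inv r p = ≈-trans (reflexive (cong₂ (λ p q → θ x p ⊛ θ⁻ x q)
        (trans (cong t⁻ (sym (iter-act-comm c r p))) (t⁻-iter r (act y p))) (t⁻-iter r p)))
      (ratio-iter B B K (t⁻ (act y p)) (t⁻ p) r (minx _) (minx _)
        (trans (len-t (act y p)) (trans (cycLenPred-commute By c p) (sym (len-t p)))))
    C-inv : ∀ r p → C (iter′ x′ r p) ≈ C p
    C-inv r p = ≈-trans (reflexive (cong (λ q → θ x q ⊛ θ⁻ x′ (iter′ x′ r p)) (t⁻-iter r p)))
      (ratio-iter B B′ K (t⁻ p) p r (minx _) (min _) (len-t p))
    split : ∀ p → G′ p ≈ G p ⊛ (C (act y p) ⊛ C⁻ p)
    split p = ≈-sym (≈-trans (solve* 6 (λ a a⁻ b b⁻ u v → (a :* b⁻) :* ((u :* a⁻) :* (b :* v)) ⊜ (a :* a⁻) :* ((b :* b⁻) :* (u :* v))) ≈-refl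
        (θ x′ (act y p)) (θ⁻ x′ (act y p)) (θ x′ p) (θ⁻ x′ p) (θ x (t⁻ (act y p))) (θ⁻ x (t⁻ p)))
      (≈-trans (*-cong (θ*θ⁻ x′ (act y p)) (≈-trans (*-congʳ (θ*θ⁻ x′ p)) (*-identityˡ _))) (*-identityˡ _)))
    cancel : ∏ (bases x′) (λ i → C (act y (pt i)) ⊛ C⁻ (pt i)) ≈ 1#
    cancel = ≈-trans (Prod.bigop-∙ (bases x′) _ _) (≈-trans (*-congʳ (∏-bases B′ B′ By K min (λ p → sym (commutes c p)) C C-inv))
      (≈-trans (≈-sym (Prod.bigop-∙ (bases x′) _ _)) (Prod.bigop-ε (bases x′) (λ {i} _ →
        ≈-trans (solve* 4 (λ u v w s → (u :* v) :* (w :* s) ⊜ (w :* v) :* (u :* s)) ≈-refl _ _ _ _)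
          (≈-trans (*-cong (θ*θ⁻ x′ (pt i)) (θ*θ⁻ x (t⁻ (pt i)))) (*-identityˡ 1#))))))

-- Conjugacy classes and centralizers

-- The common form of `repsGo` and `transGo`: an element is kept unless one kept before is related
-- to it.
module Greedy {A : Set} (rel : A → A → Bool) where

  greedy : List A → List A → List A
  greedy acc [] = []
  greedy acc (x ∷ xs) = if any (λ r → rel r x) acc then greedy acc xs else x ∷ greedy (x ∷ acc) xs

  greedy-⊆ : ∀ acc xs {z} → z ∈ greedy acc xs → z ∈ xs
  greedy-⊆ acc (x ∷ xs) m with any (λ r → rel r x) acc
  greedy-⊆ acc (x ∷ xs) m | true = there (greedy-⊆ acc xs m)
  greedy-⊆ acc (x ∷ xs) (here e) | false = here e
  greedy-⊆ acc (x ∷ xs) (there m) | false = there (greedy-⊆ (x ∷ acc) xs m)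

  greedy-unique : ∀ acc {xs} → Unique xs → Unique (greedy acc xs)
  greedy-unique acc {[]} u = []
  greedy-unique acc {x ∷ xs} (h ∷ u) with any (λ r → rel r x) acc
  ... | true = greedy-unique acc u
  ... | false = All.tabulate (λ m → All.lookup h (greedy-⊆ (x ∷ acc) xs m)) ∷ greedy-unique (x ∷ acc) u

  greedy-fresh : ∀ acc xs {z r} → z ∈ greedy acc xs → r ∈ acc → rel r z ≡ true → ⊥
  greedy-fresh acc (x ∷ xs) m r∈ h with any (λ r → rel r x) acc in eq
  greedy-fresh acc (x ∷ xs) m r∈ h | true = greedy-fresh acc xs m r∈ h
  greedy-fresh acc (x ∷ xs) (here refl) r∈ h | false = true≢false (true-any (λ r → rel r x) acc r∈ h) eq
  greedy-fresh acc (x ∷ xs) (there m) r∈ h | false = greedy-fresh (x ∷ acc) xs m (there r∈) h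

  -- Relatedness is tested only from the earlier element to the later one, and the order of the two
  -- is not known here; hence both directions are assumed.
  greedy-independent : ∀ acc xs {z z′} → z ∈ greedy acc xs → z′ ∈ greedy acc xs → rel z z′ ≡ true → rel z′ z ≡ true → z ≡ z′
  greedy-independent acc (x ∷ xs) m m′ h h′ with any (λ r → rel r x) acc
  greedy-independent acc (x ∷ xs) m m′ h h′ | true = greedy-independent acc xs m m′ h h′
  greedy-independent acc (x ∷ xs) (here refl) (here refl) h h′ | false = refl
  greedy-independent acc (x ∷ xs) (here refl) (there m′) h h′ | false = ⊥-elim (greedy-fresh (x ∷ acc) xs m′ (here refl) h)
  greedy-independent acc (x ∷ xs) (there m) (here refl) h h′ | false = ⊥-elim (greedy-fresh (x ∷ acc) xs m (here refl) h′)
  greedy-independent acc (x ∷ xs) (there m) (there m′) h h′ | false = greedy-independent (x ∷ acc) xs m m′ h h′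

  greedy-cover : ∀ acc xs {z} → rel z z ≡ true → z ∈ xs →
    (∃ λ r → r ∈ acc × rel r z ≡ true) ⊎ (∃ λ r → r ∈ greedy acc xs × rel r z ≡ true)
  greedy-cover acc (x ∷ xs) h m with any (λ r → rel r x) acc in eq
  greedy-cover acc (x ∷ xs) h (here refl) | true = inj₁ (any-true (λ r → rel r x) acc eq)
  greedy-cover acc (x ∷ xs) h (there m) | true = greedy-cover acc xs h m
  greedy-cover acc (x ∷ xs) h (here refl) | false = inj₂ (x , here refl , h)
  greedy-cover acc (x ∷ xs) h (there m) | false with greedy-cover (x ∷ acc) xs h m
  ... | inj₁ (r , here refl , k) = inj₂ (x , here refl , k)
  ... | inj₁ (r , there r∈ , k) = inj₁ (r , r∈ , k)
  ... | inj₂ (r , r∈ , k) = inj₂ (r , there r∈ , k)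

  greedy-cover[] : ∀ xs {z} → rel z z ≡ true → z ∈ xs → ∃ λ r → r ∈ greedy [] xs × rel r z ≡ true
  greedy-cover[] xs h m with greedy-cover [] xs h m
  ... | inj₂ w = w

open Greedy

repsGo≡greedy : ∀ (acc xs : List (W n)) → repsGo acc xs ≡ greedy conjugate acc xs
repsGo≡greedy acc [] = refl
repsGo≡greedy acc (x ∷ xs) with any (λ r → conjugate r x) acc
... | true = repsGo≡greedy acc xs
... | false = cong (x ∷_) (repsGo≡greedy (x ∷ acc) xs)

opaque
  sameCoset : W n → W n → W n → Bool
  sameCoset x t g = inZ x (inv t · g)

  sameCoset-def : ∀ (x t g : W n) → sameCoset x t g ≡ inZ x (inv t · g)
  sameCoset-def x t g = refl

  transGo≡greedy : ∀ (x : W n) acc xs → transGo x acc xs ≡ greedy (sameCoset x) acc xs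
  transGo≡greedy x acc [] = refl
  transGo≡greedy x acc (g ∷ gs) with any (λ t → inZ x (inv t · g)) acc
  ... | true = transGo≡greedy x acc gs
  ... | false = cong (g ∷_) (transGo≡greedy x (g ∷ acc) gs)

  conj : W n → W n → W n
  conj t x = t · x · inv t

  conj-def : ∀ (t x : W n) → t · x · inv t ≡ conj t x
  conj-def t x = refl

  conj-act : ∀ {t : W n} → IsB t → ∀ x p → act t (act x p) ≡ act (conj t x) (act t p)
  conj-act {t = t} B x p = sym (trans (act-· (t · x) (inv t) (act t p)) (trans (cong (act (t · x)) (inv-act B p)) (act-· t x p)))

conj-unique : ∀ {t : W n} → IsB t → ∀ x x′ → (∀ p → act t (act x p) ≡ act x′ (act t p)) → conj t x ≡ x′
conj-unique {t = t} B x x′ h = W-ext λ p → trans (cong (act (conj t x)) (sym (act-inv B p)))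
  (trans (sym (conj-act B x _)) (trans (h _) (cong (act x′) (act-inv B p))))

IsB-conj : ∀ {t x : W n} → IsB t → IsB x → IsB (conj t x)
IsB-conj {t = t} {x} Bt Bx = subst IsB (conj-def t x) (IsB-· (IsB-· Bt Bx) (IsB-inv Bt))

conjugate-true : ∀ {a b : W n} → conjugate a b ≡ true → ∃ λ g → IsB g × conj g a ≡ b
conjugate-true {n} {a} {b} h with any-true _ (Bn n) h
... | g , g∈ , e = g , ∈-Bn⁻ g∈ , trans (sym (conj-def g a)) (eqW-true {v = g · a · inv g} {b} e)

true-conjugate : ∀ {g a b : W n} → IsB g → conj g a ≡ b → conjugate a b ≡ true
true-conjugate {n} {g} {a} {b} Bg e = true-any (λ g → eqW (g · a · inv g) b) (Bn n) (∈-Bn Bg) (true-eqW (trans (conj-def g a) e))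

conjugate-refl : ∀ (a : W n) → conjugate a a ≡ true
conjugate-refl a = true-conjugate {a = a} {a} IsB-id (conj-unique IsB-id a a (λ p → trans (act-id _) (cong (act a) (sym (act-id p)))))

conj-inv : ∀ {g a b : W n} → IsB g → conj g a ≡ b → conj (inv g) b ≡ a
conj-inv {g = g} {a} B refl = conj-unique (IsB-inv B) _ a λ p → act-inj B
  (trans (act-inv B _) (sym (trans (conj-act B a _) (cong (act (conj g a)) (act-inv B p)))))

conj-conj : ∀ {g h a b c : W n} → IsB g → IsB h → conj g a ≡ b → conj h b ≡ c → conj (h · g) a ≡ c
conj-conj {g = g} {h} {a} Bg Bh refl refl = conj-unique (IsB-· Bh Bg) a _ λ p → trans (act-· h g _)
  (trans (cong (act h) (conj-act Bg a p)) (trans (conj-act Bh _ _) (cong (act (conj h (conj g a))) (sym (act-· h g p)))))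

-- t⁻¹g centralizes x exactly when t and g conjugate x to the same element. With the converse below,
-- a transversal of the centralizer lists the class of x without repetition.
sameCoset⇒conj : ∀ {x t g : W n} → IsB t → IsB g → sameCoset x t g ≡ true → conj t x ≡ conj g x
sameCoset⇒conj {x = x} {t} {g} Bt Bg h = sym (conj-unique Bg x _ λ p →
  trans (sym (act-inv Bt _)) (trans (cong (act t) (sym (act-· (inv t) g (act x p))))
    (trans (cong (act t) (sym (commutes (inZ-true {z = inv t · g} (trans (sym (sameCoset-def x t g)) h)) p))) (trans (conj-act Bt x _)
      (cong (act (conj t x)) (trans (cong (act t) (act-· (inv t) g p)) (act-inv Bt _)))))))

conj⇒sameCoset : ∀ {x t g : W n} → IsB t → IsB g → conj t x ≡ conj g x → sameCoset x t g ≡ true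
conj⇒sameCoset {x = x} {t} {g} Bt Bg e = trans (sameCoset-def x t g) (true-inZ {z = inv t · g} (mkC λ p → act-inj Bt
  (trans (conj-act Bt x _) (trans (cong (act (conj t x)) (trans (cong (act t) (act-· (inv t) g p)) (act-inv Bt _)))
    (trans (cong (λ w → act w (act g p)) e) (trans (sym (conj-act Bg x p)) (sym (trans (cong (act t) (act-· (inv t) g (act x p))) (act-inv Bt _)))))))))

act-twist : ∀ {t : W n} → IsB t → ∀ y p → act t (act (inv t · y · t) p) ≡ act y (act t p)
act-twist {t = t} Bt y p = trans (cong (act t) (trans (act-· (inv t · y) t p) (act-· (inv t) y (act t p)))) (act-inv Bt _)

inZ-conj : ∀ {t : W n} → IsB t → ∀ x y → inZ x (inv t · y · t) ≡ inZ (conj t x) y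
inZ-conj {t = t} Bt x y = ⇔⇒≡ᵇ
  (λ h → true-inZ {z = _} (mkC λ p → trans (cong (λ q → act (conj t x) (act y q)) (sym (act-inv Bt p)))
    (trans (cong (act (conj t x)) (sym (act-twist Bt y _))) (trans (sym (conj-act Bt x _)) (trans (cong (act t) (commutes (inZ-true h) _))
      (trans (act-twist Bt y _) (cong (act y) (trans (conj-act Bt x _) (cong (act (conj t x)) (act-inv Bt p))))))))))
  (λ h → true-inZ {z = _} (mkC λ p → act-inj Bt (trans (conj-act Bt x _)
    (trans (cong (act (conj t x)) (act-twist Bt y p)) (trans (commutes (inZ-true h) _)
      (trans (cong (act y) (sym (conj-act Bt x p))) (sym (act-twist Bt y _))))))))

record PowMinus (K : ℕ) (x : W n) : Set where
  constructor mkM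
  field minus : ∀ p → iter′ x K p ≡ negSP p
open PowMinus

-- w₀ is central, so its K-th roots form a union of conjugacy classes.
conj-PowMinus : ∀ {K} {t x : W n} → IsB t → PowMinus K x → PowMinus K (conj t x)
conj-PowMinus {K = K} {t} {x} B m = mkM λ p → trans (cong (iter′ (conj t x) K) (sym (act-inv B p)))
  (trans (sym (go K (act (inv t) p))) (trans (cong (act t) (minus m _)) (trans (act-neg t _) (cong negSP (act-inv B p)))))
  where
  go : ∀ r p → act t (iter′ x r p) ≡ iter′ (conj t x) r (act t p)
  go zero p = refl
  go (suc r) p = trans (conj-act B x _) (cong (act (conj t x)) (go r p))

module Characters {c ℓ : Level} (R : CommutativeRing c ℓ) (n : ℕ) (ζ : CommutativeRing.Carrier R)
  (ζᴺ : IsRoot R n ζ)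
  (k : ℤ) (K : ℕ) (powK : ∀ (x : W n) → IsB x → ∀ p → act (powℤ x k) p ≡ iter′ x K p) where

  open CommutativeRing R renaming (_+_ to _⊕_; _*_ to _⊛_; refl to ≈-refl; sym to ≈-sym; trans to ≈-trans)
  open RingSums R
  open Angles R n ζ ζᴺ

  rootOfMinus : W n → Bool
  rootOfMinus x = eqW (powℤ x k) w0

  rootOfMinus-true : ∀ {x} → IsB x → rootOfMinus x ≡ true → PowMinus K x
  rootOfMinus-true {x} B h = mkM λ p → trans (sym (powK x B p)) (trans (cong (λ w → act w p) (eqW-true {v = powℤ x k} {w0} h)) (act-w0 p))

  true-rootOfMinus : ∀ {x} → IsB x → PowMinus K x → rootOfMinus x ≡ true
  true-rootOfMinus {x} B m = true-eqW (W-ext λ p → trans (powK x B p) (trans (minus m p) (sym (act-w0 p))))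

  reps : List (W n)
  reps = filterᵇ (classPowIsW0 k) (ConjReps n)

  ∈-transversal : ∀ {x t} → t ∈ transversal x → IsB t
  ∈-transversal {x} m = ∈-Bn⁻ (greedy-⊆ (sameCoset x) [] (Bn n) (subst (_ ∈_) (transGo≡greedy x [] (Bn n)) m))

  ∈-reps : ∀ {x} → x ∈ reps → IsB x × PowMinus K x × x ∈ greedy conjugate [] (Bn n)
  ∈-reps {x} m with ∈-filterᵇ⁻ (classPowIsW0 k) (ConjReps n) m
  ... | m′ , h = Bx , minus-x , m″
    where
    m″ = subst (x ∈_) (repsGo≡greedy [] (Bn n)) m′
    Bx = ∈-Bn⁻ (greedy-⊆ conjugate [] (Bn n) m″)
    minus-x : PowMinus K x
    minus-x = rootOfMinus-true Bx (subst (λ z → rootOfMinus z ≡ true) (trans (conj-def idW x) (conj-unique IsB-id x x (λ p → trans (act-id _) (cong (act x) (sym (act-id p))))))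
      (all-true (λ g → eqW (powℤ (g · x · inv g) k) w0) (Bn n) h (∈-Bn IsB-id)))

  conjugates : W n → List (W n)
  conjugates x = map (λ t → conj t x) (transversal x)

  conjugates-unique : ∀ x → Unique (conjugates x)
  conjugates-unique x rewrite transGo≡greedy x [] (Bn n) =
    map-unique (λ t → conj t x) (greedy-unique (sameCoset x) [] (Bn-unique n)) λ {t} {t′} m m′ e →
      greedy-independent (sameCoset x) [] (Bn n) m m′ (conj⇒sameCoset (B m) (B m′) e) (conj⇒sameCoset (B m′) (B m) (sym e))
    where
    B : ∀ {t} → t ∈ greedy (sameCoset x) [] (Bn n) → IsB t
    B m = ∈-Bn⁻ (greedy-⊆ (sameCoset x) [] (Bn n) m)

  -- The representatives are pairwise non-conjugate, so their classes are disjoint. Conversely a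
  -- root of w₀ is conjugate to some representative, which is then a root as well, together with its
  -- whole class.
  allConjugates↭ : concatMap conjugates reps ↭ filterᵇ rootOfMinus (Bn n)
  allConjugates↭ = sameSet⇒↭ (concatMap-unique conjugates
      (filterᵇ-unique (classPowIsW0 k) (subst Unique (sym (repsGo≡greedy [] (Bn n))) (greedy-unique conjugate [] (Bn-unique n))))
      (λ {x} _ → conjugates-unique x) disjoint)
    (filterᵇ-unique rootOfMinus (Bn-unique n)) to from
    where
    disjoint : ∀ {x y z} → x ∈ reps → y ∈ reps → z ∈ conjugates x → z ∈ conjugates y → x ≡ y
    disjoint {x} {y} x∈ y∈ p q with Memₚ.∈-map⁻ _ p | Memₚ.∈-map⁻ _ q
    ... | t , t∈ , refl | u , u∈ , e = greedy-independent conjugate [] (Bn n) (proj₂ (proj₂ (∈-reps x∈))) (proj₂ (proj₂ (∈-reps y∈)))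
        (true-conjugate {a = x} {y} (IsB-· (IsB-inv Bu) Bt) (conj-conj Bt (IsB-inv Bu) refl (conj-inv Bu (sym e))))
        (true-conjugate {a = y} {x} (IsB-· (IsB-inv Bt) Bu) (conj-conj Bu (IsB-inv Bt) refl (conj-inv Bt e)))
      where
      Bt = ∈-transversal t∈
      Bu = ∈-transversal u∈
    to : ∀ {z} → z ∈ concatMap conjugates reps → z ∈ filterᵇ rootOfMinus (Bn n)
    to m with ∈-concatMap⁻ conjugates reps m
    ... | x , x∈ , z∈ with Memₚ.∈-map⁻ _ z∈
    ... | t , t∈ , refl = ∈-filterᵇ⁺ rootOfMinus (Bn n) (∈-Bn B) (true-rootOfMinus B (conj-PowMinus (∈-transversal t∈) (proj₁ (proj₂ (∈-reps x∈)))))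
      where B = IsB-conj (∈-transversal t∈) (proj₁ (∈-reps x∈))
    from : ∀ {z} → z ∈ filterᵇ rootOfMinus (Bn n) → z ∈ concatMap conjugates reps
    from {z} m with ∈-filterᵇ⁻ rootOfMinus (Bn n) m
    ... | z∈ , h with greedy-cover[] conjugate (Bn n) (conjugate-refl z) z∈
    ... | x , x∈ , xz with conjugate-true {a = x} {z} xz
    ... | g , Bg , refl with greedy-cover[] (sameCoset x) (Bn n) (conj⇒sameCoset Bg Bg refl) (∈-Bn Bg)
    ... | t , t∈ , tg = ∈-concatMap conjugates reps (∈-filterᵇ⁺ (classPowIsW0 k) (ConjReps n) (subst (x ∈_) (sym (repsGo≡greedy [] (Bn n))) x∈)
        (true-all _ (Bn n) (λ {h} h∈ → subst (λ z → rootOfMinus z ≡ true) (sym (conj-def h x)) (true-rootOfMinus (IsB-conj (∈-Bn⁻ h∈) Bx) (conj-PowMinus (∈-Bn⁻ h∈) minus-x)))))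
        (subst (_∈ conjugates x) (sameCoset⇒conj (∈-Bn⁻ (greedy-⊆ (sameCoset x) [] (Bn n) t∈)) Bg tg)
          (Memₚ.∈-map⁺ (λ t → conj t x) (subst (t ∈_) (sym (transGo≡greedy x [] (Bn n))) t∈)))
      where
      Bx = ∈-Bn⁻ (greedy-⊆ conjugate [] (Bn n) x∈)
      minus-x : PowMinus K x
      minus-x = subst (PowMinus K) (conj-inv {a = x} Bg refl) (conj-PowMinus (IsB-inv Bg) (rootOfMinus-true (∈-Bn⁻ z∈) h))

  module _ {y : W n} (By : IsB y) where

    term : W n → Carrier
    term x = if inZ x y then Ω x y else 0#

    -- The summand of the induced character at t is the character of Z(x) at t⁻¹yt, which is the
    -- character of Z(txt⁻¹) at y. The sum over the transversal thereby becomes a sum over the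
    -- class.
    ψ-term : ∀ {x t} → x ∈ reps → t ∈ transversal x →
      (if inZ x (inv t · y · t) then pow ζ (ωexp x (inv t · y · t)) else 0#) ≈ term (conj t x)
    ψ-term {x} {t} x∈ t∈ rewrite inZ-conj {t = t} (∈-transversal t∈) x y with inZ (conj t x) y in eq
    ... | false = ≈-refl
    ... | true = ≈-trans (ωexp-Ω Bx Bz (inZ-true (trans (inZ-conj Bt x y) eq)) K (minus mx))
          (Ω-conj Bx (IsB-conj Bt Bx) By Bt K (minus (conj-PowMinus Bt mx)) (conj-act Bt x) (act-twist Bt y) (inZ-true eq))
      where
      Bx = proj₁ (∈-reps x∈)
      mx = proj₁ (proj₂ (∈-reps x∈))
      Bt = ∈-transversal t∈
      Bz = IsB-· (IsB-· (IsB-inv Bt) By) Bt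

    sumψ-Ω : sumψ R ζ k n y ≈ ∑ (filterᵇ rootOfMinus (Bn n)) term
    sumψ-Ω = ≈-trans (reflexive (sumR-map _ reps)) (≈-trans (Sum.bigop-cong reps λ {x} x∈ →
        ≈-trans (reflexive (sumR-map _ (transversal x))) (≈-trans (Sum.bigop-cong (transversal x) (λ {t} t∈ → ψ-term x∈ t∈))
          (reflexive (sym (Sum.bigop-map (λ t → conj t x) (transversal x) term)))))
      (≈-trans (≈-sym (Sum.bigop-concatMap conjugates reps term)) (Sum.bigop-↭ term allConjugates↭)))

-- Congruences and exponential sums

-- Congruence modulo D without subtraction: both sides may be raised by multiples of D.
record Cong (D a b : ℕ) : Set where
  constructor mkCong
  field
    u v : ℕ
    eq : a + u * D ≡ b + v * D

module _ {D : ℕ} where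

  cong-refl : ∀ {a b} → a ≡ b → Cong D a b
  cong-refl refl = mkCong 0 0 refl

  cong-sym : ∀ {a b} → Cong D a b → Cong D b a
  cong-sym (mkCong u v e) = mkCong v u (sym e)

  cong-trans : ∀ {a b c} → Cong D a b → Cong D b c → Cong D a c
  cong-trans {a} {b} {c} (mkCong u v e) (mkCong u′ v′ e′) = mkCong (u + u′) (v + v′)
    (trans (l₁ a u u′ D) (trans (cong (_+ u′ * D) e) (trans (l₂ b v u′ D) (trans (cong (_+ v * D) e′) (l₃ c v v′ D)))))
    where
    l₁ : ∀ a u u′ D → a + (u + u′) * D ≡ a + u * D + u′ * D
    l₁ = solve-∀
    l₂ : ∀ b v u′ D → b + v * D + u′ * D ≡ b + u′ * D + v * D
    l₂ = solve-∀
    l₃ : ∀ c v v′ D → c + v′ * D + v * D ≡ c + (v + v′) * D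
    l₃ = solve-∀

  cong-+ : ∀ {a b c d} → Cong D a b → Cong D c d → Cong D (a + c) (b + d)
  cong-+ {a} {b} {c} {d} (mkCong u v e) (mkCong u′ v′ e′) = mkCong (u + u′) (v + v′)
    (trans (l a c u u′ D) (trans (cong₂ _+_ e e′) (sym (l b d v v′ D))))
    where
    l : ∀ a c u u′ D → a + c + (u + u′) * D ≡ (a + u * D) + (c + u′ * D)
    l = solve-∀

  cong-* : ∀ {a b c d} → Cong D a b → Cong D c d → Cong D (a * c) (b * d)
  cong-* {a} {b} {c} {d} (mkCong u v e) (mkCong u′ v′ e′) = mkCong (a * u′ + u * c + u * u′ * D) (b * v′ + v * d + v * v′ * D)
    (trans (l a c u u′ D) (trans (cong₂ _*_ e e′) (sym (l b d v v′ D))))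
    where
    l : ∀ a c u u′ D → a * c + (a * u′ + u * c + u * u′ * D) * D ≡ (a + u * D) * (c + u′ * D)
    l = solve-∀

  cong-0⇒∣ : ∀ {a} → Cong D a 0 → D ∣ a
  cong-0⇒∣ {a} (mkCong u v e) = Div.∣m+n∣m⇒∣n (subst (D ∣_) (trans (sym e) (ℕₚ.+-comm a (u * D))) (Div.n∣m*n v)) (Div.n∣m*n u)

  ∣⇒cong-0 : ∀ {a} → D ∣ a → Cong D a 0
  ∣⇒cong-0 (divides q refl) = mkCong 0 q (ℕₚ.+-identityʳ (q * D))

  cong-cancel-+ : ∀ {a b} c → Cong D (a + c) (b + c) → Cong D a b
  cong-cancel-+ {a} {b} c (mkCong u v e) = mkCong u v (ℕₚ.+-cancelʳ-≡ c _ _ (trans (l a u c D) (trans e (sym (l b v c D)))))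
    where
    l : ∀ a u c D → a + u * D + c ≡ a + c + u * D
    l = solve-∀

  cong-∣-resp : ∀ {e a b} → e ∣ D → Cong D a b → e ∣ b → e ∣ a
  cong-∣-resp {e} {a} {b} e∣D (mkCong u v eq) e∣b = Div.∣m+n∣m⇒∣n (subst (e ∣_) (trans (sym eq) (ℕₚ.+-comm a (u * D)))
    (Div.∣m∣n⇒∣m+n e∣b (Div.∣n⇒∣m*n v e∣D))) (Div.∣n⇒∣m*n u e∣D)

  cong-mod : .{{_ : NonZero D}} → ∀ a → Cong D a (a % D)
  cong-mod a = mkCong 0 (a / D) (trans (ℕₚ.+-identityʳ a) (DivMod.m≡m%n+[m/n]*n a D))

  cong-small : .{{_ : NonZero D}} → ∀ {a b} → a < D → b < D → Cong D a b → a ≡ b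
  cong-small {a} {b} a< b< (mkCong u v e) = trans (sym (mod a u a<)) (trans (cong (_% D) e) (mod b v b<))
    where
    mod : ∀ a u → a < D → (a + u * D) % D ≡ a
    mod a u a< = trans (DivMod.[m+kn]%n≡m%n a u D) (DivMod.m<n⇒m%n≡m a<)

cong-weaken : ∀ {d D a b} → d ∣ D → Cong D a b → Cong d a b
cong-weaken {d} {_} {a} {b} (divides q refl) (mkCong u v e) = mkCong (u * q) (v * q) (trans (cong (a +_) (ℕₚ.*-assoc u q d)) (trans e (cong (b +_) (sym (ℕₚ.*-assoc v q d)))))

cong-scale : ∀ {D a b} m → Cong D a b → Cong (m * D) (m * a) (m * b)
cong-scale {D} {a} {b} m (mkCong u v e) = mkCong u v (trans (l m a u D) (trans (cong (m *_) e) (sym (l m b v D))))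
  where
  l : ∀ m a u D → m * a + u * (m * D) ≡ m * (a + u * D)
  l = solve-∀

-- s = m a and s′ = m w generate the same subgroup of Z/D, and a w = 1/ρ modulo the index D/m.
record Dual (D ρ s s′ : ℕ) : Set where
  constructor mkDual
  field
    m b a w : ℕ
    D≡ : D ≡ m * b
    s≡ : s ≡ m * a
    s′≡ : s′ ≡ m * w
    a<b : a < b
    w<b : w < b
    inverse : Cong b (ρ * (a * w)) 1

dual-sym : ∀ {D ρ s s′} → Dual D ρ s s′ → Dual D ρ s′ s
dual-sym {ρ = ρ} (mkDual m b a w d e f g h i) = mkDual m b w a d f e h g (subst (λ c → Cong b (ρ * c) 1) (ℕₚ.*-comm a w) i)

-- Since ρ a w is 1 modulo b and D = m b, m is congruent to ρ w s modulo D. Thus every common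
-- divisor of s and D divides m, which makes m their gcd.
dual-m∣ : ∀ {D ρ s s′} m′ → (d : Dual D ρ s s′) → m′ ∣ s → m′ ∣ D → m′ ∣ Dual.m d
dual-m∣ {D} {ρ} {s} m′ (mkDual m b a w refl refl refl _ _ i) m∣s m∣D =
  cong-∣-resp m∣D (subst₂ (Cong (m * b)) (ℕₚ.*-identityʳ m) refl (cong-sym (cong-scale m i)))
    (subst (m′ ∣_) (l m a w ρ) (Div.∣m⇒∣m*n (ρ * w) m∣s))
  where
  l : ∀ m a w ρ → m * a * (ρ * w) ≡ m * (ρ * (a * w))
  l = solve-∀

inverse-cong : ∀ {b a w w′} ρ → Cong b (ρ * (a * w)) 1 → Cong b (ρ * (a * w′)) 1 → Cong b w w′
inverse-cong {b} {a} {w} {w′} ρ i j = cong-trans (cong-refl (sym (ℕₚ.*-identityˡ w))) (cong-trans (cong-* (cong-sym j) (cong-refl refl))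
  (cong-trans (cong-refl (l ρ a w w′)) (cong-trans (cong-* i (cong-refl refl)) (cong-refl (ℕₚ.*-identityˡ w′)))))
  where
  l : ∀ ρ a w w′ → ρ * (a * w′) * w ≡ ρ * (a * w) * w′
  l = solve-∀

-- The gcd property of m fixes m, hence a and b; then w is determined modulo b as an inverse of ρ a.
dual-unique : ∀ {D ρ s s₁ s₂} → 0 < D → Dual D ρ s s₁ → Dual D ρ s s₂ → s₁ ≡ s₂
dual-unique {D} {ρ} {s} 0<D d₁@(mkDual m b a w D≡ s≡ refl a<b w<b i) d₂@(mkDual m′ b′ a′ w′ D≡′ s≡′ refl a′<b′ w′<b′ i′)
  with Div.∣-antisym (dual-m∣ m d₂ (divides a (trans s≡ (ℕₚ.*-comm m a))) (divides b (trans D≡ (ℕₚ.*-comm m b))))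
                     (dual-m∣ m′ d₁ (divides a′ (trans s≡′ (ℕₚ.*-comm m′ a′))) (divides b′ (trans D≡′ (ℕₚ.*-comm m′ b′))))
dual-unique {D} {ρ} {s} 0<D d₁@(mkDual zero b a w D≡ s≡ refl a<b w<b i) d₂ | refl = ⊥-elim (ℕₚ.<⇒≢ 0<D (sym D≡))
dual-unique {D} {ρ} {s} 0<D d₁@(mkDual m@(suc _) b a w D≡ s≡ refl a<b w<b i) d₂@(mkDual m′ b′ a′ w′ D≡′ s≡′ refl a′<b′ w′<b′ i′) | refl
  with ℕₚ.*-cancelˡ-≡ b b′ m (trans (sym D≡) D≡′) | ℕₚ.*-cancelˡ-≡ a a′ m (trans (sym s≡) s≡′)
dual-unique {D} {ρ} {s} 0<D d₁@(mkDual m@(suc _) b@(suc _) a w D≡ s≡ refl a<b w<b i) d₂@(mkDual m′ b′ a′ w′ D≡′ s≡′ refl a′<b′ w′<b′ i′) | refl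
  | refl | refl = cong (m *_) (cong-small w<b w′<b′ (inverse-cong {a = a} ρ i i′))

-- b is the additive order of s in Z/D, the cofactor a being invertible modulo b.
dual-index∣ : ∀ {D ρ s s′} k → 0 < D → (d : Dual D ρ s s′) → D ∣ k * s → Dual.b d ∣ k
dual-index∣ k 0<D (mkDual zero b a w refl s≡ s′≡ _ _ i) D∣ = ⊥-elim (ℕₚ.<-irrefl refl 0<D)
dual-index∣ {ρ = ρ} k 0<D (mkDual m@(suc _) b a w refl refl s′≡ _ _ i) D∣ =
  cong-0⇒∣ (cong-trans (cong-refl (sym (ℕₚ.*-identityʳ k))) (cong-trans (cong-* (cong-refl {a = k} refl) (cong-sym i))
    (cong-trans (cong-refl (l k ρ a w)) (cong-* (∣⇒cong-0 (Div.*-cancelˡ-∣ m (subst (m * b ∣_) (l′ k m a) D∣))) (cong-refl {a = ρ * w} refl)))))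
  where
  l : ∀ k ρ a w → k * (ρ * (a * w)) ≡ k * a * (ρ * w)
  l = solve-∀
  l′ : ∀ k m a → k * (m * a) ≡ m * (k * a)
  l′ = solve-∀

dual-∣ : ∀ {D ρ s s′} k → 0 < D → Dual D ρ s s′ → D ∣ k * s → D ∣ k * s′
dual-∣ {s′ = s′} k 0<D d D∣ with dual-index∣ k 0<D d D∣
dual-∣ k 0<D (mkDual m b a w refl refl refl _ _ i) D∣ | divides q refl = divides (q * w) (l q b m w)
  where
  l : ∀ q b m w → q * b * (m * w) ≡ q * w * (m * b)
  l = solve-∀

bezout-inverse : ∀ {m a b} → 0 < m → 0 < b → Bézout.Identity m (m * a) (m * b) → ∃ λ w → Cong b (a * w) 1
bezout-inverse {m@(suc _)} {a} {b} _ _ (Bézout.+- x y e) = x , mkCong 0 y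
  (ℕₚ.*-cancelˡ-≡ _ _ m (trans (l₁ m a x b) (trans (sym e) (l₂ m y b))))
  where
  l₁ : ∀ m a x b → m * (a * x + 0 * b) ≡ x * (m * a)
  l₁ = solve-∀
  l₂ : ∀ m y b → m + y * (m * b) ≡ m * (1 + y * b)
  l₂ = solve-∀
-- This form of the identity gives a x = -1 modulo b; the inverse -x is represented by x (b - 1).
bezout-inverse {m@(suc _)} {a} {b@(suc b′)} _ _ (Bézout.-+ x y e) = x * b′ , mkCong y (a * x) (trans (cong (a * (x * b′) +_) (sym yb)) (l₃ a x b′))
  where
  l₁ : ∀ m a x → m + x * (m * a) ≡ m * (1 + x * a)
  l₁ = solve-∀
  l₂ : ∀ m y b → y * (m * b) ≡ m * (y * b)
  l₂ = solve-∀
  yb : 1 + x * a ≡ y * b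
  yb = ℕₚ.*-cancelˡ-≡ _ _ m (trans (sym (l₁ m a x)) (trans e (l₂ m y b)))
  l₃ : ∀ a x b′ → a * (x * b′) + (1 + x * a) ≡ 1 + a * x * (1 + b′)
  l₃ = solve-∀

-- The index b = D/m divides k, so ρ is invertible modulo b.
dual-exists : ∀ {D ρ s} k ρ⁻ → 0 < D → Cong k (ρ * ρ⁻) 1 → s < D → D ∣ k * s → ∃ λ s′ → Dual D ρ s s′
dual-exists {D} {ρ} {s} k ρ⁻ 0<D iρ s<D D∣
  with gcd s D | gcd-GCD s D
... | m | g with GCD.gcd∣m g | GCD.gcd∣n g | Bézout.identity g
dual-exists {D} {ρ} {s} k ρ⁻ 0<D iρ s<D D∣ | zero | g | _ | divides b refl | _ = ⊥-elim (ℕₚ.<-irrefl (sym (ℕₚ.*-zeroʳ b)) 0<D)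
dual-exists {D} {ρ} {s} k ρ⁻ 0<D iρ s<D D∣ | m@(suc _) | g | divides a refl | divides zero refl | bz = ⊥-elim (ℕₚ.<-irrefl refl 0<D)
dual-exists {D} {ρ} {s} k ρ⁻ 0<D iρ s<D D∣ | m@(suc _) | g | divides a refl | divides b@(suc _) refl | bz
  with bezout-inverse {m} {a} {b} (s≤s z≤n) (s≤s z≤n) (subst₂ (Bézout.Identity m) (ℕₚ.*-comm a m) (ℕₚ.*-comm b m) bz)
... | w , iw = m * (ρ⁻ * w % b) , mkDual m b a (ρ⁻ * w % b) (ℕₚ.*-comm b m) (ℕₚ.*-comm a m) refl
      (ℕₚ.*-cancelʳ-< m a b s<D) (DivMod.m%n<n (ρ⁻ * w) b)
      (cong-trans (cong-* (cong-refl {a = ρ} refl) (cong-* (cong-refl {a = a} refl) (cong-sym (cong-mod (ρ⁻ * w)))))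
        (cong-trans (cong-refl (l₁ ρ a ρ⁻ w)) (cong-* (cong-weaken b∣k iρ) iw)))
  where
  l₁ : ∀ ρ a ρ⁻ w → ρ * (a * (ρ⁻ * w)) ≡ ρ * ρ⁻ * (a * w)
  l₁ = solve-∀
  l₂ : ∀ k a w → k * (a * w) ≡ k * a * w
  l₂ = solve-∀
  b∣k : b ∣ k
  b∣k = cong-0⇒∣ (cong-trans (cong-refl (sym (ℕₚ.*-identityʳ k))) (cong-trans (cong-* (cong-refl {a = k} refl) (cong-sym iw))
    (cong-trans (cong-refl (l₂ k a w)) (cong-* {a = k * a} (∣⇒cong-0 (Div.*-cancelʳ-∣ m (subst (b * m ∣_) (sym (ℕₚ.*-assoc k a m)) D∣))) (cong-refl {a = w} refl)))))

module Dualisation {D k ρ ρ⁻ : ℕ} (0<D : 0 < D) (iρ : Cong k (ρ * ρ⁻) 1) where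

  dualOf : ∀ s → Dec (D ∣ k * s) → Dec (s < D) → ℕ
  dualOf s (yes D∣) (yes s<D) = proj₁ (dual-exists {ρ = ρ} k ρ⁻ 0<D iρ s<D D∣)
  dualOf s _ _ = 0

  dual : ℕ → ℕ
  dual s = dualOf s (D ∣? (k * s)) (s ℕₚ.<? D)

  dual-spec : ∀ s → s < D → D ∣ k * s → Dual D ρ s (dual s)
  dual-spec s s<D D∣ with D ∣? (k * s) | s ℕₚ.<? D
  ... | yes D∣′ | yes s<D′ = proj₂ (dual-exists {ρ = ρ} k ρ⁻ 0<D iρ s<D′ D∣′)
  ... | no h | _ = ⊥-elim (h D∣)
  ... | yes _ | no h = ⊥-elim (h s<D)

  dual<D : ∀ s → s < D → D ∣ k * s → dual s < D
  dual<D s s<D D∣ with dual-spec s s<D D∣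
  ... | mkDual zero b a w d e f _ w<b _ = ⊥-elim (ℕₚ.<-irrefl (sym d) 0<D)
  ... | mkDual m@(suc _) b a w d e f _ w<b _ = subst₂ _<_ (sym f) (sym d) (ℕₚ.*-monoʳ-< m w<b)
  
  -- The relation `Dual` is symmetric and functional.
  dual-dual : ∀ s → s < D → D ∣ k * s → dual (dual s) ≡ s
  dual-dual s s<D D∣ = dual-unique 0<D (dual-spec (dual s) (dual<D s s<D D∣) (dual-∣ k 0<D d D∣)) (dual-sym d)
    where d = dual-spec s s<D D∣

-- Exponential sums over Z/D

module ExponentSums {c ℓ : Level} (R : CommutativeRing c ℓ)
  (domain : IsDomain R) (char0 : CharZero R) where

  open CommutativeRing R renaming (_+_ to _⊕_; _*_ to _⊛_; refl to ≈-refl; sym to ≈-sym; trans to ≈-trans)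
  open RingSums R
  open Domain domain char0

  ind : Bool → Carrier
  ind b = if b then 1# else 0#

  module _ {D : ℕ} (0<D : 0 < D) (Z : Carrier) (Zᴰ : pow Z D ≈ 1#) (prim : ∀ e → pow Z e ≈ 1# → D ∣ e) where

    orthogonality : ∀ e (b : Bool) → (b ≡ true → D ∣ e) → (D ∣ e → b ≡ true) →
      ∑ (upTo D) (λ r → pow Z (r * e)) ≈ natR R D ⊛ ind b
    orthogonality e true f g with f refl
    ... | divides q refl = ≈-trans (Sum.bigop-cong (upTo D) (λ {r} _ → ≈-trans (pow-* Z r (q * D)) (pow-one r (≈-trans (pow-* Z q D) (pow-one q Zᴰ)))))
          (∑-const D 1#)
    orthogonality e false f g = ≈-trans (Sum.bigop-cong (upTo D) (λ {r} _ → pow-* Z r e))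
      (≈-trans (geometric D (pow Z e) eᴰ (λ h → true≢false (g (prim e h)) refl)) (≈-sym (zeroʳ _)))
      where
      eᴰ : pow (pow Z e) D ≈ 1#
      eᴰ = ≈-trans (≈-sym (pow-* Z D e)) (≈-trans (reflexive (cong (pow Z) (ℕₚ.*-comm D e))) (≈-trans (pow-* Z e D) (pow-one e Zᴰ)))

    -- Finite Fourier inversion on Z/D.
    count-inverse : ∀ k (c₀ c₁ : ℕ → Bool) → (∀ s → c₀ s ≡ true → D ∣ k * s) → (∀ s → D ∣ k * s → c₀ s ≡ true) →
      (∀ s → c₁ s ≡ true → Cong D (k * s) 1) → (∀ s → Cong D (k * s) 1 → c₁ s ≡ true) →
      ∑ (upTo D) (λ s → ind (c₁ s)) ≈ ∑ (upTo D) (λ s → if c₀ s then pow Z s else 0#)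
    count-inverse k c₀ c₁ f₀ g₀ f₁ g₁ = natR-cancel D 0<D (≈-trans (∑-*ˡ (upTo D) _ _)
      (≈-trans (Sum.bigop-cong (upTo D) (λ {s} _ → ≈-sym (orthogonality (k * s * D′ + 1) (c₁ s) (λ h → to s (f₁ s h)) (λ h → g₁ s (from s h)))))
      (≈-trans (Sum.bigop-swap (upTo D) (upTo D) _)
      (≈-trans (Sum.bigop-cong (upTo D) (λ {r} _ → inner r)) (≈-sym (∑-*ˡ (upTo D) _ _))))))
      where
      -- D - 1 stands for -1, so `k * s * D′ + 1` is 1 - k s modulo D, and the sum over r of the
      -- powers with exponent r (1 - k s) detects k s = 1.
      D′ = D ∸ 1
      D≡ : D ≡ suc D′
      D≡ = sym (ℕₚ.m+[n∸m]≡n 0<D)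
      l₁ : ∀ t D′ → t * D′ + 1 + t ≡ t * suc D′ + 1
      l₁ = solve-∀
      tD : ∀ t → t * D ≡ t * D′ + t
      tD t = trans (cong (t *_) D≡) (trans (ℕₚ.*-suc t D′) (ℕₚ.+-comm t _))
      to : ∀ s → Cong D (k * s) 1 → D ∣ k * s * D′ + 1
      to s h = cong-0⇒∣ (cong-cancel-+ (k * s) (cong-trans (cong-refl (trans (l₁ (k * s) D′) (cong (λ d → k * s * d + 1) (sym D≡))))
        (cong-+ (∣⇒cong-0 (Div.n∣m*n (k * s))) (cong-sym h))))
      from : ∀ s → D ∣ k * s * D′ + 1 → Cong D (k * s) 1
      from s h = cong-trans (cong-+ {a = 0} (cong-sym (∣⇒cong-0 h)) (cong-refl {a = k * s} refl))
        (cong-trans (cong-refl (trans (l₁ (k * s) D′) (cong (λ d → k * s * d + 1) (sym D≡)))) (cong-+ (∣⇒cong-0 (Div.n∣m*n (k * s))) (cong-refl {a = 1} refl)))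
      -- After the exchange of the sums the exponent is read as s (-k r) + r: the sum over s forces
      -- k r = 0 and leaves Z^r.
      l₂ : ∀ r k s D′ → r * (k * s * D′ + 1) ≡ s * (k * r * D′) + r
      l₂ = solve-∀
      inner : ∀ r → ∑ (upTo D) (λ s → pow Z (r * (k * s * D′ + 1))) ≈ natR R D ⊛ (if c₀ r then pow Z r else 0#)
      inner r = ≈-trans (Sum.bigop-cong (upTo D) (λ {s} _ → ≈-trans (reflexive (cong (pow Z) (l₂ r k s D′))) (≈-trans (pow-+ Z (s * (k * r * D′)) r) (*-comm _ _))))
        (≈-trans (≈-sym (∑-*ˡ (upTo D) _ _)) (≈-trans (*-congˡ (orthogonality (k * r * D′) (c₀ r) (λ h → Div.∣m⇒∣m*n D′ (f₀ r h)) (λ h → g₀ r (unD′ h))))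
        (last (c₀ r))))
        where
        unD′ : D ∣ k * r * D′ → D ∣ k * r
        unD′ h = Div.∣m+n∣m⇒∣n (subst (D ∣_) (tD (k * r)) (Div.n∣m*n (k * r))) h
        last : ∀ b → pow Z r ⊛ (natR R D ⊛ ind b) ≈ natR R D ⊛ (if b then pow Z r else 0#)
        last true = ≈-trans (*-congˡ (*-identityʳ _)) (*-comm _ _)
        last false = ≈-trans (*-congˡ (zeroʳ _)) (≈-trans (zeroʳ _) (≈-sym (zeroʳ _)))

    module _ (k ρ ρ⁻ : ℕ) (iρ : Cong k (ρ * ρ⁻) 1) where
      open Dualisation {D} {k} {ρ} {ρ⁻} 0<D iρ

      -- `dual` is an involution of the summation range, so the sum is merely reindexed.
      dual-sum : ∀ (c₀ : ℕ → Bool) → (∀ s → c₀ s ≡ true → D ∣ k * s) → (∀ s → D ∣ k * s → c₀ s ≡ true) →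
        ∑ (upTo D) (λ s → if c₀ s then pow Z (dual s) else 0#) ≈ ∑ (upTo D) (λ s → if c₀ s then pow Z s else 0#)
      dual-sum c₀ f₀ g₀ = ≈-trans (≈-sym (Sum.bigop-filterᵇ c₀ (upTo D) _)) (≈-trans
        (Sum.bigop-reindex dual (pow Z) u u into inj onto) (Sum.bigop-filterᵇ c₀ (upTo D) _))
        where
        u = filterᵇ-unique c₀ (Uniqueₚ.upTo⁺ D)
        mem : ∀ {s} → s ∈ filterᵇ c₀ (upTo D) → s < D × D ∣ k * s
        mem m with ∈-filterᵇ⁻ c₀ (upTo D) m
        ... | m′ , h = ∈-upTo⁻ m′ , f₀ _ h
        into : ∀ {s} → s ∈ filterᵇ c₀ (upTo D) → dual s ∈ filterᵇ c₀ (upTo D)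
        into {s} m with mem m
        ... | s<D , D∣ = ∈-filterᵇ⁺ c₀ (upTo D) (∈-upTo (dual<D s s<D D∣)) (g₀ _ (dual-∣ k 0<D (dual-spec s s<D D∣) D∣))
        invol : ∀ {s} → s ∈ filterᵇ c₀ (upTo D) → dual (dual s) ≡ s
        invol {s} m with mem m
        ... | s<D , D∣ = dual-dual s s<D D∣
        inj : ∀ {s t} → s ∈ filterᵇ c₀ (upTo D) → t ∈ filterᵇ c₀ (upTo D) → dual s ≡ dual t → s ≡ t
        inj m m′ e = trans (sym (invol m)) (trans (cong dual e) (invol m′))
        onto : ∀ {t} → t ∈ filterᵇ c₀ (upTo D) → ∃ λ s → s ∈ filterᵇ c₀ (upTo D) × dual s ≡ t
        onto {t} m = dual t , into m , invol m

-- Orbits of two commuting elements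

negᵇ-false : ∀ (p : SP n) → negᵇ false p ≡ p
negᵇ-false (i , s) = cong (i ,_) (Boolₚ.xor-identityʳ s)

negᵇ-true : ∀ (p : SP n) → negᵇ true p ≡ negSP p
negᵇ-true (i , true) = refl
negᵇ-true (i , false) = refl

negᵇ-negᵇ : ∀ a b (p : SP n) → negᵇ b (negᵇ a p) ≡ negᵇ (a xor b) p
negᵇ-negᵇ a b (i , s) = cong (i ,_) (Boolₚ.xor-assoc s a b)

iter-negᵇ : ∀ (w : W n) m b p → iter′ w m (negᵇ b p) ≡ negᵇ b (iter′ w m p)
iter-negᵇ w m true p = trans (cong (iter′ w m) (negᵇ-true p)) (trans (iter-neg w m p) (sym (negᵇ-true _)))
iter-negᵇ w m false p = trans (cong (iter′ w m) (negᵇ-false p)) (sym (negᵇ-false _))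

act-negᵇ : ∀ (w : W n) b p → act w (negᵇ b p) ≡ negᵇ b (act w p)
act-negᵇ w b p = iter-negᵇ w 1 b p

mulᵇ : ℕ → Bool → Bool
mulᵇ zero b = false
mulᵇ (suc m) b = mulᵇ m b xor b

abs⇒negᵇ : ∀ {p q : SP n} → ∣ p ∣ₚ ≡ ∣ q ∣ₚ → ∃ λ b → p ≡ negᵇ b q
abs⇒negᵇ {p = p} {q} e with abs-eq {p = p} {q} e
... | inj₁ f = false , trans f (sym (negᵇ-false q))
... | inj₂ f = true , trans f (sym (negᵇ-true q))

commute-· : ∀ {x z y : W n} → Commute x y → Commute z y → Commute (x · z) y
commute-· {x = x} {z} {y} c d = mkC λ p → trans (act-· x z _) (trans (cong (act x) (commutes d p)) (trans (commutes c _) (cong (act y) (sym (act-· x z p)))))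

iter-return-abs : ∀ {x : W n} → IsB x → ∀ a p q → ∣ iter′ x a p ∣ₚ ≡ ∣ q ∣ₚ → ∃ λ b → ∣ p ∣ₚ ≡ ∣ iter′ x b q ∣ₚ
iter-return-abs {x = x} B a p q e with iter-return B a p
... | b , r = b , trans (sym (cong ∣_∣ₚ r)) (iter-abs-cong x b e)

Orb : W n → W n → Fin n → Fin n → Set
Orb x y j i = ∃ λ a → ∃ λ b → ∣ iter′ x a (iter′ y b (pt j)) ∣ₚ ≡ i

opaque
  orb : W n → W n → Fin n → Fin n → Bool
  orb {n} x y j i = any (λ a → any (λ b → eqFin ∣ iter′ x a (iter′ y b (pt j)) ∣ₚ i) (upTo (2 * n))) (upTo (2 * n))

  orb-true : ∀ {x y : W n} {j i} → orb x y j i ≡ true → Orb x y j i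
  orb-true {n} h with any-true _ (upTo (2 * n)) h
  ... | a , _ , h′ with any-true _ (upTo (2 * n)) h′
  ... | b , _ , e = a , b , eqFin-true e

  true-orb : ∀ {x y : W n} {j i} → IsB x → IsB y → Orb x y j i → orb x y j i ≡ true
  true-orb {n} {x} {y} {j} {i} Bx By (a , b , e) = true-any _ (upTo (2 * n)) (∈-upTo (%-bound Bx (iter′ y b (pt j)) a))
    (true-any (λ u → eqFin ∣ iter′ x (a % cycLen x (iter′ y b (pt j))) (iter′ y u (pt j)) ∣ₚ i) (upTo (2 * n)) (∈-upTo (%-bound By (pt j) b)) (true-eqFin
      (trans (cong (λ p → ∣ iter′ x (a % cycLen x (iter′ y b (pt j))) p ∣ₚ) (sym (iter-% By (pt j) b))) (trans (cong ∣_∣ₚ (sym (iter-% Bx (iter′ y b (pt j)) a))) e))))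

orb-refl : ∀ {x y : W n} j → Orb x y j j
orb-refl j = 0 , 0 , refl

orb-sym : ∀ {x y : W n} {i j} → IsB x → IsB y → Commute x y → Orb x y i j → Orb x y j i
orb-sym {x = x} {y} {i} Bx By c (a , b , refl) with iter-return-abs Bx a (iter′ y b (pt i)) (pt ∣ iter′ x a (iter′ y b (pt i)) ∣ₚ) refl
... | a′ , e with iter-return-abs By b (pt i) (iter′ x a′ (pt ∣ iter′ x a (iter′ y b (pt i)) ∣ₚ)) e
... | b′ , f = a′ , b′ , trans (cong ∣_∣ₚ (iter-commute c a′ b′ _)) (sym f)

orb-trans : ∀ {x y : W n} {i j k} → Commute x y → Orb x y i j → Orb x y j k → Orb x y i k
orb-trans {x = x} {y} {i} {j} c (a , b , e) (a′ , b′ , f) = a′ + a , b′ + b ,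
  trans (cong ∣_∣ₚ (trans (iter-+ x a′ a _) (cong (iter′ x a′) (trans (cong (iter′ x a) (iter-+ y b′ b _)) (iter-commute c a b′ _)))))
    (trans (iter-abs-cong x a′ (iter-abs-cong y b′ e)) f)

Twist : W n → W n → W n → Set
Twist y x x′ = ∀ p → ∃ λ c → ∣ act x′ p ∣ₚ ≡ ∣ act x (iter′ y c p) ∣ₚ

-- Each step of the twisted element inserts a power of y. As y commutes with x, all insertions
-- collect into a single power of y.
twist-orb : ∀ {x x′ y : W n} {j i} → Commute x y → Twist y x x′ → Orb x′ y j i → Orb x y j i
twist-orb {x = x} {x′} {y} {j} c tw (a , b , e) with go a
  where
  go : ∀ a → ∃ λ b′ → ∣ iter′ x′ a (iter′ y b (pt j)) ∣ₚ ≡ ∣ iter′ x a (iter′ y b′ (pt j)) ∣ₚ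
  go zero = b , refl
  go (suc a) with go a | tw (iter′ x′ a (iter′ y b (pt j)))
  ... | b′ , f | c′ , g = c′ + b′ , trans g (trans (abs-cong x (trans (iter-abs-cong y c′ f)
        (cong ∣_∣ₚ (sym (iter-commute c a c′ _))))) (cong (λ q → ∣ act x (iter′ x a q) ∣ₚ) (sym (iter-+ y c′ b′ _))))
... | b′ , f = a , b′ , trans (sym f) e

module AtPoint {y : W n} (By : IsB y) (j : Fin n) where

  J : SP n
  J = pt j

  Y : ℕ → SP n
  Y c = iter′ y c J

  D : ℕ
  D = cycLen y J

  Y-D : Y D ≡ J
  Y-D = iter-cycLen By J

  Y-+ : ∀ a b → iter′ y a (Y b) ≡ Y (a + b)
  Y-+ a b = sym (iter-+ y a b J)

  Y-mult : ∀ u → Y (u * D) ≡ J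
  Y-mult u = iter-fix y D Y-D u

  Y-cong : ∀ {a b} → Cong D a b → Y a ≡ Y b
  Y-cong {a} {b} (mkCong u v e) = trans (sym (add a u)) (trans (cong Y e) (add b v))
    where
    add : ∀ a u → Y (a + u * D) ≡ Y a
    add a u = trans (sym (Y-+ a (u * D))) (cong (iter′ y a) (Y-mult u))

  Y-cong⁻ : ∀ {a b} → Y a ≡ Y b → Cong D a b
  Y-cong⁻ {a} {b} e = cong-cancel-+ w (cong-trans (∣⇒cong-0 (cycLen-divides By J (a + w) (trans (l a) (trans (cong (iter′ y w) e) (trans (sym (l b)) bw)))))
    (cong-sym (∣⇒cong-0 (cycLen-divides By J (b + w) bw))))
    where
    -- Adding `w` undoes b steps, b + w being a multiple of N; an equality of two points becomes a
    -- return to J.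
    w = b * (N-1 n)
    l : ∀ c → Y (c + w) ≡ iter′ y w (Y c)
    l c = trans (cong Y (ℕₚ.+-comm c w)) (sym (Y-+ w c))
    bw : Y (b + w) ≡ J
    bw = trans (cong Y (trans (cong (_+ w) (sym (ℕₚ.*-identityʳ b))) (trans (sym (ℕₚ.*-distribˡ-+ b 1 (N-1 n))) (cong (b *_) (suc-N-1 n))))) (iter-Nord* By b J)

  Returns : ℕ → Set
  Returns c = ∣ Y c ∣ₚ ≡ j

  returns-add : ∀ {a b} → Returns a → Returns b → Returns (a + b)
  returns-add {a} {b} h h′ = trans (cong ∣_∣ₚ (sym (Y-+ a b))) (trans (iter-abs-cong y a h′) h)

  returns-sub : ∀ {a b} → Returns a → Returns (a + b) → Returns b
  returns-sub {a} {b} h h′ = iter-abs-inj By a (trans (cong ∣_∣ₚ (Y-+ a b)) (trans h′ (sym h)))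

  absPeriod : ∃ λ m → 0 < m × Returns m × (∀ c → Returns c → m ∣ c)
  absPeriod = minimalPeriod (λ c → ∣ Y c ∣ₚ Finₚ.≟ j) D (s≤s z≤n) (cong ∣_∣ₚ Y-D)
    (λ {a} {b} → returns-add {a} {b}) (λ {a} {b} → returns-sub {a} {b})

  -- d is the length of the y-cycle of j and δ its class: y^d J = (−1)^δ J.
  d : ℕ
  d = proj₁ absPeriod

  0<d : 0 < d
  0<d = proj₁ (proj₂ absPeriod)

  returns-d : Returns d
  returns-d = proj₁ (proj₂ (proj₂ absPeriod))

  d∣returns : ∀ c → Returns c → d ∣ c
  d∣returns = proj₂ (proj₂ (proj₂ absPeriod))

  δ : Bool
  δ = proj₁ (abs⇒negᵇ {p = Y d} {J} returns-d)

  Y-d : Y d ≡ negᵇ δ J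
  Y-d = proj₂ (abs⇒negᵇ {p = Y d} {J} returns-d)

  onY : Fin n → Bool
  onY = inCycle y J

  onY-true : ∀ {i} → onY i ≡ true → ∃ λ m → ∣ Y m ∣ₚ ≡ i
  onY-true {i} = inCycle-true y J i

  true-onY : ∀ {i} m → ∣ Y m ∣ₚ ≡ i → onY i ≡ true
  true-onY {i} m = true-inCycle By J i m

  opaque
    eᵇ : ℕ → Bool → Fin n → Bool → SP n
    eᵇ a b i true = negᵇ b (iter′ y a (pt i))
    eᵇ a b i false = pt i

    -- (−1)ᵇ yᵃ on the y-cycle of j, the identity elsewhere.
    e : ℕ → Bool → W n
    e a b = tabulate (λ i → eᵇ a b i (onY i))

    e-lookup : ∀ a b i → lookup (e a b) i ≡ eᵇ a b i (onY i)
    e-lookup a b i = Vecₚ.lookup∘tabulate _ i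

    e-pt : ∀ a b i → act (e a b) (pt i) ≡ eᵇ a b i (onY i)
    e-pt a b i = trans (act-def (e a b) i false) (e-lookup a b i)

    e-pt-on : ∀ a b i → onY i ≡ true → act (e a b) (pt i) ≡ negᵇ b (iter′ y a (pt i))
    e-pt-on a b i h = trans (e-pt a b i) (cong (eᵇ a b i) h)

    e-pt-off : ∀ a b i → onY i ≡ false → act (e a b) (pt i) ≡ pt i
    e-pt-off a b i h = trans (e-pt a b i) (cong (eᵇ a b i) h)

  e-on : ∀ a b p → onY ∣ p ∣ₚ ≡ true → act (e a b) p ≡ negᵇ b (iter′ y a p)
  e-on a b p@(i , s) h = trans (act-negᵇ (e a b) s (pt i)) (trans (cong (negᵇ s) (e-pt-on a b i h))
    (trans (negᵇ-negᵇ b s (iter′ y a (pt i))) (trans (cong (λ c → negᵇ c (iter′ y a (pt i))) (Boolₚ.xor-comm b s)) (trans (sym (negᵇ-negᵇ s b (iter′ y a (pt i)))) (cong (negᵇ b) (sym (iter-negᵇ y a s (pt i))))))))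

  e-off : ∀ a b p → onY ∣ p ∣ₚ ≡ false → act (e a b) p ≡ p
  e-off a b p@(i , s) h = trans (act-negᵇ (e a b) s (pt i)) (cong (negᵇ s) (e-pt-off a b i h))

  onY-iter : ∀ a p → onY ∣ iter′ y a p ∣ₚ ≡ onY ∣ p ∣ₚ
  onY-iter a p = ⇔⇒≡ᵇ
    (λ h → let m , f = onY-true h ; c , g = iter-return-abs By a p (Y m) (sym f)
           in true-onY (c + m) (trans (cong ∣_∣ₚ (sym (Y-+ c m))) (sym g)))
    (λ h → let m , f = onY-true h in true-onY (a + m) (trans (cong ∣_∣ₚ (sym (Y-+ a m))) (iter-abs-cong y a f)))

  e-abs : ∀ a b p → ∃ λ c → ∣ act (e a b) p ∣ₚ ≡ ∣ iter′ y c p ∣ₚ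
  e-abs a b p with onY ∣ p ∣ₚ in eq
  ... | true = a , cong ∣_∣ₚ (e-on a b p eq)
  ... | false = 0 , cong ∣_∣ₚ (e-off a b p eq)

  onY-e : ∀ a b p → onY ∣ act (e a b) p ∣ₚ ≡ onY ∣ p ∣ₚ
  onY-e a b p with e-abs a b p
  ... | c , f = trans (cong onY f) (onY-iter c p)

  IsB-e : ∀ a b → IsB (e a b)
  IsB-e a b = absInj⇒IsB λ {p} {q} h → go p q h
    where
    go : ∀ p q → ∣ act (e a b) p ∣ₚ ≡ ∣ act (e a b) q ∣ₚ → ∣ p ∣ₚ ≡ ∣ q ∣ₚ
    go p q h with onY ∣ p ∣ₚ in eqp | onY ∣ q ∣ₚ in eqq
    ... | true | true = iter-abs-inj By a {p} {q} (trans (sym (cong ∣_∣ₚ (e-on a b p eqp))) (trans h (cong ∣_∣ₚ (e-on a b q eqq))))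
    ... | false | false = trans (sym (cong ∣_∣ₚ (e-off a b p eqp))) (trans h (cong ∣_∣ₚ (e-off a b q eqq)))
    ... | true | false = ⊥-elim (true≢false (trans (cong onY (sym h)) (trans (onY-e a b p) eqp)) (trans (onY-e a b q) eqq))
    ... | false | true = ⊥-elim (true≢false (trans (cong onY h) (trans (onY-e a b q) eqq)) (trans (onY-e a b p) eqp))

  e-commute : ∀ a b → Commute (e a b) y
  e-commute a b = mkC go
    where
    go : ∀ p → act (e a b) (act y p) ≡ act y (act (e a b) p)
    go p with onY ∣ p ∣ₚ in eqp
    ... | true = trans (e-on a b (act y p) (trans (onY-iter 1 p) eqp)) (trans (cong (negᵇ b) (iter-comm y a 1 p))
          (trans (sym (act-negᵇ y b _)) (cong (act y) (sym (e-on a b p eqp)))))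
    ... | false = trans (e-off a b (act y p) (trans (onY-iter 1 p) eqp)) (cong (act y) (sym (e-off a b p eqp)))

  twist-e : ∀ x a b → Twist y x (x · e a b)
  twist-e x a b p with e-abs a b p
  ... | c , f = c , trans (cong ∣_∣ₚ (act-· x (e a b) p)) (abs-cong x f)

  twist-e⁻ : ∀ x a b → Twist y (x · e a b) x
  twist-e⁻ x a b p with e-abs a b (act (inv (e a b)) p)
  ... | c , f with iter-return-abs By c (act (inv (e a b)) p) p (trans (sym f) (cong ∣_∣ₚ (act-inv (IsB-e a b) p)))
  ... | c′ , g = c′ , trans (cong (λ q → ∣ act x q ∣ₚ) (sym (act-inv (IsB-e a b) p)))
        (trans (sym (cong ∣_∣ₚ (act-· x (e a b) _))) (abs-cong (x · e a b) g))

  -- t is the first return time of x to the y-cycle of j, and x^t = (−1)^ε y^s there.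
  record Loc (x : W n) (t s : ℕ) (ε : Bool) : Set where
    constructor mkLoc
    field
      t>0 : 0 < t
      return : iter′ x t J ≡ negᵇ ε (Y s)
      t-divides : ∀ c b → ∣ iter′ x c J ∣ₚ ≡ ∣ Y b ∣ₚ → t ∣ c
  open Loc public

  Hits : W n → ℕ → Set
  Hits x c = ∃ λ b → ∣ iter′ x c J ∣ₚ ≡ ∣ Y b ∣ₚ

  module _ {x : W n} (c : Commute x y) where

    hits-add : ∀ {a b} → Hits x a → Hits x b → Hits x (a + b)
    hits-add {a} {b} (u , f) (v , g) = v + u , trans (cong ∣_∣ₚ (iter-+ x a b J)) (trans (iter-abs-cong x a g)
      (trans (cong ∣_∣ₚ (iter-commute c a v J)) (trans (iter-abs-cong y v f) (cong ∣_∣ₚ (Y-+ v u)))))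

    hits-sub : ∀ {a b} → Hits x a → Hits x (a + b) → Hits x b
    hits-sub {a} {b} (u , f) (v , g) with iter-return-abs By u (iter′ x b J) (Y v)
      (trans (cong ∣_∣ₚ (sym (iter-commute c b u J))) (trans (iter-abs-cong x b (sym f)) (trans (cong ∣_∣ₚ (sym (iter-+ x b a J)))
        (trans (cong (λ m → ∣ iter′ x m J ∣ₚ) (ℕₚ.+-comm b a)) g))))
    ... | w , h = w + v , trans h (cong ∣_∣ₚ (Y-+ w v))

    hits? : ∀ m → Dec (Hits x m)
    hits? m with onY ∣ iter′ x m J ∣ₚ in eq
    ... | true = yes (let b , f = onY-true eq in b , sym f)
    ... | false = no λ { (b , f) → true≢false (true-onY b (sym f)) eq }

    -- The times at which x brings J to its y-cycle are closed under sums and cancellation, so they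
    -- are multiples of the first one.
    loc : IsB x → ∃ λ t → ∃ λ s → ∃ λ ε → Loc x t s ε
    loc Bx with minimalPeriod hits? (Nord n) (Nord>0 n) (0 , cong ∣_∣ₚ (iter-Nord Bx J))
                  (λ {a} {b} → hits-add {a} {b}) (λ {a} {b} → hits-sub {a} {b})
    ... | t , 0<t , (s , f) , div with abs⇒negᵇ {p = iter′ x t J} {Y s} f
    ... | ε , g = t , s , ε , mkLoc 0<t g (λ c b h → div c (b , h))

  module _ {x : W n} (c : Commute x y) {t s : ℕ} {ε : Bool} (L : Loc x t s ε) where

    loc-iter : ∀ m → iter′ x (m * t) J ≡ negᵇ (mulᵇ m ε) (Y (m * s))
    loc-iter zero = refl
    loc-iter (suc m) = trans (iter-+ x t (m * t) J) (trans (cong (iter′ x t) (loc-iter m))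
      (trans (iter-negᵇ x t _ _) (trans (cong (negᵇ (mulᵇ m ε)) (trans (iter-commute c t (m * s) J) (trans (cong (iter′ y (m * s)) (return L))
        (trans (iter-negᵇ y (m * s) ε (Y s)) (cong (negᵇ ε) (Y-+ (m * s) s))))))
        (trans (negᵇ-negᵇ ε (mulᵇ m ε) (Y (m * s + s))) (cong₂ negᵇ (Boolₚ.xor-comm ε (mulᵇ m ε)) (cong Y (ℕₚ.+-comm (m * s) s)))))))

    -- Between departure and first return x keeps off the y-cycle, and there `e a b` is the
    -- identity. The factor therefore acts exactly once, at departure: t survives and the return
    -- data are translated by (a, b).
    loc-shift : ∀ a b → Loc (x · e a b) t (s + a) (ε xor b)
    loc-shift a b = mkLoc (t>0 L) ret div
      where
      x′ = x · e a b
      c′ : Commute x′ y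
      c′ = commute-· c (e-commute a b)
      eJ : act (e a b) J ≡ negᵇ b (Y a)
      eJ = e-on a b J (true-onY 0 refl)
      onY-free : ∀ m → 0 < m → m < t → onY ∣ iter′ x m (negᵇ b (Y a)) ∣ₚ ≡ false
      onY-free m 0<m m<t = ≢true⇒false λ h → let u , f = onY-true h
                                                 v , g = iter-return-abs By a (iter′ x m J) (Y u) (trans (cong ∣_∣ₚ (trans (sym (iter-commute c m a J))
                                                          refl)) (trans (sym (cong ∣_∣ₚ (iter-negᵇ x m b (Y a)))) (sym f)))
        in ℕₚ.<⇒≱ m<t (Div.∣⇒≤ {{>-nonZero 0<m}} (t-divides L m (v + u) (trans g (cong ∣_∣ₚ (Y-+ v u)))))
      first : ∀ m → suc m ≤ t → iter′ x′ (suc m) J ≡ iter′ x (suc m) (negᵇ b (Y a))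
      first zero _ = trans (act-· x (e a b) J) (cong (act x) eJ)
      first (suc m) m< = trans (act-· x (e a b) _) (cong (act x) (trans (cong (act (e a b)) (first m (ℕₚ.<⇒≤ m<)))
        (e-off a b _ (onY-free (suc m) (s≤s z≤n) m<))))
      first′ : ∀ m → 0 < m → m ≤ t → iter′ x′ m J ≡ iter′ x m (negᵇ b (Y a))
      first′ (suc m) _ m≤ = first m m≤
      ret : iter′ x′ t J ≡ negᵇ (ε xor b) (Y (s + a))
      ret = trans (first′ t (t>0 L) ℕₚ.≤-refl) (trans (iter-negᵇ x t b _) (trans (cong (negᵇ b) (trans (iter-commute c t a J)
        (trans (cong (iter′ y a) (return L)) (trans (iter-negᵇ y a ε (Y s)) (cong (negᵇ ε) (trans (Y-+ a s) (cong Y (ℕₚ.+-comm a s))))))))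
        (negᵇ-negᵇ ε b (Y (s + a)))))
      div : ∀ m u → ∣ iter′ x′ m J ∣ₚ ≡ ∣ Y u ∣ₚ → t ∣ m
      div m u f = least-divides t (t>0 L) (s + a , cong ∣_∣ₚ ret)
        (λ m 0<m m<t h → true≢false (true-onY (proj₁ h) (trans (sym (proj₂ h)) (cong ∣_∣ₚ (first′ m 0<m (ℕₚ.<⇒≤ m<t))))) (onY-free m 0<m m<t))
        (λ {a} {b} → hits-add c′ {a} {b}) (λ {a} {b} → hits-sub c′ {a} {b}) m (u , f)

-- Weights of an orbit

module Weights {c ℓ : Level} (R : CommutativeRing c ℓ) (n : ℕ) (ζ : CommutativeRing.Carrier R)
  (ζᴺ : IsRoot R n ζ)
  (K : ℕ) {y : W n} (By : IsB y) where

  open CommutativeRing R renaming (_+_ to _⊕_; _*_ to _⊛_; refl to ≈-refl; sym to ≈-sym; trans to ≈-trans)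
  open RingSums R
  open Angles R n ζ ζᴺ
  open CM using (_⊜_) renaming (_⊕_ to _:*_; solve to solve*)

  σ : SP n → Carrier
  σ p = sg (proj₂ p)

  -- The products over all i are [x^K = y] χ(x) for a₁ and [x^K = w₀] ω^x(y) for a₂.
  a₁ a₂ : W n → Fin n → Carrier
  a₁ x i = if eqSP (iter′ x K (pt i)) (act y (pt i)) then σ (act x (pt i)) else 0#
  a₂ x i = if eqSP (iter′ x K (pt i)) (negSP (pt i)) then (if isBase x i then θ x (act y (pt i)) else 1#) else 0#

  orbit : W n → Fin n → List (Fin n)
  orbit x j = filterᵇ (orb x y j) (allFin n)

  ∈-orbit : ∀ {x j i} → IsB x → Orb x y j i → i ∈ orbit x j
  ∈-orbit {x} {j} {i} Bx o = ∈-filterᵇ⁺ (orb x y j) (allFin n) (Memₚ.∈-allFin i) (true-orb Bx By o)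

  ∈-orbit⁻ : ∀ {x j i} → i ∈ orbit x j → Orb x y j i
  ∈-orbit⁻ {x} {j} m = orb-true (proj₂ (∈-filterᵇ⁻ (orb x y j) (allFin n) m))

  orbit-unique : ∀ x j → Unique (orbit x j)
  orbit-unique x j = filterᵇ-unique (orb x y j) (Uniqueₚ.allFin⁺ n)

  σ-negᵇ : ∀ b p → σ (negᵇ b p) ≈ sg b ⊛ σ p
  σ-negᵇ b p = ≈-trans (sg-xor (proj₂ p) b) (*-comm _ _)

  σ² : ∀ p → σ p ⊛ σ p ≈ 1#
  σ² p = sg² (proj₂ p)

  σ-pt : ∀ x p → σ (act x (pt ∣ p ∣ₚ)) ≈ σ (act x p) ⊛ σ p
  σ-pt x p@(i , s) = ≈-sym (≈-trans (*-congʳ (≈-trans (reflexive (cong σ (act-negᵇ x s (pt i)))) (σ-negᵇ s (act x (pt i)))))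
    (≈-trans (≈-trans (*-congʳ (*-comm _ _)) (*-assoc _ _ _)) (≈-trans (*-congˡ (sg² s)) (*-identityʳ _))))

  cancel-middle : ∀ a b c → b ⊛ b ≈ 1# → (a ⊛ b) ⊛ (b ⊛ c) ≈ a ⊛ c
  cancel-middle a b c e = ≈-trans (solve* 3 (λ a b c → (a :* b) :* (b :* c) ⊜ (b :* b) :* (a :* c)) ≈-refl a b c) (≈-trans (*-congʳ e) (*-identityˡ _))

  module Local (j : Fin n) where
    open AtPoint By j

    W₁ W₂ : W n → Carrier
    W₁ x = ∏ (orbit x j) (a₁ x)
    W₂ x = ∏ (orbit x j) (a₂ x)

    module _ {x : W n} (Bx : IsB x) (c : Commute x y) where

      move : ∀ m β a b → iter′ x m (negᵇ β (iter′ x a (Y b))) ≡ negᵇ β (iter′ x a (iter′ y b (iter′ x m J)))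
      move m β a b = trans (iter-negᵇ x m β _) (cong (negᵇ β) (trans (iter-comm x m a _) (cong (iter′ x a) (iter-commute c m b J))))

      W₁-zero : ¬ iter′ x K J ≡ act y J → W₁ x ≈ 0#
      W₁-zero h = ∏-zero (orbit x j) (a₁ x) (∈-orbit Bx (orb-refl j))
        (reflexive (cong (λ b → if b then σ (act x J) else 0#) (≢true⇒false {eqSP (iter′ x K J) (act y J)} (λ e → h (eqSP-true e)))))

      W₂-zero : ¬ iter′ x K J ≡ negSP J → W₂ x ≈ 0#
      W₂-zero h = ∏-zero (orbit x j) (a₂ x) (∈-orbit Bx (orb-refl j))
        (reflexive (cong (λ b → if b then (if isBase x j then θ x (act y J) else 1#) else 0#) (≢true⇒false {eqSP (iter′ x K J) (negSP J)} (λ e → h (eqSP-true e)))))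

      represent : ∀ {i} → Orb x y j i → ∃ λ a → ∃ λ b → ∃ λ β → pt i ≡ negᵇ β (iter′ x a (Y b))
      represent {i} (a , b , f) = a , b , abs⇒negᵇ {p = pt i} {iter′ x a (Y b)} (sym f)

      module _ {t s : ℕ} {ε : Bool} (L : Loc x t s ε) where

        -- The points x^a y^b J with a < t and b < d meet each absolute value of the orbit once: a
        -- is reduced modulo t by x^t J = ± y^s J, then b modulo d by y^d J = ± J.
        orbit-∏ : ∀ (F : Fin n → Carrier) → ∏ (orbit x j) F ≈ ∏ (upTo d) (λ b → ∏ (upTo t) (λ a → F ∣ iter′ x a (Y b) ∣ₚ))
        orbit-∏ F = ≈-sym (≈-trans (Prod.bigop-cong (upTo d) (λ {b} _ → reflexive (sym (Prod.bigop-map (b ,_) (upTo t) (F ∘ h)))))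
          (≈-trans (≈-sym (Prod.bigop-concatMap (λ b → map (b ,_) (upTo t)) (upTo d) (F ∘ h)))
            (Prod.bigop-reindex h F pairs-unique (orbit-unique x j) into inj onto)))
          where
          h : ℕ × ℕ → Fin n
          h (b , a) = ∣ iter′ x a (Y b) ∣ₚ
          pairs = concatMap (λ b → map (b ,_) (upTo t)) (upTo d)
          mem : ∀ {b a} → (b , a) ∈ pairs → b < d × a < t
          mem m with ∈-concatMap⁻ (λ b → map (b ,_) (upTo t)) (upTo d) m
          ... | b , b∈ , m′ with Memₚ.∈-map⁻ _ m′
          ... | a , a∈ , refl = ∈-upTo⁻ b∈ , ∈-upTo⁻ a∈
          pairs-unique : Unique pairs
          pairs-unique = concatMap-unique _ (Uniqueₚ.upTo⁺ d) (λ {b} _ → map-unique (b ,_) (Uniqueₚ.upTo⁺ t) (λ { _ _ refl → refl })) (λ _ _ → dis)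
            where
            dis : ∀ {b b′ z} → z ∈ map (b ,_) (upTo t) → z ∈ map (b′ ,_) (upTo t) → b ≡ b′
            dis p q with Memₚ.∈-map⁻ _ p | Memₚ.∈-map⁻ _ q
            ... | _ , _ , refl | _ , _ , refl = refl
          into : ∀ {z} → z ∈ pairs → h z ∈ orbit x j
          into {b , a} _ = ∈-orbit Bx (a , b , refl)
          multiple-small : ∀ m k → k < m → m ∣ k → k ≡ 0
          multiple-small m zero _ _ = refl
          multiple-small m (suc k) k<m m∣k = ⊥-elim (ℕₚ.<⇒≱ k<m (Div.∣⇒≤ m∣k))
          same-b : ∀ b b′ → b ≤ b′ → b′ < d → ∣ Y b ∣ₚ ≡ ∣ Y b′ ∣ₚ → b ≡ b′
          same-b b b′ b≤ b′< f with ℕₚ.m≤n⇒∃[o]m+o≡n b≤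
          ... | o , refl with multiple-small d o (ℕₚ.≤-<-trans (ℕₚ.m≤n+m o b) b′<)
                   (d∣returns o (iter-abs-inj By b (trans (cong ∣_∣ₚ (Y-+ b o)) (sym f))))
          ... | refl = sym (ℕₚ.+-identityʳ b)
          same-b′ : ∀ b b′ → b < d → b′ < d → ∣ Y b ∣ₚ ≡ ∣ Y b′ ∣ₚ → b ≡ b′
          same-b′ b b′ b< b′< f with ℕₚ.≤-total b b′
          ... | inj₁ le = same-b b b′ le b′< f
          ... | inj₂ le = sym (same-b b′ b le b< (sym f))
          same : ∀ a b a′ b′ → a ≤ a′ → a′ < t → b < d → b′ < d → h (b , a) ≡ h (b′ , a′) → (b , a) ≡ (b′ , a′)
          same a b a′ b′ a≤ a′< b< b′< f with ℕₚ.m≤n⇒∃[o]m+o≡n a≤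
          ... | o , refl with iter-abs-inj Bx a {Y b} {iter′ x o (Y b′)} (trans f (cong ∣_∣ₚ (iter-+ x a o (Y b′))))
          ... | g with iter-return-abs By b′ (iter′ x o J) (Y b) (trans (cong ∣_∣ₚ (sym (iter-commute c o b′ J))) (sym g))
          ... | w , k with multiple-small t o (ℕₚ.≤-<-trans (ℕₚ.m≤n+m o a) a′<) (t-divides L o (w + b) (trans k (cong ∣_∣ₚ (Y-+ w b))))
          ... | refl = cong₂ _,_ (same-b′ b b′ b< b′< g) (sym (ℕₚ.+-identityʳ a))
          inj : ∀ {z z′} → z ∈ pairs → z′ ∈ pairs → h z ≡ h z′ → z ≡ z′
          inj {b , a} {b′ , a′} m m′ f with mem m | mem m′ | ℕₚ.≤-total a a′
          ... | b< , a< | b′< , a′< | inj₁ le = same a b a′ b′ le a′< b< b′< f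
          ... | b< , a< | b′< , a′< | inj₂ le = sym (same a′ b′ a b le a< b′< b< (sym f))
          Y-rem : ∀ u → ∃ λ r → r < d × ∣ Y u ∣ₚ ≡ ∣ Y r ∣ₚ
          Y-rem u with euclid d 0<d u
          ... | q , r , r<d , refl = r , r<d , trans (cong ∣_∣ₚ (sym (Y-+ r (q * d)))) (iter-abs-cong y r (mult q))
            where
            mult : ∀ q → Returns (q * d)
            mult zero = refl
            mult (suc q) = returns-add {d} {q * d} returns-d (mult q)
          onto : ∀ {i} → i ∈ orbit x j → ∃ λ z → z ∈ pairs × h z ≡ i
          onto m with ∈-orbit⁻ m
          ... | a , b , f with euclid t (t>0 L) a
          ... | q , r , r<t , refl with Y-rem (b + q * s)
          ... | b′ , b′<d , g = (b′ , r) , ∈-concatMap (λ b → map (b ,_) (upTo t)) (upTo d) (∈-upTo b′<d) (Memₚ.∈-map⁺ (b′ ,_) (∈-upTo r<t)) ,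
                trans (iter-abs-cong x r (trans (sym g) (sym (trans (cong ∣_∣ₚ (iter-commute c (q * t) b J))
                  (trans (iter-abs-cong y b (cong ∣_∣ₚ (loc-iter c L q))) (cong ∣_∣ₚ (Y-+ b (q * s))))))))
                  (trans (cong ∣_∣ₚ (sym (iter-+ x r (q * t) (Y b)))) f)

        -- The sign of x at |p| is σ(x p) σ(p), so the inner signs cancel in pairs.
        telescope-x : ∀ m q → ∏ (upTo m) (λ a → σ (act x (pt ∣ iter′ x a q ∣ₚ))) ≈ σ (iter′ x m q) ⊛ σ q
        telescope-x zero q = ≈-sym (σ² q)
        telescope-x (suc m) q = ≈-trans (Prod.bigop-upTo-suc m _) (≈-trans (*-cong (telescope-x m q) (σ-pt x (iter′ x m q)))
          (≈-trans (solve* 3 (λ a b c → (a :* b) :* (c :* a) ⊜ (c :* a) :* (a :* b)) ≈-refl _ _ _) (cancel-middle _ _ _ (σ² (iter′ x m q)))))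

        -- Passing from s to s + 1 drops the sign of `Y s` from the window and takes in that of
        -- `Y (d + s)`, which is (-1)^δ times it.
        shift-y : ∀ s → ∏ (upTo d) (λ b → σ (Y (b + s)) ⊛ σ (Y b)) ≈ pow (sg δ) s
        shift-y zero = Prod.bigop-ε (upTo d) (λ {b} _ → ≈-trans (*-congʳ (reflexive (cong (σ ∘ Y) (ℕₚ.+-identityʳ b)))) (σ² (Y b)))
        shift-y (suc s) = ≈-trans (Prod.bigop-∙ (upTo d) _ _) (≈-trans (*-congʳ rotate) (≈-trans (*-assoc _ _ _)
            (*-congˡ (≈-trans (≈-sym (Prod.bigop-∙ (upTo d) _ _)) (shift-y s)))))
          where
          P = ∏ (upTo d) (λ b → σ (Y (b + s)))
          Q = ∏ (upTo d) (λ b → σ (Y (b + suc s)))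
          Y-ds : Y (d + s) ≡ negᵇ δ (Y s)
          Y-ds = trans (cong Y (ℕₚ.+-comm d s)) (trans (sym (Y-+ s d)) (trans (cong (iter′ y s) Y-d) (iter-negᵇ y s δ J)))
          whole : σ (Y s) ⊛ Q ≈ P ⊛ (sg δ ⊛ σ (Y s))
          whole = ≈-trans (*-congˡ (Prod.bigop-cong (upTo d) (λ {b} _ → reflexive (cong (σ ∘ Y) (ℕₚ.+-suc b s)))))
            (≈-trans (≈-sym (Prod.bigop-upTo-head d (λ b → σ (Y (b + s))))) (≈-trans (Prod.bigop-upTo-suc d (λ b → σ (Y (b + s))))
              (*-congˡ (≈-trans (reflexive (cong σ Y-ds)) (σ-negᵇ δ (Y s))))))
          rotate : Q ≈ sg δ ⊛ P
          rotate = ≈-trans (≈-sym (≈-trans (≈-sym (*-assoc _ _ _)) (≈-trans (*-congʳ (σ² (Y s))) (*-identityˡ _)))) (≈-trans (*-congˡ whole)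
            (≈-trans (solve* 3 (λ a p e → a :* (p :* (e :* a)) ⊜ (a :* a) :* (e :* p)) ≈-refl _ _ _) (≈-trans (*-congʳ (σ² (Y s))) (*-identityˡ _))))

        ∏-const : ∀ m r → ∏ (upTo m) (λ _ → r) ≈ pow r m
        ∏-const zero r = ≈-refl
        ∏-const (suc m) r = ≈-trans (Prod.bigop-upTo-head m (λ _ → r)) (*-congˡ (∏-const m r))

        -- For fixed b the signs along x telescope to those of Y b and of x^t Y b = (-1)^ε Y (b +
        -- s). Each of the d values of b contributes (-1)^ε, and the rotation by s contributes the
        -- s-th power of (-1)^δ.
        W₁-value : iter′ x K J ≡ act y J → W₁ x ≈ pow (sg ε) d ⊛ pow (sg δ) s
        W₁-value h = ≈-trans (Prod.bigop-cong (orbit x j) (λ {i} m → reflexive (cong (λ b → if b then σ (act x (pt i)) else 0#)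
              (true-eqSP {p = iter′ x K (pt i)} (all-y m)))))
          (≈-trans (orbit-∏ (λ i → σ (act x (pt i)))) (≈-trans (Prod.bigop-cong (upTo d) (λ {b} _ → ≈-trans (telescope-x t (Y b)) (≈-trans (*-congʳ (last b)) (*-assoc _ _ _))))
          (≈-trans (Prod.bigop-∙ (upTo d) _ _) (*-cong (∏-const d (sg ε)) (shift-y s)))))
          where
          all-y : ∀ {i} → i ∈ orbit x j → iter′ x K (pt i) ≡ act y (pt i)
          all-y m with represent (∈-orbit⁻ m)
          ... | a , b , β , f = trans (cong (iter′ x K) f) (trans (move K β a b) (trans (cong (λ q → negᵇ β (iter′ x a (iter′ y b q))) h)
                (sym (trans (cong (act y) f) (trans (act-negᵇ y β _) (cong (negᵇ β) (trans (sym (iter-commute c a 1 (Y b))) (cong (iter′ x a) (iter-comm y 1 b J)))))))))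
          last : ∀ b → σ (iter′ x t (Y b)) ≈ sg ε ⊛ σ (Y (b + s))
          last b = ≈-trans (reflexive (cong σ (trans (iter-commute c t b J) (trans (cong (iter′ y b) (return L)) (trans (iter-negᵇ y b ε (Y s)) (cong (negᵇ ε) (Y-+ b s)))))))
            (σ-negᵇ ε (Y (b + s)))

      -- The cycles of x in the orbit of j are those of J, yJ, …, yᵐ⁻¹J; the product telescopes.
      W₂-value : ∀ m r → 0 < m → Y m ≡ iter′ x r J → (∀ c r′ → Y c ≡ iter′ x r′ J → m ∣ c) → iter′ x K J ≡ negSP J →
        W₂ x ≈ pow ζ (r * angle x J)
      W₂-value m r 0<m Ym div h =
        ≈-trans (Prod.bigop-cong (orbit x j) (λ {i} i∈ → reflexive (cong (λ b → if b then (if isBase x i then θ x (act y (pt i)) else 1#) else 0#)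
            (true-eqSP {p = iter′ x K (pt i)} (min-orbit i∈)))))
        (≈-trans (≈-sym (Prod.bigop-filterᵇ (isBase x) (orbit x j) (λ i → θ x (act y (pt i)))))
        -- Inserting θ⁻, which is 1 at base points, makes the factors constant along cycles; base
        -- points can then be traded for the points Y u.
        (≈-trans (Prod.bigop-cong Bs (λ {i} i∈ → ≈-sym (≈-trans (*-congˡ (θ⁻-base Bx i (proj₂ (∈-filterᵇ⁻ (isBase x) (orbit x j) i∈)))) (*-identityʳ _))))
        (≈-trans (≈-sym (Prod.bigop-reindex base (λ i → G (pt i)) (Uniqueₚ.upTo⁺ m) (filterᵇ-unique (isBase x) (orbit-unique x j)) into inj onto))
        (≈-trans (Prod.bigop-cong (upTo m) (λ {u} _ → G-base u)) (≈-trans (telescope m) (≈-trans (*-congʳ (≈-trans (reflexive (cong (θ x) Ym)) (θ-iter Bx K J r h)))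
          (≈-trans (*-assoc _ _ _) (≈-trans (*-congˡ (θ*θ⁻ x J)) (*-identityʳ _)))))))))
        where
        open Minus Bx K
        Bs = filterᵇ (isBase x) (orbit x j)
        min-at : ∀ a b → Min (iter′ x a (Y b))
        min-at a b = Min-iter a (trans (iter-commute c K b J) (trans (cong (iter′ y b) h) (iter-neg y b J)))
        min-orbit : ∀ {i} → i ∈ orbit x j → Min (pt i)
        min-orbit i∈ with ∈-orbit⁻ i∈
        ... | a , b , f = Min-abs {iter′ x a (Y b)} f (min-at a b)
        G : SP n → Carrier
        G p = θ x (act y p) ⊛ θ⁻ x p
        base : ℕ → Fin n
        base u = baseOf x (Y u)
        G-base : ∀ u → G (pt (base u)) ≈ G (Y u)
        G-base u with toBase (min-at 0 u)
        ... | b , f = ≈-trans (reflexive (cong G (sym f))) (≈-trans (reflexive (cong (λ q → θ x q ⊛ θ⁻ x (iter′ x b (Y u))) (sym (iter-act-comm c b (Y u)))))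
            (ratio-iter Bx Bx K (act y (Y u)) (Y u) b (min-at 0 (suc u)) (min-at 0 u) (cycLenPred-commute By c (Y u))))
        telescope : ∀ m → ∏ (upTo m) (λ u → G (Y u)) ≈ θ x (Y m) ⊛ θ⁻ x J
        telescope zero = ≈-sym (θ*θ⁻ x J)
        telescope (suc m) = ≈-trans (Prod.bigop-upTo-suc m _) (≈-trans (*-congʳ (telescope m))
          (≈-trans (solve* 4 (λ a b c e → (a :* b) :* (c :* e) ⊜ (c :* b) :* (a :* e)) ≈-refl _ _ _ _) (≈-trans (*-congˡ (θ*θ⁻ x (Y m))) (*-identityʳ _))))
        into : ∀ {u} → u ∈ upTo m → base u ∈ Bs
        into {u} _ with toBase (min-at 0 u)
        ... | b , f = ∈-filterᵇ⁺ (isBase x) (orbit x j) (∈-orbit Bx (b , u , cong ∣_∣ₚ f)) (baseOf-isBase Bx (Y u))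
        inj-≤ : ∀ u v → u ≤ v → v < m → base u ≡ base v → u ≡ v
        inj-≤ u v u≤v v<m f with ℕₚ.m≤n⇒∃[o]m+o≡n u≤v
        ... | o , refl with sameBase⇒cycle {Y u} {Y (u + o)} (min-at 0 u) (min-at 0 (u + o)) f
        ... | b , g with div o b (iter-inj By u (trans (Y-+ u o) (trans (sym g) (iter-commute c b u J))))
        ... | divides zero refl = sym (ℕₚ.+-identityʳ u)
        ... | divides (suc q) refl = ⊥-elim (ℕₚ.<⇒≱ v<m (ℕₚ.≤-trans (ℕₚ.m≤m+n m (q * m)) (ℕₚ.m≤n+m _ u)))
        inj : ∀ {u v} → u ∈ upTo m → v ∈ upTo m → base u ≡ base v → u ≡ v
        inj {u} {v} u∈ v∈ f with ℕₚ.≤-total u v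
        ... | inj₁ le = inj-≤ u v le (∈-upTo⁻ v∈) f
        ... | inj₂ le = sym (inj-≤ v u le (∈-upTo⁻ u∈) (sym f))
        Y-q : ∀ q → ∃ λ r′ → Y (q * m) ≡ iter′ x r′ J
        Y-q zero = 0 , refl
        Y-q (suc q) with Y-q q
        ... | r′ , f = r′ + r , trans (sym (Y-+ m (q * m))) (trans (cong (iter′ y m) f) (trans (sym (iter-commute c r′ m J))
              (trans (cong (iter′ x r′) Ym) (sym (iter-+ x r′ r J)))))
        onto : ∀ {i} → i ∈ Bs → ∃ λ u → u ∈ upTo m × base u ≡ i
        onto {i} i∈ with ∈-filterᵇ⁻ (isBase x) (orbit x j) i∈
        ... | i∈O , b with ∈-orbit⁻ i∈O
        ... | A , B , f with euclid m 0<m B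
        ... | q , u , u<m , refl with Y-q q
        ... | r′ , g = u , ∈-upTo u<m , trans (sym (baseOf-cycle Bx (Y u) (pt i) (A + r′) (trans (cong ∣_∣ₚ (trans (iter-+ x A r′ (Y u))
              (cong (iter′ x A) (trans (iter-commute c r′ u J) (trans (cong (iter′ y u) (sym g)) (Y-+ u (q * m))))))) f)))
              (isBase-true Bx i b)

-- The local identity

mulᵇ-false : ∀ m → mulᵇ m false ≡ false
mulᵇ-false zero = refl
mulᵇ-false (suc m) = trans (Boolₚ.xor-identityʳ _) (mulᵇ-false m)

mulᵇ-xor : ∀ m a b → mulᵇ m (a xor b) ≡ mulᵇ m a xor mulᵇ m b
mulᵇ-xor zero a b = refl
mulᵇ-xor (suc m) a b = trans (cong (_xor (a xor b)) (mulᵇ-xor m a b)) (l (mulᵇ m a) (mulᵇ m b) a b)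
  where
  l : ∀ p q a b → (p xor q) xor (a xor b) ≡ (p xor a) xor (q xor b)
  l p q a b = trans (Boolₚ.xor-assoc p q (a xor b)) (trans (cong (p xor_) (trans (sym (Boolₚ.xor-assoc q a b))
    (trans (cong (_xor b) (Boolₚ.xor-comm q a)) (Boolₚ.xor-assoc a q b)))) (sym (Boolₚ.xor-assoc p a (q xor b))))

mulᵇ-+ : ∀ m k b → mulᵇ (m + k) b ≡ mulᵇ m b xor mulᵇ k b
mulᵇ-+ zero k b = refl
mulᵇ-+ (suc m) k b = trans (cong (_xor b) (mulᵇ-+ m k b)) (l (mulᵇ m b) (mulᵇ k b) b)
  where
  l : ∀ p q b → (p xor q) xor b ≡ (p xor b) xor q
  l p q b = trans (Boolₚ.xor-assoc p q b) (trans (cong (p xor_) (Boolₚ.xor-comm q b)) (sym (Boolₚ.xor-assoc p b q)))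

mulᵇ-* : ∀ m k b → mulᵇ (m * k) b ≡ mulᵇ m (mulᵇ k b)
mulᵇ-* zero k b = refl
mulᵇ-* (suc m) k b = trans (mulᵇ-+ k (m * k) b) (trans (Boolₚ.xor-comm (mulᵇ k b) _) (cong (_xor mulᵇ k b) (mulᵇ-* m k b)))

mulᵇ-2 : ∀ b → mulᵇ 2 b ≡ false
mulᵇ-2 true = refl
mulᵇ-2 false = refl

mulᵇ-even : ∀ l b → mulᵇ (l * 2) b ≡ false
mulᵇ-even l b = trans (mulᵇ-* l 2 b) (trans (cong (mulᵇ l) (mulᵇ-2 b)) (mulᵇ-false l))

mulᵇ-odd : ∀ l b → mulᵇ (suc (l * 2)) b ≡ b
mulᵇ-odd l b = cong (_xor b) (mulᵇ-even l b)

parity : ∀ m → (∃ λ l → m ≡ l * 2) ⊎ (∃ λ l → m ≡ suc (l * 2))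
parity m with euclid 2 (s≤s z≤n) m
... | q , zero , _ , e = inj₁ (q , e)
... | q , suc zero , _ , e = inj₂ (q , e)
... | q , suc (suc _) , s≤s (s≤s ()) , e

even≢odd : ∀ a b → a * 2 ≡ suc (b * 2) → ⊥
even≢odd (suc a) (suc b) e = even≢odd a b (ℕₚ.suc-injective (ℕₚ.suc-injective e))

odd-factorʳ : ∀ a b l → a * b ≡ suc (l * 2) → ∃ λ b′ → b ≡ suc (b′ * 2)
odd-factorʳ a b l e with parity b
... | inj₂ h = h
... | inj₁ (b′ , refl) = ⊥-elim (even≢odd (a * b′) l (trans (ℕₚ.*-assoc a b′ 2) e))

even-factor : ∀ m b′ l → m * suc (b′ * 2) ≡ l * 2 → ∃ λ m′ → m ≡ m′ * 2
even-factor m b′ l e with parity m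
... | inj₁ h = h
... | inj₂ (m′ , refl) = ⊥-elim (even≢odd l (m′ + b′ + (m′ * b′) * 2) (trans (sym e) (l₁ m′ b′)))
  where
  l₁ : ∀ m′ b′ → suc (m′ * 2) * suc (b′ * 2) ≡ suc ((m′ + b′ + (m′ * b′) * 2) * 2)
  l₁ = solve-∀

odd∣even : ∀ {b} b′ v → b ≡ 1 + b′ * 2 → b ∣ v * 2 → b * 2 ∣ v * 2
odd∣even {b} b′ v refl (divides q e) with even-factor q b′ v (sym e)
... | q′ , refl = divides q′ (trans e (l q′ b))
  where
  l : ∀ q′ b → q′ * 2 * b ≡ q′ * (b * 2)
  l = solve-∀

-- Chinese remainders for the coprime moduli 2 and b: adding the odd number b to an even number
-- makes it odd and keeps its residue modulo b.
cong-lift : ∀ {b} b′ c → b ≡ 1 + b′ * 2 → Cong b (c * 2) 1 → Cong (b * 2) (c * 2 + b) 1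
cong-lift {b} b′ c b≡ h = cong-trans (cong-refl {a = c * 2 + b} {(c + b′) * 2 + 1} half) (cong-+ {c = 1} {1} (∣⇒cong-0 even) (cong-refl refl))
  where
  l₁ : ∀ c b′ → c * 2 + (1 + b′ * 2) ≡ (c + b′) * 2 + 1
  l₁ = solve-∀
  half : c * 2 + b ≡ (c + b′) * 2 + 1
  half = trans (cong (c * 2 +_) b≡) (l₁ c b′)
  sum : Cong b ((c + b′) * 2 + 1) (0 + 1)
  sum = cong-trans (cong-refl {b = c * 2 + b} (sym half)) (cong-+ {b = 1} {d = 0} h (∣⇒cong-0 Div.∣-refl))
  even : b * 2 ∣ (c + b′) * 2
  even = odd∣even b′ (c + b′) b≡ (cong-0⇒∣ (cong-cancel-+ {a = (c + b′) * 2} {0} 1 sum))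

iter-raise : ∀ {n} (x : W n) k {a b p} → iter′ x a p ≡ iter′ x b p → iter′ x (k * a) p ≡ iter′ x (k * b) p
iter-raise x zero e = refl
iter-raise x (suc k) {a} {b} {p} e = trans (iter-+ x a (k * a) p) (trans (cong (iter′ x a) (iter-raise x k {a} {b} e))
  (trans (iter-comm x a (k * b) p) (trans (cong (iter′ x (k * b)) e) (trans (iter-comm x (k * b) b p) (sym (iter-+ x b (k * b) p))))))

module LocalIdentity {c ℓ : Level} (R : CommutativeRing c ℓ)
  (domain : IsDomain R) (char0 : CharZero R)
  (n : ℕ) (ζ : CommutativeRing.Carrier R)
  (ζᴺ : IsRoot R n ζ) (prim : IsPrimitive R n ζ)
  (K : ℕ) {y : W n} (By : IsB y) (j : Fin n) where

  open CommutativeRing R renaming (_+_ to _⊕_; _*_ to _⊛_; refl to ≈-refl; sym to ≈-sym; trans to ≈-trans)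
  open RingSums R
  open Domain domain char0
  open ExponentSums R domain char0
  open Angles R n ζ ζᴺ
  open Weights R n ζ ζᴺ K By
  open Local j
  open AtPoint By j
  open import Algebra.Properties.Ring ring using (-1*x≈-x)

  ζ-order : ∀ m → pow ζ m ≈ 1# → Nord n ∣ m
  ζ-order m h with euclid (Nord n) (Nord>0 n) m
  ... | q , zero , _ , refl = divides q refl
  ... | q , suc r , r< , refl = ⊥-elim (prim (suc r) (s≤s z≤n) r<
        (≈-trans (≈-sym (≈-trans (*-congˡ (ζ-period q)) (*-identityʳ _))) (≈-trans (≈-sym (pow-+ ζ (suc r) (q * Nord n))) h)))

  positive-factor : ∀ {a b m} → a * b ≡ m → 0 < m → 0 < a
  positive-factor {zero} refl ()
  positive-factor {suc a} _ _ = s≤s z≤n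

  order-factor : ∀ {A L} → A * L ≡ Nord n → ∀ m → pow ζ (m * A) ≈ 1# → L ∣ m
  order-factor {zero} e m h = ⊥-elim (ℕₚ.<⇒≢ (Nord>0 n) e)
  order-factor {A@(suc _)} {L} e m h = Div.*-cancelˡ-∣ A (subst₂ _∣_ (sym e) (ℕₚ.*-comm m A) (ζ-order (m * A) h))

  -- Twice m steps return to J, so the value squares to 1. It is not 1, since otherwise the cycle
  -- length would divide m and J would equal -J.
  minus-angle : ∀ {x} → IsB x → ∀ m → iter′ x m J ≡ negSP J → pow ζ (m * angle x J) ≈ - 1#
  minus-angle {x} Bx m h = square-one _ sq (λ one → neg≢ (trans (sym h) (back (order-factor (angle-* Bx J) m one))))
    where
    sq : pow ζ (m * angle x J) ⊛ pow ζ (m * angle x J) ≈ 1#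
    sq = ≈-trans (≈-sym (pow-+ ζ (m * angle x J) (m * angle x J))) (≈-trans (reflexive (cong (pow ζ) (sym (ℕₚ.*-distribʳ-+ (angle x J) m m))))
      (pow-cycle Bx J (m + m) 0 (trans (iter-+ x m m J) (trans (cong (iter′ x m) h) (trans (iter-neg x m J) (trans (cong negSP h) (neg-neg J)))))))
    back : cycLen x J ∣ m → iter′ x m J ≡ J
    back (divides q refl) = iter-fix x (cycLen x J) (iter-cycLen Bx J) q

  Z : Carrier
  Z = pow ζ (angle y J)

  Zᴰ : pow Z D ≈ 1#
  Zᴰ = ≈-trans (≈-sym (pow-* ζ D (angle y J))) (≈-trans (reflexive (cong (pow ζ) (trans (ℕₚ.*-comm D (angle y J)) (angle-* By J)))) ζᴺ)

  Z-order : ∀ m → pow Z m ≈ 1# → D ∣ m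
  Z-order m h = order-factor (angle-* By J) m (≈-trans (pow-* ζ m (angle y J)) h)

  J≡ : negᵇ true J ≡ negSP J
  J≡ = negᵇ-true J

  Y-D∣ : ∀ m → D ∣ m → Y m ≡ J
  Y-D∣ m (divides q refl) = Y-mult q

  Y-∣ : ∀ m → Y m ≡ J → D ∣ m
  Y-∣ m h = cycLen-divides By J m h

  d∣D : d ∣ D
  d∣D = d∣returns D (cong ∣_∣ₚ Y-D)

  class⁺ : δ ≡ false → ∀ m → ¬ Y m ≡ negSP J
  class⁺ e m h with d∣returns m (cong ∣_∣ₚ h)
  ... | divides q refl = neg≢ (trans (sym h) (iter-fix y d (trans Y-d (trans (cong (λ b → negᵇ b J) e) (negᵇ-false J))) q))

  Y-d⁻ : δ ≡ true → Y d ≡ negSP J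
  Y-d⁻ e = trans Y-d (trans (cong (λ b → negᵇ b J) e) J≡)

  Y-shift⁻ : δ ≡ true → ∀ m → Y (m + d) ≡ negᵇ true (Y m)
  Y-shift⁻ e m = trans (sym (Y-+ m d)) (trans (cong (iter′ y m) (trans (Y-d⁻ e) (sym J≡))) (iter-negᵇ y m true J))

  -- d steps lead to -J and 2d steps to J, while every odd multiple of d still ends at -J.
  D≡2d : δ ≡ true → D ≡ d * 2
  D≡2d e with d∣D
  ... | divides q D≡ with parity q
  ... | inj₁ (l , refl) = Div.∣-antisym (Y-∣ (d * 2) two) (divides l (trans D≡ (l₁ l d)))
    where
    two : Y (d * 2) ≡ J
    two = trans (cong Y (l₂ d)) (trans (Y-shift⁻ e d) (trans (cong (negᵇ true) (trans (Y-d⁻ e) (sym J≡))) (trans (negᵇ-negᵇ true true J) (negᵇ-false J))))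
      where
      l₂ : ∀ d → d * 2 ≡ d + d
      l₂ = solve-∀
    l₁ : ∀ l d → l * 2 * d ≡ l * (d * 2)
    l₁ = solve-∀
  ... | inj₂ (l , refl) = ⊥-elim (neg≢ (trans (sym (trans (cong Y (trans D≡ (l₁ l d))) (odd l))) Y-D))
    where
    l₁ : ∀ l d → suc (l * 2) * d ≡ l * 2 * d + d
    l₁ = solve-∀
    odd : ∀ l → Y (l * 2 * d + d) ≡ negSP J
    odd zero = Y-d⁻ e
    odd (suc l) = trans (cong Y (l₃ l d)) (trans (Y-shift⁻ e (l * 2 * d + d + d)) (trans (cong (negᵇ true) (Y-shift⁻ e (l * 2 * d + d))) (trans (negᵇ-negᵇ true true (Y (l * 2 * d + d))) (trans (negᵇ-false (Y (l * 2 * d + d))) (odd l)))))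
      where
      l₃ : ∀ l d → suc l * 2 * d + d ≡ l * 2 * d + d + d + d
      l₃ = solve-∀

  pow-sg-even : ∀ b l → pow (sg b) (l * 2) ≈ 1#
  pow-sg-even b l = ≈-trans (pow-* (sg b) l 2) (pow-one l (≈-trans (*-congˡ (*-identityʳ _)) (sg² b)))

  pow-sg-odd : ∀ b l → pow (sg b) (suc (l * 2)) ≈ sg b
  pow-sg-odd b l = ≈-trans (*-congˡ (pow-sg-even b l)) (*-identityʳ _)

  sg-not : ∀ b → sg b ⊕ sg (b xor true) ≈ 0#
  sg-not true = -‿inverseˡ 1#
  sg-not false = -‿inverseʳ 1#

  zero-sum : ∀ {u v} → u ≈ 0# → v ≈ 0# → u ⊕ v ≈ 0#
  zero-sum e f = ≈-trans (+-cong e f) (+-identityˡ 0#)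

  hit-y : ∀ {x t s ε} → Loc x t s ε → iter′ x K J ≡ act y J → t ∣ K
  hit-y L h = t-divides L K 1 (cong ∣_∣ₚ h)

  hit-neg : ∀ {x t s ε} → Loc x t s ε → iter′ x K J ≡ negSP J → t ∣ K
  hit-neg L h = t-divides L K 0 (cong ∣_∣ₚ h)

  -- When k = K/t is even, changing the sign of the return changes the sign of both weights.
  module Even {t l : ℕ} (K≡ : K ≡ l * 2 * t) where

    k = l * 2

    xK : ∀ {x s ε} → Commute x y → Loc x t s ε → iter′ x K J ≡ Y (k * s)
    xK {x} {s} {ε} c L = trans (cong (λ m → iter′ x m J) K≡) (trans (loc-iter c L k)
      (trans (cong (λ b → negᵇ b (Y (k * s))) (mulᵇ-even l ε)) (negᵇ-false _)))

    -- k s = 1 modulo D with k even makes D odd, and d divides D.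
    d-odd : ∀ s → Y (k * s) ≡ act y J → ∃ λ d′ → d ≡ suc (d′ * 2)
    d-odd s h with parity d
    ... | inj₂ w = w
    ... | inj₁ (d′ , e) = ⊥-elim (ℕₚ.<⇒≱ (s≤s (s≤s z≤n)) (Div.∣⇒≤ (cong-∣-resp (Div.∣-trans (divides d′ e) d∣D) (cong-sym (Y-cong⁻ {k * s} {1} h))
            (divides (l * s) (l₁ l s)))))
      where
      l₁ : ∀ l s → l * 2 * s ≡ l * s * 2
      l₁ = solve-∀

    module _ {x₁ x₂ : W n} (B₁ : IsB x₁) (B₂ : IsB x₂) (c₁ : Commute x₁ y) (c₂ : Commute x₂ y)
      {s : ℕ} {ε : Bool} (L₁ : Loc x₁ t s ε) (L₂ : Loc x₂ t s (ε xor true)) where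

      -- The return sign enters as its d-th power, and d is odd.
      W₁-flip : W₁ x₁ ⊕ W₁ x₂ ≈ 0#
      W₁-flip with Y (k * s) ≟SP act y J
      ... | no h = zero-sum (W₁-zero B₁ c₁ (λ e → h (trans (sym (xK c₁ L₁)) e))) (W₁-zero B₂ c₂ (λ e → h (trans (sym (xK c₂ L₂)) e)))
      ... | yes h with d-odd s h
      ... | d′ , d≡ = ≈-trans (+-cong (value B₁ c₁ L₁) (value B₂ c₂ L₂)) (≈-trans (≈-sym (distribʳ _ _ _)) (≈-trans (*-congʳ (sg-not ε)) (zeroˡ _)))
        where
        value : ∀ {x ε} → IsB x → (c : Commute x y) → Loc x t s ε → W₁ x ≈ sg ε ⊛ pow (sg δ) s
        value {x} {ε} B c L = ≈-trans (W₁-value B c L (trans (xK c L) h)) (*-congʳ (≈-trans (reflexive (cong (pow (sg ε)) d≡)) (pow-sg-odd ε d′)))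

      -- Taking k + 1 returns in place of one keeps the return sign, as k + 1 is odd, and the
      -- surplus y^(k s) negates J. This makes up for the flipped sign.
      flip-iter : ∀ {x₁ x₂ ε} → Commute x₁ y → Commute x₂ y → Loc x₁ t s ε → Loc x₂ t s (ε xor true) → Y (k * s) ≡ negSP J →
        ∀ u → iter′ x₂ (u * suc k * t) J ≡ iter′ x₁ (u * t) J
      flip-iter {x₁} {x₂} {ε} c₁ c₂ L₁ L₂ h u = trans (loc-iter c₂ L₂ (u * suc k)) (trans (cong₂ negᵇ signs points)
          (trans (negᵇ-negᵇ (mulᵇ u true) (mulᵇ u (ε xor true)) (Y (u * s))) (trans (cong (λ b → negᵇ b (Y (u * s))) signs′) (sym (loc-iter c₁ L₁ u)))))
        where
        signs : mulᵇ (u * suc k) (ε xor true) ≡ mulᵇ u (ε xor true)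
        signs = trans (mulᵇ-* u (suc k) (ε xor true)) (cong (mulᵇ u) (mulᵇ-odd l (ε xor true)))
        signs′ : mulᵇ u true xor mulᵇ u (ε xor true) ≡ mulᵇ u ε
        signs′ = trans (sym (mulᵇ-xor u true (ε xor true))) (cong (mulᵇ u) (lem ε))
          where
          lem : ∀ ε → true xor (ε xor true) ≡ ε
          lem true = refl
          lem false = refl
        mults : ∀ u → Y (u * (k * s)) ≡ negᵇ (mulᵇ u true) J
        mults zero = refl
        mults (suc u) = trans (sym (Y-+ (k * s) (u * (k * s)))) (trans (cong (iter′ y (k * s)) (mults u)) (trans (iter-negᵇ y (k * s) _ J)
          (trans (cong (negᵇ (mulᵇ u true)) (trans h (sym J≡))) (trans (negᵇ-negᵇ true (mulᵇ u true) J) (cong (λ b → negᵇ b J) (Boolₚ.xor-comm true (mulᵇ u true)))))))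
        points : Y (u * suc k * s) ≡ negᵇ (mulᵇ u true) (Y (u * s))
        points = trans (cong Y (l₁ u k s)) (trans (sym (Y-+ (u * s) (u * (k * s)))) (trans (cong (iter′ y (u * s)) (mults u)) (iter-negᵇ y (u * s) _ J)))
          where
          l₁ : ∀ u k s → u * suc k * s ≡ u * s + u * (k * s)
          l₁ = solve-∀

      L₂₁ : Loc x₁ t s ((ε xor true) xor true)
      L₂₁ = subst (Loc x₁ t s) (lem ε) L₁
        where
        lem : ∀ ε → ε ≡ (ε xor true) xor true
        lem true = refl
        lem false = refl

      -- By `flip-iter` the two x-cycles of J meet the y-cycle in the same points and have equal
      -- length, with the exponent u t replaced by u (k + 1) t = u t + u K. The surplus contributes
      -- (-1)^u because x^K negates J, and u is odd.
      W₂-flip : W₂ x₁ ⊕ W₂ x₂ ≈ 0#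
      W₂-flip with Y (k * s) ≟SP negSP J
      ... | no h = zero-sum (W₂-zero B₁ c₁ (λ e → h (trans (sym (xK c₁ L₁)) e))) (W₂-zero B₂ c₂ (λ e → h (trans (sym (xK c₂ L₂)) e)))
      ... | yes h = main
        where
        f₁ = flip-iter c₁ c₂ L₁ L₂ h
        f₂ = flip-iter c₂ c₁ L₂ L₂₁ h
        h₁ : iter′ x₁ K J ≡ negSP J
        h₁ = trans (xK c₁ L₁) h
        h₂ : iter′ x₂ K J ≡ negSP J
        h₂ = trans (xK c₂ L₂) h
        InCyc : ℕ → Set
        InCyc m = ∃ λ r → Y m ≡ iter′ x₁ r J
        inCyc? : ∀ m → Dec (InCyc m)
        inCyc? m with baseOf x₁ J Finₚ.≟ baseOf x₁ (Y m)
        ... | yes e = yes (let r , f = Minus.sameBase⇒cycle B₁ K h₁ (trans (iter-commute c₁ K m J) (trans (cong (iter′ y m) h₁) (iter-neg y m J))) e in r , sym f)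
        ... | no ¬e = no λ { (r , f) → ¬e (sym (baseOf-cycle B₁ J (Y m) r (cong ∣_∣ₚ (sym f)))) }
        inCyc-add : ∀ {a b} → InCyc a → InCyc b → InCyc (a + b)
        inCyc-add {a} {b} (r , f) (r′ , f′) = r′ + r , trans (sym (Y-+ a b)) (trans (cong (iter′ y a) f′) (trans (sym (iter-commute c₁ r′ a J))
          (trans (cong (iter′ x₁ r′) f) (sym (iter-+ x₁ r′ r J)))))
        inCyc-sub : ∀ {a b} → InCyc a → InCyc (a + b) → InCyc b
        inCyc-sub {a} {b} (r , f) (r′ , f′) with iter-return B₁ r (Y b)
        ... | w , g = w + r′ , trans (sym g) (trans (cong (iter′ x₁ w) (trans (iter-commute c₁ r b J) (trans (cong (iter′ y b) (sym f))
              (trans (Y-+ b a) (trans (cong Y (ℕₚ.+-comm b a)) f′))))) (sym (iter-+ x₁ w r′ J)))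
        period = minimalPeriod inCyc? D (s≤s z≤n) (0 , Y-D) (λ {a} {b} → inCyc-add {a} {b}) (λ {a} {b} → inCyc-sub {a} {b})
        m = proj₁ period
        0<m : 0 < m
        0<m = proj₁ (proj₂ period)
        r = proj₁ (proj₁ (proj₂ (proj₂ period)))
        Ym : Y m ≡ iter′ x₁ r J
        Ym = proj₂ (proj₁ (proj₂ (proj₂ period)))
        div : ∀ c → InCyc c → m ∣ c
        div = proj₂ (proj₂ (proj₂ period))
        t∣r : t ∣ r
        t∣r = t-divides L₁ r m (cong ∣_∣ₚ (sym Ym))
        u = _∣_.quotient t∣r
        r≡ : r ≡ u * t
        r≡ = _∣_.equality t∣r
        Ym₁ : Y m ≡ iter′ x₁ (u * t) J
        Ym₁ = trans Ym (cong (λ r → iter′ x₁ r J) r≡)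
        div₂ : ∀ c r′ → Y c ≡ iter′ x₂ r′ J → m ∣ c
        div₂ c r′ f with t-divides L₂ r′ c (cong ∣_∣ₚ (sym f))
        ... | divides u′ refl = div c (u′ * suc k * t , trans f (sym (f₂ u′)))
        fixes : ∀ {x x′} → (∀ c b → ∣ iter′ x c J ∣ₚ ≡ ∣ Y b ∣ₚ → t ∣ c) → (∀ u → iter′ x (u * suc k * t) J ≡ iter′ x′ (u * t) J) →
          ∀ m → iter′ x m J ≡ J → iter′ x′ m J ≡ J
        fixes {x} {x′} td g m e with td m 0 (cong ∣_∣ₚ e)
        ... | divides q refl = trans (sym (g q)) (trans (cong (λ m → iter′ x m J) (l₁ q k t)) (iter-fix x (q * t) e (suc k)))
          where
          l₁ : ∀ q k t → q * suc k * t ≡ suc k * (q * t)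
          l₁ = solve-∀
        len : angle x₂ J ≡ angle x₁ J
        len = angle-len x₂ x₁ J J (cycLenPred-⇔ x₂ x₁ J J (fixes (t-divides L₂) f₁) (fixes (t-divides L₁) f₂))
        A = angle x₁ J
        V : Carrier
        V = pow ζ (u * t * A)
        val₁ : W₂ x₁ ≈ V
        val₁ = W₂-value B₁ c₁ m (u * t) 0<m Ym₁ (λ c r′ f → div c (r′ , f)) h₁
        -- A return sign -1 is absorbed into the power of y, since -J = `Y (k * s)`.
        s₁ : ∃ λ s₁ → negᵇ ε (Y s) ≡ Y s₁
        s₁ = pick ε
          where
          pick : ∀ ε → ∃ λ s₁ → negᵇ ε (Y s) ≡ Y s₁
          pick false = s , negᵇ-false (Y s)
          pick true = s + k * s , trans (sym (iter-negᵇ y s true J)) (trans (cong (iter′ y s) (trans J≡ (sym h))) (Y-+ s (k * s)))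
        Y-mults : ∀ a → Y (a * m) ≡ iter′ x₁ (a * (u * t)) J
        Y-mults zero = refl
        Y-mults (suc a) = trans (sym (Y-+ m (a * m))) (trans (cong (iter′ y m) (Y-mults a)) (trans (sym (iter-commute c₁ (a * (u * t)) m J))
          (trans (cong (iter′ x₁ (a * (u * t))) Ym₁) (trans (iter-comm x₁ (a * (u * t)) (u * t) J) (sym (iter-+ x₁ (u * t) (a * (u * t)) J))))))
        -- The return x₁^t J is some y^(a m) J = x₁^(a u t) J. If u were even, repeating this k
        -- times would give -J = x₁^(k t) J on the left, but J on the right, because x₁^(2 k t)
        -- fixes J.
        u-odd : ∃ λ v → u ≡ suc (v * 2)
        u-odd with parity u
        ... | inj₂ w = w
        ... | inj₁ (v , u≡) with div (proj₁ s₁) (t , trans (sym (proj₂ s₁)) (sym (return L₁)))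
        ... | divides a s₁≡ = ⊥-elim (neg≢ (trans (sym h₁) (trans (cong (λ m → iter′ x₁ m J) K≡) (trans (iter-raise x₁ k {t} {a * (u * t)} step) fixed))))
          where
          step : iter′ x₁ t J ≡ iter′ x₁ (a * (u * t)) J
          step = trans (return L₁) (trans (proj₂ s₁) (trans (cong Y s₁≡) (Y-mults a)))
          l₁ : ∀ k a v t → k * (a * (v * 2 * t)) ≡ a * v * (k * t + k * t)
          l₁ = solve-∀
          twice : iter′ x₁ (k * t + k * t) J ≡ J
          twice = trans (iter-+ x₁ (k * t) (k * t) J) (trans (cong (λ m → iter′ x₁ m (iter′ x₁ m J)) (sym K≡))
            (trans (cong (iter′ x₁ K) h₁) (trans (iter-neg x₁ K J) (trans (cong negSP h₁) (neg-neg J)))))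
          fixed : iter′ x₁ (k * (a * (u * t))) J ≡ J
          fixed = trans (cong (λ u → iter′ x₁ (k * (a * (u * t))) J) u≡) (trans (cong (λ m → iter′ x₁ m J) (l₁ k a v t)) (iter-fix x₁ (k * t + k * t) twice (a * v)))
        val₂ : W₂ x₂ ≈ - V
        val₂ = ≈-trans (W₂-value B₂ c₂ m (u * suc k * t) 0<m (trans Ym₁ (sym (f₁ u))) div₂ h₂)
          (≈-trans (reflexive (cong (pow ζ) (trans (cong (u * suc k * t *_) len) (trans (l₁ u k t A) (cong (λ K → u * t * A + u * (K * A)) (sym K≡))))))
          (≈-trans (pow-+ ζ (u * t * A) (u * (K * A))) (≈-trans (*-congˡ (≈-trans (pow-* ζ u (K * A)) (≈-trans (pow-cong u (minus-angle B₁ K h₁))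
            (≈-trans (reflexive (cong (pow (sg true)) (proj₂ u-odd))) (pow-sg-odd true (proj₁ u-odd)))))) (≈-trans (*-comm _ _) (-1*x≈-x V)))))
          where
          l₁ : ∀ u k t A → u * suc k * t * A ≡ u * t * A + u * (k * t * A)
          l₁ = solve-∀
        main : W₂ x₁ ⊕ W₂ x₂ ≈ 0#
        main = ≈-trans (+-cong val₁ val₂) (-‿inverseʳ V)

  -- The x-cycle of J has length 2bt, which accounts for one factor 2. If -J lies on the y-cycle,
  -- the least power of y on the x-cycle is m/2 instead of m, which accounts for another.
  ρ : Bool → ℕ
  ρ false = 2
  ρ true = 4

  -- Modulo the odd number 2l + 1 the inverse of 2 is l + 1.
  ρ⁻ : Bool → ℕ → ℕ
  ρ⁻ false l = suc l
  ρ⁻ true l = suc l * suc l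

  ρ-inverse : ∀ b l → Cong (suc (l * 2)) (ρ b * ρ⁻ b l) 1
  ρ-inverse false l = mkCong 0 1 (l₁ l)
    where
    l₁ : ∀ l → 2 * (1 + l) + 0 * (1 + l * 2) ≡ 1 + 1 * (1 + l * 2)
    l₁ = solve-∀
  ρ-inverse true l = mkCong 0 (3 + l * 2) (l₁ l)
    where
    l₁ : ∀ l → 4 * ((1 + l) * (1 + l)) + 0 * (1 + l * 2) ≡ 1 + (3 + l * 2) * (1 + l * 2)
    l₁ = solve-∀

  Balanced : W n → Set ℓ
  Balanced x = ∑ (upTo D) (λ a → W₁ (x · e a false) ⊕ W₁ (x · e a true)) ≈ ∑ (upTo D) (λ a → W₂ (x · e a false) ⊕ W₂ (x · e a true))

  module Odd {t l : ℕ} (K≡ : K ≡ suc (l * 2) * t) where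

    k = suc (l * 2)

    xK : ∀ {x s ε} → Commute x y → Loc x t s ε → iter′ x K J ≡ negᵇ ε (Y (k * s))
    xK {x} {s} {ε} c L = trans (cong (λ m → iter′ x m J) K≡) (trans (loc-iter c L k) (cong (λ b → negᵇ b (Y (k * s))) (mulᵇ-odd l ε)))

    Y-neg-mult : ∀ m → Y m ≡ negSP J → ∀ u → Y (u * m) ≡ negᵇ (mulᵇ u true) J
    Y-neg-mult m h zero = refl
    Y-neg-mult m h (suc u) = trans (sym (Y-+ m (u * m))) (trans (cong (iter′ y m) (Y-neg-mult m h u)) (trans (iter-negᵇ y m (mulᵇ u true) J)
      (trans (cong (negᵇ (mulᵇ u true)) (trans h (sym J≡))) (trans (negᵇ-negᵇ true (mulᵇ u true) J) (cong (λ b → negᵇ b J) (Boolₚ.xor-comm true (mulᵇ u true)))))))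

    class⁺-neg : δ ≡ false → ∀ m u → Y m ≡ negᵇ true (Y u) → ⊥
    class⁺-neg e m u h with iter-return By u J
    ... | w , f = class⁺ e (w + m) (trans (sym (Y-+ w m)) (trans (cong (iter′ y w) h) (trans (iter-negᵇ y w true (Y u)) (trans (cong (negᵇ true) f) J≡))))

    module _ {x : W n} (Bx : IsB x) (c : Commute x y) {s : ℕ} (L : Loc x t s true) (D∣ks : D ∣ k * s) where

      xKJ : iter′ x K J ≡ negSP J
      xKJ = trans (xK c L) (trans (cong (negᵇ true) (Y-D∣ (k * s) D∣ks)) J≡)

      module _ (m b b′ a w : ℕ) (D≡ : D ≡ m * b) (s≡ : s ≡ m * a) (b≡ : b ≡ 1 + b′ * 2)
        (b-cancel : ∀ u → b ∣ u * a → b ∣ u) where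

        A B : ℕ
        A = angle x J
        B = angle y J

        0<m : 0 < m
        0<m = positive-factor (sym D≡) (s≤s z≤n)

        mulᵇ-b : mulᵇ b true ≡ true
        mulᵇ-b = trans (cong (λ b → mulᵇ b true) b≡) (mulᵇ-odd b′ true)

        D∣bs : D ∣ b * s
        D∣bs = divides a (trans (cong (b *_) s≡) (trans (l₁ b m a) (cong (a *_) (sym D≡))))
          where
          l₁ : ∀ b m a → b * (m * a) ≡ a * (m * b)
          l₁ = solve-∀

        x-half : iter′ x (b * t) J ≡ negSP J
        x-half = trans (loc-iter c L b) (trans (cong₂ negᵇ mulᵇ-b (Y-D∣ (b * s) D∣bs)) J≡)

        x-full : iter′ x (b * 2 * t) J ≡ J
        x-full = trans (loc-iter c L (b * 2)) (trans (cong₂ negᵇ (mulᵇ-even b true) (Y-D∣ (b * 2 * s) (subst (D ∣_) (l₁ b s) (Div.∣n⇒∣m*n 2 D∣bs)))) (negᵇ-false J))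
          where
          l₁ : ∀ b s → 2 * (b * s) ≡ b * 2 * s
          l₁ = solve-∀

        -- b returns negate J, as b is odd and b s = 0 modulo D, so 2b returns fix J. Conversely, an
        -- even number of returns fixing J is a multiple of b and hence of 2b, and an odd number is
        -- impossible.
        len : cycLen x J ≡ b * 2 * t
        len = Div.∣-antisym (cycLen-divides Bx J (b * 2 * t) x-full) (back (t-divides L (cycLen x J) 0 (cong ∣_∣ₚ fix)))
          where
          fix : iter′ x (cycLen x J) J ≡ J
          fix = iter-cycLen Bx J
          back : t ∣ cycLen x J → b * 2 * t ∣ cycLen x J
          back (divides u u≡) with trans (sym (trans (cong (λ m → iter′ x m J) u≡) (loc-iter c L u))) fix | parity u
          ... | f | inj₁ (v , refl) = subst (b * 2 * t ∣_) (sym u≡) (Div.*-monoˡ-∣ t (odd∣even b′ v b≡ (b-cancel (v * 2)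
                (Div.*-cancelˡ-∣ m {{>-nonZero 0<m}} (subst₂ _∣_ D≡ (trans (cong (v * 2 *_) s≡) (l₁ (v * 2) m a)) (Y-∣ (v * 2 * s)
                  (trans (sym (negᵇ-false (Y (v * 2 * s)))) (trans (cong (λ b → negᵇ b (Y (v * 2 * s))) (sym (mulᵇ-even v true))) f))))))))
            where
            l₁ : ∀ u m a → u * (m * a) ≡ m * (u * a)
            l₁ = solve-∀
          -- An odd number u′ of returns fixing J would give y^(u′ s) J = -J. Repeating this b
          -- times, b odd, gives -J again, although D divides b s.
          ... | f | inj₂ (v , refl) = ⊥-elim (neg≢ (trans (sym (trans (Y-neg-mult (u′ * s) Yus b) (trans (cong (λ β → negᵇ β J) mulᵇ-b) J≡))) (Y-D∣ (b * (u′ * s)) (subst (D ∣_) (l₁ u′ b s) (Div.∣n⇒∣m*n u′ D∣bs)))))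
            where
            u′ = suc (v * 2)
            l₁ : ∀ u b s → u * (b * s) ≡ b * (u * s)
            l₁ = solve-∀
            Yus : Y (u′ * s) ≡ negSP J
            Yus = trans (sym (negᵇ-false (Y (u′ * s)))) (trans (sym (negᵇ-negᵇ true true (Y (u′ * s)))) (trans (cong (negᵇ true)
              (trans (cong (λ β → negᵇ β (Y (u′ * s))) (sym (mulᵇ-odd v true))) f)) J≡))

        -- Both sides times b equal N, the cycle lengths being 2bt for x and mb for y.
        angles : A * (2 * t) ≡ B * m
        angles = ℕₚ.*-cancelʳ-≡ (A * (2 * t)) (B * m) b {{>-nonZero 0<b}} (trans (l₁ A t b) (trans (cong (A *_) (sym len)) (trans (angle-* Bx J)
          (trans (sym (angle-* By J)) (trans (cong (B *_) D≡) (sym (ℕₚ.*-assoc B m b)))))))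
          where
          0<b : 0 < b
          0<b = subst (0 <_) (sym b≡) (s≤s z≤n)
          l₁ : ∀ A t b → A * (2 * t) * b ≡ A * (b * 2 * t)
          l₁ = solve-∀

        pow-dual : pow ζ (w * 2 * t * A) ≈ pow Z (m * w)
        pow-dual = ≈-trans (reflexive (cong (pow ζ) (trans (l₁ w t A) (trans (cong (w *_) angles) (l₂ w B m))))) (pow-* ζ (m * w) B)
          where
          l₁ : ∀ w t A → w * 2 * t * A ≡ w * (A * (2 * t))
          l₁ = solve-∀
          l₂ : ∀ w B m → w * (B * m) ≡ m * w * B
          l₂ = solve-∀

        hit : ∀ c′ r′ → Y c′ ≡ iter′ x r′ J → ∃ λ u → Y c′ ≡ negᵇ (mulᵇ u true) (Y (u * s))
        hit c′ r′ f with t-divides L r′ c′ (cong ∣_∣ₚ (sym f))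
        ... | divides u refl = u , trans f (loc-iter c L u)

        -- 2w s = m (2 a w) is m modulo D = m b, so 2w returns carry J to y^m J, without a sign
        -- because their number is even. As -J is off the y-cycle, only returns of total sign +
        -- yield powers of y, and m divides all of these.
        dual⁺ : δ ≡ false → Cong b (2 * (a * w)) 1 → W₂ x ≈ pow Z (m * w)
        dual⁺ e inv = ≈-trans (W₂-value Bx c m (w * 2 * t) 0<m Ym div xKJ) pow-dual
          where
          l₁ : ∀ w m a → w * 2 * (m * a) ≡ m * (2 * (a * w))
          l₁ = solve-∀
          Ym : Y m ≡ iter′ x (w * 2 * t) J
          Ym = trans (Y-cong {m} {w * 2 * s} (subst₂ (λ D′ s′ → Cong D′ m (w * 2 * s′)) (sym D≡) (sym s≡)
              (cong-trans (cong-refl (sym (ℕₚ.*-identityʳ m))) (cong-trans (cong-sym (cong-scale m inv)) (cong-refl (sym (l₁ w m a)))))))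
            (sym (trans (loc-iter c L (w * 2)) (trans (cong (λ β → negᵇ β (Y (w * 2 * s))) (mulᵇ-even w true)) (negᵇ-false (Y (w * 2 * s))))))
          m∣D : m ∣ D
          m∣D = divides b (trans D≡ (ℕₚ.*-comm m b))
          m∣s : m ∣ s
          m∣s = divides a (trans s≡ (ℕₚ.*-comm m a))
          div : ∀ c′ r′ → Y c′ ≡ iter′ x r′ J → m ∣ c′
          div c′ r′ f with hit c′ r′ f
          ... | u , g with mulᵇ u true
          ... | false = cong-∣-resp m∣D (Y-cong⁻ {c′} {u * s} (trans g (negᵇ-false (Y (u * s))))) (Div.∣n⇒∣m*n u m∣s)
          ... | true = ⊥-elim (class⁺-neg e c′ (u * s) g)

        -- From m b = D = 2d and b odd, m = 2m′. A sign -1 of the returns now equals a factor y^d,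
        -- which brings y^m′ J onto the x-cycle, after 2w + b returns. The b extra returns take b t
        -- steps, which negate J and so multiply the weight by -1.
        dual⁻ : δ ≡ true → Cong b (4 * (a * w)) 1 → W₂ x ≈ - pow Z (m * w)
        dual⁻ e inv with even-factor m b′ d (trans (cong (m *_) (sym b≡)) (trans (sym D≡) (D≡2d e)))
        ... | m′ , m≡ = ≈-trans (W₂-value Bx c m′ ((w * 2 + b) * t) 0<m′ Ym div xKJ)
            (≈-trans (reflexive (cong (pow ζ) (l₀ w b t A))) (≈-trans (pow-+ ζ (w * 2 * t * A) (b * t * A))
            (≈-trans (*-cong pow-dual (minus-angle Bx (b * t) x-half)) (≈-trans (*-comm _ _) (-1*x≈-x _)))))
          where
          l₀ : ∀ w b t A → (w * 2 + b) * t * A ≡ w * 2 * t * A + b * t * A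
          l₀ = solve-∀
          0<m′ : 0 < m′
          0<m′ = positive-factor (sym m≡) 0<m
          d≡ : d ≡ m′ * b
          d≡ = ℕₚ.*-cancelʳ-≡ d (m′ * b) 2 (trans (sym (D≡2d e)) (trans D≡ (trans (cong (_* b) m≡) (l₁ m′ b))))
            where
            l₁ : ∀ m′ b → m′ * 2 * b ≡ m′ * b * 2
            l₁ = solve-∀
          D≡′ : D ≡ m′ * (b * 2)
          D≡′ = trans (D≡2d e) (trans (cong (_* 2) d≡) (ℕₚ.*-assoc m′ b 2))
          X = (w * 2 + b) * s
          X≡ : m′ * ((2 * (a * w)) * 2 + b + a * (b * 2)) ≡ X + d
          X≡ = sym (trans (cong₂ (λ s d → (w * 2 + b) * s + d) (trans s≡ (cong (_* a) m≡)) d≡) (l₁ w b m′ a))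
            where
            l₁ : ∀ w b m′ a → (w * 2 + b) * (m′ * 2 * a) + m′ * b ≡ m′ * ((2 * (a * w)) * 2 + b + a * (b * 2))
            l₁ = solve-∀
          -- After division by m′ the exponent X + d has to be 1 modulo 2b. Modulo b it is so by the
          -- choice of w, and the odd number b supplies the parity.
          lifted : Cong (b * 2) (2 * (a * w) * 2 + b + a * (b * 2)) (1 + 0)
          lifted = cong-+ (cong-lift b′ (2 * (a * w)) b≡ (cong-trans (cong-refl (l₁ (a * w))) inv)) (∣⇒cong-0 (Div.n∣m*n a))
            where
            l₁ : ∀ p → 2 * p * 2 ≡ 4 * p
            l₁ = solve-∀
          Ym : Y m′ ≡ iter′ x ((w * 2 + b) * t) J
          Ym = trans (Y-cong {m′} {X + d} (subst (λ D′ → Cong D′ m′ (X + d)) (sym D≡′)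
                (cong-trans (cong-refl (sym (ℕₚ.*-identityʳ m′))) (cong-trans (cong-sym (cong-scale m′ lifted)) (cong-refl X≡)))))
            (trans (Y-shift⁻ e X) (sym (trans (loc-iter c L (w * 2 + b)) (cong (λ β → negᵇ β (Y X))
              (trans (mulᵇ-+ (w * 2) b true) (trans (cong (_xor mulᵇ b true) (mulᵇ-even w true)) mulᵇ-b))))))
          m′∣D : m′ ∣ D
          m′∣D = divides (b * 2) (trans D≡′ (ℕₚ.*-comm m′ (b * 2)))
          m′∣s : m′ ∣ s
          m′∣s = divides (2 * a) (trans s≡ (trans (cong (_* a) m≡) (l₁ m′ a)))
            where
            l₁ : ∀ m′ a → m′ * 2 * a ≡ 2 * a * m′
            l₁ = solve-∀
          m′∣d : m′ ∣ d
          m′∣d = divides b (trans d≡ (ℕₚ.*-comm m′ b))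
          div : ∀ c′ r′ → Y c′ ≡ iter′ x r′ J → m′ ∣ c′
          div c′ r′ f with hit c′ r′ f
          ... | u , g with mulᵇ u true
          ... | false = cong-∣-resp m′∣D (Y-cong⁻ {c′} {u * s} (trans g (negᵇ-false (Y (u * s))))) (Div.∣n⇒∣m*n u m′∣s)
          ... | true = cong-∣-resp m′∣D (Y-cong⁻ {c′} {u * s + d} (trans g (sym (Y-shift⁻ e (u * s))))) (Div.∣m∣n⇒∣m+n (Div.∣n⇒∣m*n u m′∣s) m′∣d)

      W₂-dual : ∀ {s*} → Dual D (ρ δ) s s* → W₂ x ≈ sg δ ⊛ pow Z s*
      W₂-dual dd@(mkDual m b a w D≡ s≡ refl _ _ inv) with dual-index∣ k (s≤s z≤n) dd D∣ks
      -- The order b of s divides the odd number k, so b is odd.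
      ... | divides q k≡ with odd-factorʳ q b l (sym k≡)
      ... | b′ , b≡ = by-class δ refl
        where
        b-cancel : ∀ u → b ∣ u * a → b ∣ u
        b-cancel u h = cong-0⇒∣ (cong-trans (cong-refl (sym (ℕₚ.*-identityʳ u))) (cong-trans (cong-* (cong-refl {a = u} refl) (cong-sym inv))
          (cong-trans (cong-refl (l₁ u (ρ δ) a w)) (cong-* {a = u * a} (∣⇒cong-0 h) (cong-refl {a = ρ δ * w} refl)))))
          where
          l₁ : ∀ u r a w → u * (r * (a * w)) ≡ u * a * (r * w)
          l₁ = solve-∀
        by-class : ∀ β → δ ≡ β → W₂ x ≈ sg δ ⊛ pow Z (m * w)
        by-class false e = ≈-trans (dual⁺ m b b′ a w D≡ s≡ b≡ b-cancel e (subst (λ β → Cong b (ρ β * (a * w)) 1) e inv))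
          (≈-trans (≈-sym (*-identityˡ _)) (*-congʳ (reflexive (cong sg (sym e)))))
        by-class true e = ≈-trans (dual⁻ m b b′ a w D≡ s≡ b≡ b-cancel e (subst (λ β → Cong b (ρ β * (a * w)) 1) e inv))
          (≈-trans (≈-sym (-1*x≈-x _)) (*-congʳ (reflexive (cong sg (sym e)))))

    open Dualisation {D} {k} {ρ δ} {ρ⁻ δ l} (s≤s z≤n) (ρ-inverse δ l) using (dual; dual-spec)

    c₀ c₁ : ℕ → Bool
    c₀ s = eqSP (Y (k * s)) J
    c₁ s = eqSP (Y (k * s)) (Y 1)

    -- The two weights as functions of the return exponent s, `W₁` for return sign + and `W₂` for
    -- return sign -. The remainder `s % D` is there because return exponents are not reduced.
    S₁ S₂ : ℕ → Carrier
    S₁ s = sg δ ⊛ ind (c₁ s)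
    S₂ s = sg δ ⊛ (if c₀ s then pow Z (dual (s % D)) else 0#)

    c₀-true : ∀ s → c₀ s ≡ true → D ∣ k * s
    c₀-true s h = Y-∣ (k * s) (eqSP-true h)

    true-c₀ : ∀ s → D ∣ k * s → c₀ s ≡ true
    true-c₀ s h = true-eqSP (Y-D∣ (k * s) h)

    Y-% : ∀ s → Y s ≡ Y (s % D)
    Y-% s = Y-cong {s} {s % D} (cong-mod s)

    module _ {x : W n} (Bx : IsB x) (c : Commute x y) where

      W₂-S₂ : ∀ {s} → Loc x t s true → W₂ x ≈ S₂ s
      W₂-S₂ {s} L with c₀ s in eq
      ... | false = ≈-trans (W₂-zero Bx c (λ h → true≢false (true-eqSP (unneg (trans (sym (xK c L)) h))) eq)) (≈-sym (zeroʳ _))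
        where
        unneg : negᵇ true (Y (k * s)) ≡ negSP J → Y (k * s) ≡ J
        unneg h = trans (sym (neg-neg (Y (k * s)))) (trans (cong negSP (trans (sym (negᵇ-true (Y (k * s)))) h)) (neg-neg J))
      ... | true = W₂-dual Bx c L′ D∣ (dual-spec (s % D) (DivMod.m%n<n s D) D∣)
        where
        L′ : Loc x t (s % D) true
        L′ = mkLoc (t>0 L) (trans (return L) (cong (negᵇ true) (Y-% s))) (t-divides L)
        D∣ : D ∣ k * (s % D)
        D∣ = cong-0⇒∣ (cong-trans (cong-* (cong-refl {a = k} refl) (cong-sym (cong-mod s))) (∣⇒cong-0 (c₀-true s eq)))

      W₁-S₁ : ∀ {s} → Loc x t s false → W₁ x ≈ S₁ s
      W₁-S₁ {s} L with c₁ s in eq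
      ... | false = ≈-trans (W₁-zero Bx c (λ h → true≢false (true-eqSP (trans (sym (trans (xK c L) (negᵇ-false (Y (k * s))))) h)) eq)) (≈-sym (zeroʳ _))
      ... | true = ≈-trans (W₁-value Bx c L (trans (xK c L) (trans (negᵇ-false (Y (k * s))) (eqSP-true eq))))
            (≈-trans (*-congʳ (pow-one d ≈-refl)) (≈-trans (*-identityˡ _) (≈-trans (sign δ refl) (≈-sym (*-identityʳ _)))))
        where
        sign : ∀ β → δ ≡ β → pow (sg δ) s ≈ sg δ
        sign false e = ≈-trans (pow-one s (reflexive (cong sg e))) (reflexive (cong sg (sym e)))
        -- In class -1 the length D = 2d is even, so k s = 1 modulo D makes s odd.
        sign true e with parity s
        ... | inj₂ (v , refl) = pow-sg-odd δ v
        ... | inj₁ (v , refl) = ⊥-elim (ℕₚ.<⇒≱ (s≤s (s≤s z≤n)) (Div.∣⇒≤ (cong-∣-resp {e = 2} (divides d (D≡2d e)) (cong-sym (Y-cong⁻ {k * (v * 2)} {1} (eqSP-true eq)))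
              (divides (k * v) (sym (ℕₚ.*-assoc k v 2))))))

    S-sum : ∑ (upTo D) S₁ ≈ ∑ (upTo D) S₂
    S-sum = ≈-trans (≈-sym (∑-*ˡ (upTo D) (sg δ) (λ s → ind (c₁ s)))) (≈-trans (*-congˡ (≈-trans
        (count-inverse (s≤s z≤n) Z Zᴰ Z-order k c₀ c₁ c₀-true true-c₀ (λ s h → Y-cong⁻ {k * s} {1} (eqSP-true h)) (λ s h → true-eqSP (Y-cong {k * s} {1} h)))
        (≈-trans (≈-sym (dual-sum (s≤s z≤n) Z Zᴰ Z-order k (ρ δ) (ρ⁻ δ l) (ρ-inverse δ l) c₀ c₀-true true-c₀))
          (Sum.bigop-cong (upTo D) (λ {s} s∈ → reflexive (cong (λ r → if c₀ s then pow Z (dual r) else 0#) (sym (DivMod.m<n⇒m%n≡m (∈-upTo⁻ s∈)))))))))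
      (∑-*ˡ (upTo D) (sg δ) _))

    Y-periodic : ∀ i → Y (k * (i + D)) ≡ Y (k * i)
    Y-periodic i = Y-cong {k * (i + D)} {k * i} (mkCong 0 k (l₁ k i D))
      where
      l₁ : ∀ k i D → k * (i + D) + 0 * D ≡ k * i + k * D
      l₁ = solve-∀

    S₁-periodic : ∀ i → S₁ (i + D) ≈ S₁ i
    S₁-periodic i = reflexive (cong (λ p → sg δ ⊛ ind (eqSP p (Y 1))) (Y-periodic i))

    S₂-periodic : ∀ i → S₂ (i + D) ≈ S₂ i
    S₂-periodic i = reflexive (cong₂ (λ p r → sg δ ⊛ (if eqSP p J then pow Z (dual r) else 0#)) (Y-periodic i) (DivMod.[m+n]%n≡m%n i D))

    S₁-shift : ∀ s → ∑ (upTo D) (λ a → S₁ (s + a)) ≈ ∑ (upTo D) S₁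
    S₁-shift s = ≈-trans (Sum.bigop-cong (upTo D) (λ {a} _ → reflexive (cong S₁ (ℕₚ.+-comm s a)))) (Sum.bigop-upTo-shift D S₁ S₁-periodic s)

    S₂-shift : ∀ s → ∑ (upTo D) (λ a → S₂ (s + a)) ≈ ∑ (upTo D) S₂
    S₂-shift s = ≈-trans (Sum.bigop-cong (upTo D) (λ {a} _ → reflexive (cong S₂ (ℕₚ.+-comm s a)))) (Sum.bigop-upTo-shift D S₂ S₂-periodic s)

    -- If -J is off the y-cycle, return sign + counts only for `W₁` and return sign - only for `W₂`,
    -- and each pair of translates has one of each. If -J = Y d, a sign is a shift of s by d, so
    -- both members of the pair contribute a full sum over Z/D.
    odd-sum : ∀ {x} → IsB x → Commute x y → ∀ {s ε} → Loc x t s ε →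
      Balanced x
    odd-sum {x} Bx c {s} {ε} L = by-class δ refl
      where
      L′ = loc-shift c L
      B′ : ∀ a b → IsB (x · e a b)
      B′ a b = IsB-· Bx (IsB-e a b)
      c′ : ∀ a b → Commute (x · e a b) y
      c′ a b = commute-· c (e-commute a b)
      flips : ∀ (f : Bool → Carrier) u → f (u xor false) ⊕ f (u xor true) ≈ f false ⊕ f true
      flips f false = ≈-refl
      flips f true = +-comm _ _
      by-class : ∀ β → δ ≡ β → Balanced x
      by-class false h = ≈-trans (Sum.bigop-cong (upTo D) (λ {a} _ → ≈-trans (+-cong (w₁ a false) (w₁ a true)) (≈-trans (flips (f₁ (s + a)) ε) (+-identityʳ _))))
        (≈-trans (S₁-shift s) (≈-trans S-sum (≈-trans (≈-sym (S₂-shift s))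
          (≈-sym (Sum.bigop-cong (upTo D) (λ {a} _ → ≈-trans (+-cong (w₂ a false) (w₂ a true)) (≈-trans (flips (f₂ (s + a)) ε) (+-identityˡ _))))))))
        where
        f₁ f₂ : ℕ → Bool → Carrier
        f₁ s b = if b then 0# else S₁ s
        f₂ s b = if b then S₂ s else 0#
        v₁ : ∀ {x s b} → IsB x → Commute x y → Loc x t s b → W₁ x ≈ f₁ s b
        v₁ {b = false} B c L = W₁-S₁ B c L
        v₁ {s = s} {true} B c L = W₁-zero B c (λ f → class⁺-neg h 1 (k * s) (trans (sym f) (xK c L)))
        v₂ : ∀ {x s b} → IsB x → Commute x y → Loc x t s b → W₂ x ≈ f₂ s b
        v₂ {b = true} B c L = W₂-S₂ B c L
        v₂ {s = s} {false} B c L = W₂-zero B c (λ f → class⁺ h (k * s) (trans (sym (negᵇ-false (Y (k * s)))) (trans (sym (xK c L)) f)))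
        w₁ : ∀ a b → W₁ (x · e a b) ≈ f₁ (s + a) (ε xor b)
        w₁ a b = v₁ (B′ a b) (c′ a b) (L′ a b)
        w₂ : ∀ a b → W₂ (x · e a b) ≈ f₂ (s + a) (ε xor b)
        w₂ a b = v₂ (B′ a b) (c′ a b) (L′ a b)
      by-class true h = ≈-trans (Sum.bigop-∙ (upTo D) _ _) (≈-trans (+-cong (sum₁ false) (sum₁ true)) (≈-trans (+-cong S-sum S-sum)
          (≈-trans (≈-sym (+-cong (sum₂ false) (sum₂ true))) (≈-sym (Sum.bigop-∙ (upTo D) _ _)))))
        where
        o₁ o₂ : Bool → ℕ
        o₁ b = if b then d else 0
        o₂ b = if b then 0 else d
        v₁ : ∀ {x s b} → IsB x → Commute x y → Loc x t s b → W₁ x ≈ S₁ (o₁ b + s)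
        v₁ {b = false} B c L = W₁-S₁ B c L
        v₁ {s = s} {true} B c L = W₁-S₁ B c {d + s} (mkLoc (t>0 L) (trans (return L) (trans (sym (Y-shift⁻ h s)) (trans (cong Y (ℕₚ.+-comm s d)) (sym (negᵇ-false (Y (d + s))))))) (t-divides L))
        v₂ : ∀ {x s b} → IsB x → Commute x y → Loc x t s b → W₂ x ≈ S₂ (o₂ b + s)
        v₂ {b = true} B c L = W₂-S₂ B c L
        v₂ {s = s} {false} B c L = W₂-S₂ B c {d + s} (mkLoc (t>0 L) (trans (return L) (trans (sym (negᵇ-negᵇ true true (Y s))) (trans (cong (negᵇ true) (sym (Y-shift⁻ h s))) (cong (negᵇ true ∘ Y) (ℕₚ.+-comm s d))))) (t-divides L))
        sum₁ : ∀ b → ∑ (upTo D) (λ a → W₁ (x · e a b)) ≈ ∑ (upTo D) S₁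
        sum₁ b = ≈-trans (Sum.bigop-cong (upTo D) (λ {a} _ → ≈-trans (v₁ (B′ a b) (c′ a b) (L′ a b)) (reflexive (cong S₁ (sym (ℕₚ.+-assoc (o₁ (ε xor b)) s a))))))
          (S₁-shift (o₁ (ε xor b) + s))
        sum₂ : ∀ b → ∑ (upTo D) (λ a → W₂ (x · e a b)) ≈ ∑ (upTo D) S₂
        sum₂ b = ≈-trans (Sum.bigop-cong (upTo D) (λ {a} _ → ≈-trans (v₂ (B′ a b) (c′ a b) (L′ a b)) (reflexive (cong S₂ (sym (ℕₚ.+-assoc (o₂ (ε xor b)) s a))))))
          (S₂-shift (o₂ (ε xor b) + s))

  -- y J and -J lie on the y-cycle of J up to sign, so both weights vanish unless t divides K;
  -- otherwise the parity of K/t decides between the two cases.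
  local-sum : ∀ {x} → IsB x → Commute x y →
    Balanced x
  local-sum {x} Bx c with loc c Bx
  ... | t , s , ε , L = go (t ∣? K)
    where
    L′ = loc-shift c L
    B′ : ∀ a b → IsB (x · e a b)
    B′ a b = IsB-· Bx (IsB-e a b)
    c′ : ∀ a b → Commute (x · e a b) y
    c′ a b = commute-· c (e-commute a b)
    xor-false : ∀ b → (b xor false) xor true ≡ b xor true
    xor-false b = cong (_xor true) (Boolₚ.xor-identityʳ b)
    go : Dec (t ∣ K) → Balanced x
    go (no h) = ≈-trans (Sum.bigop-ε (upTo D) (λ {a} _ → zero-sum (z₁ a false) (z₁ a true)))
        (≈-sym (Sum.bigop-ε (upTo D) (λ {a} _ → zero-sum (z₂ a false) (z₂ a true))))
      where
      z₁ : ∀ a b → W₁ (x · e a b) ≈ 0#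
      z₁ a b = W₁-zero (B′ a b) (c′ a b) (λ f → h (hit-y (L′ a b) f))
      z₂ : ∀ a b → W₂ (x · e a b) ≈ 0#
      z₂ a b = W₂-zero (B′ a b) (c′ a b) (λ f → h (hit-neg (L′ a b) f))
    go (yes (divides k K≡)) with parity k
    ... | inj₂ (l , refl) = Odd.odd-sum {l = l} K≡ Bx c L
    ... | inj₁ (l , refl) = ≈-trans
        (Sum.bigop-ε (upTo D) (λ {a} _ → Even.W₁-flip {l = l} K≡ (B′ a false) (B′ a true) (c′ a false) (c′ a true) (L′ a false) (subst (Loc (x · e a true) t (s + a)) (sym (xor-false ε)) (L′ a true))))
        (≈-sym (Sum.bigop-ε (upTo D) (λ {a} _ → Even.W₂-flip {l = l} K≡ (B′ a false) (B′ a true) (c′ a false) (c′ a true) (L′ a false) (subst (Loc (x · e a true) t (s + a)) (sym (xor-false ε)) (L′ a true)))))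

-- From orbits to the whole group

filterᵇ-cong : ∀ {a} {A : Set a} {p q : A → Bool} → (∀ x → p x ≡ q x) → ∀ xs → filterᵇ p xs ≡ filterᵇ q xs
filterᵇ-cong h [] = refl
filterᵇ-cong {q = q} h (x ∷ xs) rewrite h x with q x
... | true = cong (x ∷_) (filterᵇ-cong h xs)
... | false = filterᵇ-cong h xs

all-false : ∀ {a} {A : Set a} (p : A → Bool) xs → all p xs ≡ false → ∃ λ x → x ∈ xs × p x ≡ false
all-false p (x ∷ xs) h with p x in eq
... | false = x , here refl , eq
... | true with all-false p xs h
...   | z , z∈ , pz = z , there z∈ , pz

commute-inv : ∀ {n} {w y : W n} → IsB w → Commute w y → Commute (inv w) y
commute-inv {w = w} {y} B c = mkC λ p → act-inj B (trans (act-inv B _) (sym (trans (commutes c _) (cong (act y) (act-inv B p)))))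

module Hybrid {c ℓ : Level} (R : CommutativeRing c ℓ)
  (domain : IsDomain R) (char0 : CharZero R)
  (n : ℕ) (ζ : CommutativeRing.Carrier R)
  (ζᴺ : IsRoot R n ζ) (prim : IsPrimitive R n ζ)
  (K : ℕ) {y : W n} (By : IsB y) where

  open CommutativeRing R renaming (_+_ to _⊕_; _*_ to _⊛_; refl to ≈-refl; sym to ≈-sym; trans to ≈-trans)
  open RingSums R
  open Domain domain char0
  open Angles R n ζ ζᴺ
  open Weights R n ζ ζᴺ K By

  Zy : List (W n)
  Zy = filterᵇ (λ x → inZ x y) (Bn n)

  Zy-unique : Unique Zy
  Zy-unique = filterᵇ-unique _ (Bn-unique n)

  ∈-Zy : ∀ {x} → IsB x → Commute x y → x ∈ Zy
  ∈-Zy B c = ∈-filterᵇ⁺ (λ x → inZ x y) (Bn n) (∈-Bn B) (true-inZ c)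

  ∈-Zy⁻ : ∀ {x} → x ∈ Zy → IsB x × Commute x y
  ∈-Zy⁻ {x} m with ∈-filterᵇ⁻ (λ x → inZ x y) (Bn n) m
  ... | x∈ , h = ∈-Bn⁻ x∈ , inZ-true h

  Low : W n → ℕ → Fin n → Set
  Low x m i = ∃ λ i′ → toℕ i′ < m × Orb x y i i′

  opaque
    low : W n → ℕ → Fin n → Bool
    low x m i = any (λ i′ → (toℕ i′ <ᵇ m) ∧ orb x y i i′) (allFin n)

    low-true : ∀ x m i → low x m i ≡ true → Low x m i
    low-true x m i h with any-true (λ i′ → (toℕ i′ <ᵇ m) ∧ orb x y i i′) (allFin n) h
    ... | i′ , _ , h′ with ∧-true {toℕ i′ <ᵇ m} h′
    ... | lt , o = i′ , ℕₚ.<ᵇ⇒< (toℕ i′) m (subst T (sym lt) tt) , orb-true o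

    true-low : ∀ {x m i} → IsB x → Low x m i → low x m i ≡ true
    true-low {x} {m} {i} B (i′ , lt , o) = true-any (λ i′ → (toℕ i′ <ᵇ m) ∧ orb x y i i′) (allFin n) (Memₚ.∈-allFin i′)
      (cong₂ _∧_ (T⇒true (ℕₚ.<⇒<ᵇ lt)) (true-orb B By o))

    low-cong : ∀ {x x′} → (∀ i i′ → orb x′ y i i′ ≡ orb x y i i′) → ∀ m i → low x′ m i ≡ low x m i
    low-cong h m i = any-cong (λ i′ → cong ((toℕ i′ <ᵇ m) ∧_) (h i i′)) (allFin n)

  weight : W n → ℕ → Fin n → Carrier
  weight x m i = if low x m i then a₁ x i else a₂ x i

  -- Orbits of ⟨x, y⟩ meeting {0,…,m−1} carry the weight of sroots, the others that of ψ.
  hybrid : ℕ → W n → Carrier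
  hybrid m x = ∏ (allFin n) (weight x m)

  module Step (j : Fin n) where
    open AtPoint By j
    open Local j
    open LocalIdentity R domain char0 n ζ ζᴺ prim K By j using (local-sum)

    J₀ = toℕ j

    translate : ∀ m a b → ∑ Zy (λ x → hybrid m (x · e a b)) ≈ ∑ Zy (hybrid m)
    translate m a b = Sum.bigop-reindex (λ x → x · e a b) (hybrid m) Zy-unique Zy-unique into (λ _ _ → cancel) onto
      where
      B = IsB-e a b
      into : ∀ {x} → x ∈ Zy → x · e a b ∈ Zy
      into x∈ with ∈-Zy⁻ x∈
      ... | Bx , c = ∈-Zy (IsB-· Bx B) (commute-· c (e-commute a b))
      cancel : ∀ {x x′} → x · e a b ≡ x′ · e a b → x ≡ x′
      cancel {x} {x′} h = W-ext λ p → trans (back x p) (trans (cong (λ w → act w (act (inv (e a b)) p)) h) (sym (back x′ p)))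
        where
        back : ∀ x p → act x p ≡ act (x · e a b) (act (inv (e a b)) p)
        back x p = sym (trans (act-· x (e a b) _) (cong (act x) (act-inv B p)))
      onto : ∀ {z} → z ∈ Zy → ∃ λ x → x ∈ Zy × x · e a b ≡ z
      onto {z} z∈ with ∈-Zy⁻ z∈
      ... | Bz , c = z · inv (e a b) , ∈-Zy (IsB-· Bz (IsB-inv B)) (commute-· c (commute-inv B (e-commute a b))) ,
            W-ext λ p → trans (act-· (z · inv (e a b)) (e a b) p) (trans (act-· z (inv (e a b)) _) (cong (act z) (inv-act B p)))

    module _ {x : W n} (Bx : IsB x) (c : Commute x y) where

      module _ (a : ℕ) (b : Bool) where

        x′ = x · e a b

        Bx′ : IsB x′
        Bx′ = IsB-· Bx (IsB-e a b)

        c′ : Commute x′ y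
        c′ = commute-· c (e-commute a b)

        orb≡ : ∀ i i′ → orb x′ y i i′ ≡ orb x y i i′
        orb≡ i i′ = ⇔⇒≡ᵇ (λ h → true-orb Bx By (twist-orb c (twist-e x a b) (orb-true h)))
          (λ h → true-orb Bx′ By (twist-orb c′ (twist-e⁻ x a b) (orb-true h)))

        low≡ : ∀ m i → low x′ m i ≡ low x m i
        low≡ m i = low-cong orb≡ m i

        -- `e a b` moves only points of the y-cycle of J, which a path starting outside the orbit
        -- never meets.
        off-iter : ∀ m p → ¬ Orb x y j ∣ p ∣ₚ → iter′ x′ m p ≡ iter′ x m p
        off-iter zero p h = refl
        off-iter (suc m) p h = trans (act-· x (e a b) _) (cong (act x) (trans (cong (act (e a b)) (off-iter m p h))
          (e-off a b (iter′ x m p) (≢true⇒false λ on → h (reach (onY-true on))))))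
          where
          reach : (∃ λ u → ∣ Y u ∣ₚ ≡ ∣ iter′ x m p ∣ₚ) → Orb x y j ∣ p ∣ₚ
          reach (u , f) with iter-return-abs Bx m p (Y u) (sym f)
          ... | v , g = v , u , sym g

        off-iter₀ : ∀ p → ¬ Orb x y j ∣ p ∣ₚ → ∀ m → iter x′ m p ≡ iter x m p
        off-iter₀ p h m = trans (sym (iter′≡iter x′ m p)) (trans (off-iter m p h) (iter′≡iter x m p))

        off-a₁ : ∀ i → ¬ Orb x y j i → a₁ x′ i ≡ a₁ x i
        off-a₁ i h = cong₂ (λ p q → if eqSP p (act y (pt i)) then σ q else 0#) (off-iter K (pt i) h) (off-iter 1 (pt i) h)

        off-θ : ∀ q → ¬ Orb x y j ∣ q ∣ₚ → θ x′ q ≡ θ x q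
        off-θ q h = cong₂ (λ u v → pow ζ (u * v)) (dlog-cong x′ x q (off-iter₀ q h) (λ m → off-iter₀ (pt (baseOf x′ q)) base-off m))
            (angle-len x′ x q q (cycLenPred-cong x′ x q q (λ m → cong (λ p → eqSP p q) (off-iter₀ q h (suc m)))))
          where
          base-off : ¬ Orb x y j (baseOf x′ q)
          base-off o with baseOf-spec Bx q
          ... | (m , f) , _ = h (orb-trans c (subst (Orb x y j) (baseOf-cong x′ x q (off-iter₀ q h)) o)
                (orb-sym Bx By c (m , 0 , trans (iter-abs-cong x m refl) f)))

        off-a₂ : ∀ i → ¬ Orb x y j i → a₂ x′ i ≡ a₂ x i
        off-a₂ i h = trans (cong (λ p → if eqSP p (negSP (pt i)) then (if isBase x′ i then θ x′ (act y (pt i)) else 1#) else 0#) (off-iter K (pt i) h))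
          (cong₂ (λ B t → if eqSP (iter′ x K (pt i)) (negSP (pt i)) then (if B then t else 1#) else 0#) (isBase-cong x′ x i (off-iter₀ (pt i) h)) (off-θ (act y (pt i)) y-off))
          where
          y-off : ¬ Orb x y j ∣ act y (pt i) ∣ₚ
          y-off o = h (orb-trans c o (orb-sym Bx By c (0 , 1 , refl)))

      -- The orbit of j already meets the indices below j, so admitting j changes the status of no
      -- orbit.
      settled : low x J₀ j ≡ true → ∀ a b → hybrid J₀ (x · e a b) ≈ hybrid (suc J₀) (x · e a b)
      settled h a b = Prod.bigop-cong (allFin n) (λ {i} _ → reflexive (cong (λ B → if B then a₁ z i else a₂ z i) (⇔⇒≡ᵇ (up i) (down i))))
        where
        z = x · e a b
        Bz = Bx′ a b
        up : ∀ i → low z J₀ i ≡ true → low z (suc J₀) i ≡ true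
        up i g with low-true z J₀ i g
        ... | i′ , lt , o = true-low Bz (i′ , ℕₚ.m<n⇒m<1+n lt , o)
        down : ∀ i → low z (suc J₀) i ≡ true → low z J₀ i ≡ true
        down i g with low-true z (suc J₀) i g
        ... | i′ , s≤s le , o with ℕₚ.m≤n⇒m<n∨m≡n le
        ... | inj₁ lt = true-low Bz (i′ , lt , o)
        ... | inj₂ eq with Finₚ.toℕ-injective eq | low-true z J₀ j (trans (low≡ a b J₀ j) h)
        ... | refl | i″ , lt , o′ = true-low Bz (i″ , lt , orb-trans (c′ a b) o o′)

      module Active (h : low x J₀ j ≡ false) where

        -- The contribution of the other orbits, the same for all translates of x and for both
        -- stages `J₀` and `suc J₀`.
        C : Carrier
        C = ∏ (filterᵇ (not ∘ orb x y j) (allFin n)) (weight x J₀)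

        split : ∀ m a b → (V : W n → Fin n → Carrier) →
          (∀ i → Orb x y j i → weight (x · e a b) m i ≡ V (x · e a b) i) →
          (∀ i → ¬ Orb x y j i → low x m i ≡ low x J₀ i) →
          hybrid m (x · e a b) ≈ ∏ (orbit (x · e a b) j) (V (x · e a b)) ⊛ C
        split m a b V on off = ≈-trans (Prod.bigop-split (orb x y j) (allFin n) (weight z m))
          (*-cong (≈-trans (Prod.bigop-cong (orbit x j) (λ {i} i∈ → reflexive (on i (∈-orbit⁻ i∈))))
              (reflexive (cong (λ l → ∏ l (V z)) (sym (filterᵇ-cong (orb≡ a b j) (allFin n))))))
            (Prod.bigop-cong (filterᵇ (not ∘ orb x y j) (allFin n)) (λ {i} i∈ → reflexive (outside i (not-true (proj₂ (∈-filterᵇ⁻ (not ∘ orb x y j) (allFin n) i∈)))))))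
          where
          z = x · e a b
          outside : ∀ i → orb x y j i ≡ false → weight z m i ≡ weight x J₀ i
          outside i f = trans (cong₂ (λ u v → if low z m i then u else v) (off-a₁ a b i ¬o) (off-a₂ a b i ¬o))
              (cong (λ B → if B then a₁ x i else a₂ x i) (trans (low≡ a b m i) (off i ¬o)))
            where
            ¬o : ¬ Orb x y j i
            ¬o o = true≢false (true-orb Bx By o) f

        hybrid-W₂ : ∀ a b → hybrid J₀ (x · e a b) ≈ W₂ (x · e a b) ⊛ C
        hybrid-W₂ a b = split J₀ a b a₂ on (λ _ _ → refl)
          where
          on : ∀ i → Orb x y j i → weight (x · e a b) J₀ i ≡ a₂ (x · e a b) i
          on i o = cong (λ B → if B then a₁ (x · e a b) i else a₂ (x · e a b) i) (trans (low≡ a b J₀ i)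
            (≢true⇒false λ g → let i′ , lt , o′ = low-true x J₀ i g in true≢false (true-low Bx (i′ , lt , orb-trans c o o′)) h))

        hybrid-W₁ : ∀ a b → hybrid (suc J₀) (x · e a b) ≈ W₁ (x · e a b) ⊛ C
        hybrid-W₁ a b = split (suc J₀) a b a₁ on off
          where
          on : ∀ i → Orb x y j i → weight (x · e a b) (suc J₀) i ≡ a₁ (x · e a b) i
          on i o = cong (λ B → if B then a₁ (x · e a b) i else a₂ (x · e a b) i) (trans (low≡ a b (suc J₀) i)
            (true-low Bx (j , ℕₚ.≤-refl , orb-sym Bx By c o)))
          off : ∀ i → ¬ Orb x y j i → low x (suc J₀) i ≡ low x J₀ i
          off i ¬o = ⇔⇒≡ᵇ down (λ g → let i′ , lt , o = low-true x J₀ i g in true-low Bx (i′ , ℕₚ.m<n⇒m<1+n lt , o))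
            where
            down : low x (suc J₀) i ≡ true → low x J₀ i ≡ true
            down g with low-true x (suc J₀) i g
            ... | i′ , s≤s le , o with ℕₚ.m≤n⇒m<n∨m≡n le
            ... | inj₁ lt = true-low Bx (i′ , lt , o)
            ... | inj₂ eq with Finₚ.toℕ-injective eq
            ... | refl = ⊥-elim (¬o (orb-sym Bx By c o))

        gather : ∀ (V : W n → Carrier) m → (∀ a b → hybrid m (x · e a b) ≈ V (x · e a b) ⊛ C) →
          ∑ (upTo D) (λ a → hybrid m (x · e a false) ⊕ hybrid m (x · e a true)) ≈ C ⊛ ∑ (upTo D) (λ a → V (x · e a false) ⊕ V (x · e a true))
        gather V m v = ≈-trans (Sum.bigop-cong (upTo D) (λ {a} _ → ≈-trans (+-cong (v a false) (v a true)) (≈-trans (≈-sym (distribʳ _ _ _)) (*-comm _ _))))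
          (≈-sym (∑-*ˡ (upTo D) C _))

      average : ∑ (upTo D) (λ a → hybrid J₀ (x · e a false) ⊕ hybrid J₀ (x · e a true)) ≈
        ∑ (upTo D) (λ a → hybrid (suc J₀) (x · e a false) ⊕ hybrid (suc J₀) (x · e a true))
      average = go (low x J₀ j) refl
        where
        go : ∀ b → low x J₀ j ≡ b → ∑ (upTo D) (λ a → hybrid J₀ (x · e a false) ⊕ hybrid J₀ (x · e a true)) ≈
          ∑ (upTo D) (λ a → hybrid (suc J₀) (x · e a false) ⊕ hybrid (suc J₀) (x · e a true))
        go true h = Sum.bigop-cong (upTo D) (λ {a} _ → +-cong (settled h a false) (settled h a true))
        go false h = ≈-trans (gather W₂ J₀ hybrid-W₂) (≈-trans (*-congˡ (≈-sym (local-sum Bx c))) (≈-sym (gather W₁ (suc J₀) hybrid-W₁)))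
          where open Active h

    -- Translation by `e a b` permutes the centralizer of y, so each of the 2D translated sums
    -- equals the original one.
    spread : ∀ m → natR R D ⊛ (∑ Zy (hybrid m) ⊕ ∑ Zy (hybrid m)) ≈ ∑ Zy (λ x → ∑ (upTo D) (λ a → hybrid m (x · e a false) ⊕ hybrid m (x · e a true)))
    spread m = ≈-trans (≈-sym (∑-const D _)) (≈-trans (Sum.bigop-cong (upTo D) (λ {a} _ → ≈-trans (≈-sym (+-cong (translate m a false) (translate m a true)))
      (≈-sym (Sum.bigop-∙ Zy _ _)))) (Sum.bigop-swap (upTo D) Zy _))

    step : ∑ Zy (hybrid J₀) ≈ ∑ Zy (hybrid (suc J₀))
    -- The factors D and 2 introduced by averaging are cancelled here.
    step = natR-cancel 2 (s≤s z≤n) (≈-trans (double _) (≈-trans (natR-cancel D (s≤s z≤n) (≈-trans (spread J₀)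
        (≈-trans (Sum.bigop-cong Zy (λ x∈ → average (proj₁ (∈-Zy⁻ x∈)) (proj₂ (∈-Zy⁻ x∈)))) (≈-sym (spread (suc J₀)))))) (≈-sym (double _))))
      where
      double : ∀ r → natR R 2 ⊛ r ≈ r ⊕ r
      double r = ≈-trans (*-congʳ (+-congˡ (+-identityʳ 1#))) (≈-trans (distribʳ r 1# 1#) (+-cong (*-identityˡ r) (*-identityˡ r)))

  steps : ∀ m → m ≤ n → ∑ Zy (hybrid 0) ≈ ∑ Zy (hybrid m)
  steps zero _ = ≈-refl
  steps (suc m) m<n = ≈-trans (steps m (ℕₚ.<⇒≤ m<n)) (subst (λ k → ∑ Zy (hybrid k) ≈ ∑ Zy (hybrid (suc k))) (Finₚ.toℕ-fromℕ< m<n) (Step.step (fromℕ< m<n)))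

  hybrid-0 : ∀ x → hybrid 0 x ≈ ∏ (allFin n) (a₂ x)
  hybrid-0 x = Prod.bigop-cong (allFin n) (λ {i} _ → reflexive (cong (λ B → if B then a₁ x i else a₂ x i)
    (≢true⇒false λ h → ℕₚ.n≮0 (proj₁ (proj₂ (low-true x 0 i h))))))

  hybrid-n : ∀ {x} → IsB x → hybrid n x ≈ ∏ (allFin n) (a₁ x)
  hybrid-n {x} Bx = Prod.bigop-cong (allFin n) (λ {i} _ → reflexive (cong (λ B → if B then a₁ x i else a₂ x i)
    (true-low Bx (i , Finₚ.toℕ<n i , orb-refl i))))

  exchange : ∑ Zy (λ x → ∏ (allFin n) (a₁ x)) ≈ ∑ Zy (λ x → ∏ (allFin n) (a₂ x))
  exchange = ≈-trans (≈-sym (Sum.bigop-cong Zy (λ x∈ → hybrid-n (proj₁ (∈-Zy⁻ x∈))))) (≈-trans (≈-sym (steps n ℕₚ.≤-refl))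
    (Sum.bigop-cong Zy (λ {x} _ → hybrid-0 x)))

  -- The two sides as sums over the centralizer of y

  χ-∏ : ∀ x → sg (χneg x) ≈ ∏ (allFin n) (λ i → σ (act x (pt i)))
  χ-∏ x = go (allFin n)
    where
    go : ∀ is → sg (foldr (λ i b → b xor proj₂ (lookup x i)) false is) ≈ ∏ is (λ i → σ (act x (pt i)))
    go [] = ≈-refl
    go (i ∷ is) = ≈-trans (sg-xor (foldr (λ i b → b xor proj₂ (lookup x i)) false is) (proj₂ (lookup x i)))
      (≈-trans (*-comm _ _) (*-cong (reflexive (cong σ (sym (act-def x i false)))) (go is)))

  module _ (k : ℤ) (powK : ∀ (x : W n) → IsB x → ∀ p → act (powℤ x k) p ≡ iter′ x K p) where

    Matches : W n → (SP n → SP n) → Fin n → Bool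
    Matches x f i = eqSP (iter′ x K (pt i)) (f (pt i))

    equal? : ∀ {x w} → IsB x → eqW (powℤ x k) w ≡ false → ∃ λ i → Matches x (act w) i ≡ false
    equal? {x} {w} Bx h with all (Matches x (act w)) (allFin n) in eq
    ... | false = let i , _ , f = all-false (Matches x (act w)) (allFin n) eq in i , f
    ... | true = ⊥-elim (true≢false (true-eqW (W-ext same)) h)
      where
      same : ∀ p → act (powℤ x k) p ≡ act w p
      same p@(i , s) = trans (powK x Bx p) (trans (iter-negᵇ x K s (pt i)) (trans (cong (negᵇ s) (eqSP-true {p = iter′ x K (pt i)} {act w (pt i)} (all-true (Matches x (act w)) (allFin n) eq (Memₚ.∈-allFin i))))
        (sym (act-negᵇ w s (pt i)))))

    equal : ∀ {x w} → IsB x → eqW (powℤ x k) w ≡ true → ∀ p → iter′ x K p ≡ act w p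
    equal {x} {w} Bx h p = trans (sym (powK x Bx p)) (cong (λ w → act w p) (eqW-true {v = powℤ x k} {w} h))

    sroots-a₁ : sroots R k n y ≈ ∑ Zy (λ x → ∏ (allFin n) (a₁ x))
    sroots-a₁ = ≈-trans (reflexive (sumR-map _ (filterᵇ P (Bn n)))) (≈-trans (Sum.bigop-filterᵇ P (Bn n) _)
      (≈-trans (Sum.bigop-cong (Bn n) (λ x∈ → term (∈-Bn⁻ x∈))) (≈-sym (Sum.bigop-filterᵇ (λ x → inZ x y) (Bn n) _))))
      where
      P : W n → Bool
      P x = eqW (powℤ x k) y
      term : ∀ {x} → IsB x → (if P x then (if χneg x then - 1# else 1#) else 0#) ≈ (if inZ x y then ∏ (allFin n) (a₁ x) else 0#)
      term {x} Bx = go (P x) (inZ x y) refl refl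
        where
        go : ∀ b b′ → P x ≡ b → inZ x y ≡ b′ → (if b then sg (χneg x) else 0#) ≈ (if b′ then ∏ (allFin n) (a₁ x) else 0#)
        go true true eq _ = ≈-trans (χ-∏ x) (Prod.bigop-cong (allFin n) (λ {i} _ → reflexive (cong (λ B → if B then σ (act x (pt i)) else 0#)
          (sym (true-eqSP {p = iter′ x K (pt i)} (equal Bx eq (pt i)))))))
        -- x commutes with its own power x^K = y.
        go true false eq eq′ = ⊥-elim (true≢false (true-inZ {x = x} {y} (mkC λ p →
          trans (cong (act x) (sym (equal Bx eq p))) (trans (sym (iter-act x K p)) (equal Bx eq (act x p))))) eq′)
        go false false _ _ = ≈-refl
        go false true eq _ with equal? Bx eq
        ... | i , f = ≈-sym (∏-zero (allFin n) (a₁ x) (Memₚ.∈-allFin i) (reflexive (cong (λ B → if B then σ (act x (pt i)) else 0#) f)))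

    open Characters R n ζ ζᴺ k K powK

    sumψ-a₂ : sumψ R ζ k n y ≈ ∑ Zy (λ x → ∏ (allFin n) (a₂ x))
    sumψ-a₂ = ≈-trans (sumψ-Ω By) (≈-trans (Sum.bigop-filterᵇ rootOfMinus (Bn n) _)
      (≈-trans (Sum.bigop-cong (Bn n) (λ x∈ → value (∈-Bn⁻ x∈))) (≈-sym (Sum.bigop-filterᵇ (λ x → inZ x y) (Bn n) _))))
      where
      value : ∀ {x} → IsB x → (if rootOfMinus x then term By x else 0#) ≈ (if inZ x y then ∏ (allFin n) (a₂ x) else 0#)
      value {x} Bx = go (rootOfMinus x) (inZ x y) refl
        where
        go : ∀ b b′ → rootOfMinus x ≡ b → (if b then (if b′ then Ω x y else 0#) else 0#) ≈ (if b′ then ∏ (allFin n) (a₂ x) else 0#)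
        go true true eq = ≈-trans (Prod.bigop-filterᵇ (isBase x) (allFin n) _) (Prod.bigop-cong (allFin n) (λ {i} _ → reflexive
          (cong (λ B → if B then (if isBase x i then θ x (act y (pt i)) else 1#) else 0#)
            (sym (true-eqSP {p = iter′ x K (pt i)} (trans (equal Bx eq (pt i)) (act-w0 (pt i))))))))
        go true false _ = ≈-refl
        go false false _ = ≈-refl
        go false true eq with equal? Bx eq
        ... | i , f = ≈-sym (∏-zero (allFin n) (a₂ x) (Memₚ.∈-allFin i) (reflexive
          (cong (λ B → if B then (if isBase x i then θ x (act y (pt i)) else 1#) else 0#) (trans (cong (eqSP (iter′ x K (pt i))) (sym (act-w0 (pt i)))) f))))

theorem6p6 : {c ℓ : Level} (R : CommutativeRing c ℓ)
    → (∀ a b → CommutativeRing._≈_ R (CommutativeRing._*_ R a b) (CommutativeRing.0# R)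
    → CommutativeRing._≈_ R a (CommutativeRing.0# R) ⊎ CommutativeRing._≈_ R b (CommutativeRing.0# R))
    → (∀ m → ¬ CommutativeRing._≈_ R (natR R (suc m)) (CommutativeRing.0# R))
    → (k : ℤ) (n : ℕ) (ζ : CommutativeRing.Carrier R)
    → CommutativeRing._≈_ R (powR R ζ (Nord n)) (CommutativeRing.1# R)
    → (∀ j → 0 < j → j < Nord n → ¬ CommutativeRing._≈_ R (powR R ζ j) (CommutativeRing.1# R))
    → (y : W n) → isBn y ≡ true
    → CommutativeRing._≈_ R (sroots R k n y) (sumψ R ζ k n y)
theorem6p6 R domain char0 k n ζ ζᴺ prim y y∈ with powℤ-nat n k
... | K , powK = CommutativeRing.trans R (sroots-a₁ k powK) (CommutativeRing.trans R exchange (CommutativeRing.sym R (sumψ-a₂ k powK)))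
  where open Hybrid R domain char0 n ζ ζᴺ prim K {y} (isBn-true y∈)
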